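{- With $Q:=q^{71}$, the following hold: $$2q^3E(q)E(Q)=(3,1,6)-(4,3,5),$$ $$2qE(q)E(Q)U(1,71,q)^2=(3,1,6)-(4,3,5)-(2,1,9)+(1,1,18),$$ $$2q^2E(q)E(Q)U(1,71,q)=(2,1,9)-(3,1,6),$$ $$2qU(1,71,q^2)=-2q^3+\kappa(q)\kappa(Q)-\kappa(-q)\kappa(-Q)-2q^9\frac{1}{\kappa(-q^2)\kappa(-Q^2)},$$ $$\big((3,1,6)-(4,3,5)-(2,1,9)+(1,1,18)\big)\big((3,1,6)-(4,3,5)\big)=\big((2,1,9)-(3,1,6)\big)^2.$$
   Context: Let $|q|<1$, $(a;q)_\infty=\prod_{k\ge0}(1-aq^k)$, $(a;q)_n=\prod_{k=0}^{n-1}(1-aq^k)$. $G(q)=\sum_{n\ge0}\frac{q^{n^2}}{(q;q)_n}$, $H(q)=\sum_{n\ge0}\frac{q^{n(n+1)}}{(q;q)_n}$. For positive integers $r,s$, $U(r,s,q)=G(q^r)G(q^s)+q^{(s+r)/5}H(q^r)H(q^s)$ if $s+r\equiv0\pmod5$ and $U(r,s,q)=H(q^r)G(q^s)-q^{(s-r)/5}G(q^r)H(q^s)$ if $s-r\equiv0\pmod5$; $U(r,s,x)$ denotes this expression with $q$ replaced by $x$. $E(q)=(q;q)_\infty$, $\kappa(q)=(-q;q^2)_\infty$. For integers $a,b,c$ with $a,c>0$, $b^2-4ac<0$, $(a,b,c)$ denotes $\sum_{n,m=-\infty}^{\infty}q^{an^2+bnm+cm^2}$. -}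

module Defs where

-- Formal power series in q with integer coefficients, represented by their
-- coefficient sequences.  All identities of the paper are identities of
-- q-series converging for |q| < 1; by the identity theorem they are
-- equivalent to coefficientwise equalities of the formal expansions.

open import Data.Nat as ℕ using (ℕ; zero; suc; _∸_; _≤ᵇ_; _≡ᵇ_; NonZero)
open import Data.Nat.DivMod using (_/_; _%_)
open import Data.Integer as ℤ using (ℤ; +_; -_)
open import Data.List using (List; []; _∷_; upTo; map; foldr; filter; length; concatMap)
open import Data.Bool using (Bool; true; false; if_then_else_)
open import Relation.Binary.PropositionalEquality using (_≡_)
open import Relation.Nullary.Decidable using (⌊_⌋)

PS : Set
PS = ℕ → ℤ

infix 4 _≐_
_≐_ : PS → PS → Set
f ≐ g = ∀ n → f n ≡ g n

sumℤ : List ℤ → ℤ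
sumℤ = foldr ℤ._+_ (+ 0)

infixl 6 _⊕_ _⊖_
infixl 7 _⊛_

_⊕_ : PS → PS → PS
(f ⊕ g) n = f n ℤ.+ g n

_⊖_ : PS → PS → PS
(f ⊖ g) n = f n ℤ.- g n

_⊛_ : PS → PS → PS
(f ⊛ g) n = sumℤ (map (λ i → f i ℤ.* g (n ∸ i)) (upTo (suc n)))

_·_ : ℤ → PS → PS
(c · f) n = c ℤ.* f n

mono : ℕ → PS
mono k n = if k ≡ᵇ n then + 1 else + 0

one : PS
one = mono 0

prodPS : List PS → PS
prodPS = foldr _⊛_ one

substPow : (k : ℕ) → .{{NonZero k}} → PS → PS
substPow k f n = if (n % k) ≡ᵇ 0 then f (n / k) else + 0

negArg : PS → PS
negArg f n = if (n % 2) ≡ᵇ 0 then f n else - f n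

-- Multiplicative inverse of a series with constant term 1:
-- g 0 = 1,  g n = - Σ_{i=1}^{n} f i * g (n - i).
-- invUpTo f N is a sequence whose coefficients 0..N are those of 1/f.
invUpTo : PS → ℕ → PS
invUpTo f zero k = if k ≡ᵇ 0 then + 1 else + 0
invUpTo f (suc N) k =
  if k ≤ᵇ N then prev k
  else (if k ≡ᵇ suc N
        then - sumℤ (map (λ i → f (suc i) ℤ.* prev (N ∸ i)) (upTo (suc N)))
        else + 0)
  where prev = invUpTo f N

inv1 : PS → PS
inv1 f n = invUpTo f n n

qPoch : ℕ → PS
qPoch n = prodPS (map (λ k → one ⊖ mono (suc k)) (upTo n))

-- E(q) = (q;q)_∞ : the coefficient of q^N only depends on the factors
-- (1 - q^k) with k ≤ N.
E : PS
E N = qPoch N N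

κ : PS
κ N = prodPS (map (λ k → one ⊕ mono (suc (2 ℕ.* k))) (upTo (suc N))) N

-- G(q) = Σ_{n≥0} q^{n²}/(q;q)_n ; terms with n > N do not contribute to q^N
G : PS
G N = sumℤ (map (λ n → (mono (n ℕ.* n) ⊛ inv1 (qPoch n)) N) (upTo (suc N)))

H : PS
H N = sumℤ (map (λ n → (mono (n ℕ.* suc n) ⊛ inv1 (qPoch n)) N) (upTo (suc N)))

-- U(r,s,q): first case if 5 ∣ s + r, otherwise the second case
-- (intended when 5 ∣ s - r, s ≥ r).
U : (r s : ℕ) → .{{NonZero r}} → .{{NonZero s}} → PS
U r s =
  if ((s ℕ.+ r) % 5) ≡ᵇ 0
  then substPow r G ⊛ substPow s G ⊕ mono ((s ℕ.+ r) / 5) ⊛ substPow r H ⊛ substPow s H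
  else substPow r H ⊛ substPow s G ⊖ mono ((s ∸ r) / 5) ⊛ substPow r G ⊛ substPow s H

intRange : ℕ → List ℤ
intRange B = map (λ i → + i ℤ.- + B) (upTo (suc (2 ℕ.* B)))

-- the theta series (a,b,c) = Σ_{n,m ∈ ℤ} q^{a n² + b n m + c m²},
-- for a, c > 0 and b² - 4ac < 0.  Coefficient of q^N = number of
-- (n,m) ∈ ℤ² with a n² + b n m + c m² = N.  For such forms
-- 4aN ≥ m² and 4cN ≥ n², so |n| ≤ 4cN, |m| ≤ 4aN contains all solutions.
theta : ℤ → ℤ → ℤ → PS
theta a b c N =
  + length (filter (λ v → v ℤ.≟ + N)
     (concatMap (λ n → map (λ m → a ℤ.* n ℤ.* n ℤ.+ b ℤ.* n ℤ.* m ℤ.+ c ℤ.* m ℤ.* m)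
                           (intRange (4 ℕ.* ℤ.∣ a ∣ ℕ.* N)))
                (intRange (4 ℕ.* ℤ.∣ c ∣ ℕ.* N))))

⟪_,_,_⟫ : ℕ → ℕ → ℕ → PS
⟪ a , b , c ⟫ = theta (+ a) (+ b) (+ c)

{-# OPTIONS --safe #-}
module Submission where

-- Write A = E(q) G(q), B = E(q) H(q).  Iterating the Bailey lemma from the unit Bailey pairs turns E, A and B into
-- theta series Σ ±q^e(j), where e(j) completes to a square over 24 or 40.  The Jacobi triple product gives
-- A B = E(q) E(q⁵), and averaging over the units of ℤ[ω] gives two cases of the quintuple product identity; together
-- they make E G², E G H and E H² theta series too, now with squares over 120.
-- Hence E(q) E(Q) times 1, U or U² is a sum of ±1 over the solutions of x² + 71 y² = M N with M = 24, 40, 120, the sign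
-- depending only on x and y mod M / 2.  A form of discriminant -71 likewise counts the solutions in a lattice
-- x ≡ c y mod M / 2.  After averaging over the signs of x and y the two weights agree on every residue class, which is a
-- finite check.  Multiplying the identity for U(q²) by E(q²) E(Q²) reduces it in the same way (M = 48) to the action of the
-- Hecke operator T₂ on (3,1,6) - (4,3,5), and the last identity follows from the first three.

open import Defs
open import Algebra.Bundles using (CommutativeRing)
open import Algebra.Solver.Ring.AlmostCommutativeRing using (fromCommutativeRing; _-Raw-AlmostCommutative⟶_)
open import Data.Bool using (Bool; true; false; if_then_else_; _∧_; T)
open import Data.Empty using (⊥-elim)
open import Data.Integer as ℤ using (ℤ; +_; -[1+_]; -_; _+_; _*_; _-_; ∣_∣; _≟_)
open import Data.Integer.DivMod as ℤ using (_%ℕ_; _/ℕ_)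
import Data.Integer.Properties as ℤ
open import Data.Integer.Tactic.RingSolver using (solve-∀)
open import Data.List using (List; []; _∷_; _++_; map; upTo; cartesianProduct; filter; length; concatMap)
import Data.List.Properties as List
open import Data.List.Relation.Unary.All using (All; []; _∷_)
open import Data.Maybe using (Maybe; just; nothing)
open import Data.Nat as ℕ using (ℕ; zero; suc; _∸_; _≤_; _<_; _≤ᵇ_; _≡ᵇ_; z≤n; s≤s; NonZero)
open import Data.Nat.DivMod as ℕ using (_/_; _%_)
import Data.Nat.Properties as ℕ
open import Data.Nat.Tactic.RingSolver using () renaming (solve-∀ to ℕ-solve-∀)
open import Data.Product using (_×_; _,_; proj₁; proj₂; ∃)
open import Data.Product.Properties using (≡-dec)
open import Data.Sum using (_⊎_; inj₁; inj₂)
open import Function using (_∘_; id)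
open import Level using (0ℓ)
open import Relation.Binary using (DecidableEquality)
open import Relation.Binary.PropositionalEquality using (_≡_; refl; sym; trans; cong; cong₂; subst; module ≡-Reasoning)
open import Relation.Nullary using (yes; no; ¬_; Dec)
open import Algebra.Properties.AbelianGroup ℤ.+-0-abelianGroup using () renaming (∙-cancelˡ to +-cancelˡ)

-- Each finite check has the same form: a weighted number of points with a definite form equal to K,
-- `rep`, must vanish for K = κ₀ + M n and all n. The weights are periodic and K is fixed modulo M,
-- so evaluating the weights on residue classes decides it. The powers of q in the theorem are those
-- that make κ₀ = 0: (1 + 71)/24 = 3, (9 + 71)/40 = 2, (49 + 71)/120 = 1. E G and E H alone do not
-- suffice: in E(q) E(Q) U² each variable carries one E but two of the factors G, H. Hence E G², E G
-- H and E H², which are found by multiplying with E times a theta series and cancelling it. In the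
-- identity for U(q²), κ(q) E(q²) = E(-q) turns κ(q) κ(Q) and κ(-q) κ(-Q) into E(-q) E(-Q) and E(q)
-- E(Q). Since q³ is odd, their difference becomes minus twice the even part of q³ E(q) E(Q); this
-- is how coefficients at 2 n, and with them T₂, enter. Limits are agreements of finitely many
-- coefficients: precision lost in one factor is repaired by the order of vanishing of the term it
-- multiplies.

private
  variable
    A B : Set
    f g h : PS
    n : ℕ


-- Finite sums of integers

∑ : List A → (A → ℤ) → ℤ
∑ xs φ = sumℤ (map φ xs)

∑-cong : ∀ (xs : List A) {φ ψ : A → ℤ} → (∀ x → φ x ≡ ψ x) → ∑ xs φ ≡ ∑ xs ψ
∑-cong []       eq = refl
∑-cong (x ∷ xs) eq = cong₂ _+_ (eq x) (∑-cong xs eq)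

∑-+ : ∀ (xs : List A) (φ ψ : A → ℤ) → ∑ xs (λ x → φ x + ψ x) ≡ ∑ xs φ + ∑ xs ψ
∑-+ []       φ ψ = refl
∑-+ (x ∷ xs) φ ψ = trans (cong (_+_ (φ x + ψ x)) (∑-+ xs φ ψ)) (interchange (φ x) (ψ x) (∑ xs φ) (∑ xs ψ))
  where
  interchange : ∀ a b c d → a + b + (c + d) ≡ a + c + (b + d)
  interchange = solve-∀

∑-*ˡ : ∀ (xs : List A) c (φ : A → ℤ) → ∑ xs (λ x → c * φ x) ≡ c * ∑ xs φ
∑-*ˡ []       c φ = sym (ℤ.*-zeroʳ c)
∑-*ˡ (x ∷ xs) c φ = trans (cong (_+_ (c * φ x)) (∑-*ˡ xs c φ)) (sym (ℤ.*-distribˡ-+ c (φ x) (∑ xs φ)))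

∑-0 : ∀ (xs : List A) → ∑ xs (λ _ → + 0) ≡ + 0
∑-0 []       = refl
∑-0 (x ∷ xs) = trans (ℤ.+-identityˡ _) (∑-0 xs)

∑-swap : ∀ (xs : List A) (ys : List B) (φ : A → B → ℤ) →
         ∑ xs (λ x → ∑ ys (φ x)) ≡ ∑ ys (λ y → ∑ xs (λ x → φ x y))
∑-swap []       ys φ = sym (∑-0 ys)
∑-swap (x ∷ xs) ys φ = trans (cong (_+_ (∑ ys (φ x))) (∑-swap xs ys φ)) (sym (∑-+ ys (φ x) _))

∑-map : ∀ (xs : List A) (k : A → B) (φ : B → ℤ) → ∑ (map k xs) φ ≡ ∑ xs (φ ∘ k)
∑-map xs k φ = cong sumℤ (sym (List.map-∘ xs))

∑-upTo-suc : ∀ n (φ : ℕ → ℤ) → ∑ (upTo (suc n)) φ ≡ φ 0 + ∑ (upTo n) (φ ∘ suc)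
∑-upTo-suc n φ = cong (λ l → φ 0 + sumℤ l)
  (trans (List.map-applyUpTo suc φ n) (sym (List.map-applyUpTo id (φ ∘ suc) n)))

∑-upTo-last : ∀ n (φ : ℕ → ℤ) → ∑ (upTo (suc n)) φ ≡ ∑ (upTo n) φ + φ n
∑-upTo-last zero    φ = ℤ.+-comm (φ 0) (+ 0)
∑-upTo-last (suc n) φ = begin
  ∑ (upTo (suc (suc n))) φ                        ≡⟨ ∑-upTo-suc (suc n) φ ⟩
  φ 0 + ∑ (upTo (suc n)) (φ ∘ suc)              ≡⟨ cong (_+_ (φ 0)) (∑-upTo-last n (φ ∘ suc)) ⟩
  φ 0 + (∑ (upTo n) (φ ∘ suc) + φ (suc n))    ≡⟨ sym (ℤ.+-assoc (φ 0) _ _) ⟩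
  φ 0 + ∑ (upTo n) (φ ∘ suc) + φ (suc n)      ≡⟨ cong (_+ φ (suc n)) (sym (∑-upTo-suc n φ)) ⟩
  ∑ (upTo (suc n)) φ + φ (suc n)                ∎
  where open ≡-Reasoning

-- The ring of formal power series

infix 4 _≈_ _~[_]_

-- A record rather than ≐ itself, so that both sides can be inferred.
record _≈_ (f g : PS) : Set where
  constructor mk
  field at : f ≐ g
open _≈_ public

-- Congruence modulo q^(n+1). It is the only notion of limit: an infinite sum or product is
-- exchanged for a finite one that agrees with it up to `n`.
_~[_]_ : PS → ℕ → PS → Set
f ~[ n ] g = ∀ i → i ≤ n → f i ≡ g i

⊛-zero : ∀ f g → (f ⊛ g) 0 ≡ f 0 * g 0
⊛-zero f g = ℤ.+-identityʳ _

-- Peeling off the constant coefficient of the left factor makes `⊛` a recursion on the index; the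
-- ring laws below are inductions along it.
⊛-suc : ∀ f g n → (f ⊛ g) (suc n) ≡ f 0 * g (suc n) + ((f ∘ suc) ⊛ g) n
⊛-suc f g n = ∑-upTo-suc (suc n) (λ i → f i * g (suc n ∸ i))

⊛-sucʳ : ∀ f g n → (f ⊛ g) (suc n) ≡ f (suc n) * g 0 + (f ⊛ (g ∘ suc)) n
⊛-sucʳ f g zero = trans (⊛-suc f g 0) (trans (cong (_+_ (f 0 * g 1)) (⊛-zero (f ∘ suc) g))
  (trans (ℤ.+-comm (f 0 * g 1) _) (cong (_+_ (f 1 * g 0)) (sym (⊛-zero f (g ∘ suc))))))
⊛-sucʳ f g (suc n) = begin
  (f ⊛ g) (suc (suc n))                                      ≡⟨ ⊛-suc f g (suc n) ⟩
  a + ((f ∘ suc) ⊛ g) (suc n)                              ≡⟨ cong (_+_ a) (⊛-sucʳ (f ∘ suc) g n) ⟩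
  a + (b + c)                                            ≡⟨ swap a b c ⟩
  b + (a + c)                                            ≡⟨ cong (_+_ b) (sym (⊛-suc f (g ∘ suc) n)) ⟩
  b + (f ⊛ (g ∘ suc)) (suc n)                              ∎
  where
  open ≡-Reasoning
  a = f 0 * g (suc (suc n))
  b = f (suc (suc n)) * g 0
  c = ((f ∘ suc) ⊛ (g ∘ suc)) n
  swap : ∀ x y z → x + (y + z) ≡ y + (x + z)
  swap = solve-∀

⊛-comm : ∀ f g n → (f ⊛ g) n ≡ (g ⊛ f) n
⊛-comm f g zero    = trans (⊛-zero f g) (trans (ℤ.*-comm (f 0) (g 0)) (sym (⊛-zero g f)))
⊛-comm f g (suc n) = trans (⊛-suc f g n)
  (trans (cong₂ _+_ (ℤ.*-comm (f 0) (g (suc n))) (⊛-comm (f ∘ suc) g n)) (sym (⊛-sucʳ g f n)))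

⊛-cong~ : ∀ {f f′ g g′} n → f ~[ n ] f′ → g ~[ n ] g′ → (f ⊛ g) n ≡ (f′ ⊛ g′) n
⊛-cong~ {f} {f′} {g} {g′} zero    p q = cong₂ (λ a b → a * b + + 0) (p 0 z≤n) (q 0 z≤n)
⊛-cong~ {f} {f′} {g} {g′} (suc n) p q = trans (⊛-suc f g n)
  (trans (cong₂ _+_ (cong₂ _*_ (p 0 z≤n) (q (suc n) ℕ.≤-refl))
                      (⊛-cong~ n (λ i i≤n → p (suc i) (s≤s i≤n)) (λ i i≤n → q i (ℕ.m≤n⇒m≤1+n i≤n))))
         (sym (⊛-suc f′ g′ n)))

⊛-distribʳ : ∀ h f g n → ((f ⊕ g) ⊛ h) n ≡ (f ⊛ h) n + (g ⊛ h) n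
⊛-distribʳ h f g n = trans (∑-cong (upTo (suc n)) (λ i → ℤ.*-distribʳ-+ (h (n ∸ i)) (f i) (g i)))
                           (∑-+ (upTo (suc n)) (λ i → f i * h (n ∸ i)) (λ i → g i * h (n ∸ i)))

⊛-scale : ∀ c f g n → ((c · f) ⊛ g) n ≡ c * (f ⊛ g) n
⊛-scale c f g n = trans (∑-cong (upTo (suc n)) (λ i → ℤ.*-assoc c (f i) (g (n ∸ i)))) (∑-*ˡ (upTo (suc n)) c _)

⊛-assoc : ∀ f g h n → ((f ⊛ g) ⊛ h) n ≡ (f ⊛ (g ⊛ h)) n
⊛-assoc f g h zero    = begin
  ((f ⊛ g) ⊛ h) 0            ≡⟨ ⊛-zero (f ⊛ g) h ⟩
  (f ⊛ g) 0 * h 0          ≡⟨ cong (_* h 0) (⊛-zero f g) ⟩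
  f 0 * g 0 * h 0        ≡⟨ ℤ.*-assoc (f 0) (g 0) (h 0) ⟩
  f 0 * (g 0 * h 0)      ≡⟨ cong (f 0 ℤ.*_) (sym (⊛-zero g h)) ⟩
  f 0 * (g ⊛ h) 0          ≡⟨ sym (⊛-zero f (g ⊛ h)) ⟩
  (f ⊛ (g ⊛ h)) 0            ∎
  where open ≡-Reasoning
⊛-assoc f g h (suc n) = begin
  ((f ⊛ g) ⊛ h) (suc n)
    ≡⟨ ⊛-suc (f ⊛ g) h n ⟩
  (f ⊛ g) 0 * h (suc n) + (((f ⊛ g) ∘ suc) ⊛ h) n
    ≡⟨ cong₂ _+_ (cong (_* h (suc n)) (⊛-zero f g))
         (⊛-cong~ {g = h} n (λ i _ → ⊛-suc f g i) (λ _ _ → refl)) ⟩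
  f 0 * g 0 * h (suc n) + (((f 0 · (g ∘ suc)) ⊕ ((f ∘ suc) ⊛ g)) ⊛ h) n
    ≡⟨ cong (_+_ (f 0 * g 0 * h (suc n)))
         (trans (⊛-distribʳ h (f 0 · (g ∘ suc)) ((f ∘ suc) ⊛ g) n)
                (cong₂ _+_ (⊛-scale (f 0) (g ∘ suc) h n) (⊛-assoc (f ∘ suc) g h n))) ⟩
  f 0 * g 0 * h (suc n) + (f 0 * ((g ∘ suc) ⊛ h) n + ((f ∘ suc) ⊛ (g ⊛ h)) n)
    ≡⟨ regroup (f 0) (g 0) (h (suc n)) (((g ∘ suc) ⊛ h) n) (((f ∘ suc) ⊛ (g ⊛ h)) n) ⟩
  f 0 * (g 0 * h (suc n) + ((g ∘ suc) ⊛ h) n) + ((f ∘ suc) ⊛ (g ⊛ h)) n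
    ≡⟨ cong (λ z → f 0 * z + ((f ∘ suc) ⊛ (g ⊛ h)) n) (sym (⊛-suc g h n)) ⟩
  f 0 * (g ⊛ h) (suc n) + ((f ∘ suc) ⊛ (g ⊛ h)) n
    ≡⟨ sym (⊛-suc f (g ⊛ h) n) ⟩
  (f ⊛ (g ⊛ h)) (suc n) ∎
  where
  open ≡-Reasoning
  regroup : ∀ a b c d e → a * b * c + (a * d + e) ≡ a * (b * c + d) + e
  regroup = solve-∀

⊝_ : PS → PS
(⊝ f) n = - f n

const : ℤ → PS
const c zero    = c
const c (suc n) = + 0

-- Constants of the form `const`, so that they are images of integers under the coefficient map
-- `const-hom` of the ring solver. The series `one` of the definitions agrees with `𝟙` only
-- coefficientwise.
𝟘 𝟙 : PS
𝟘 = const (+ 0)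
𝟙 = const (+ 1)

𝟘-at : ∀ n → 𝟘 n ≡ + 0
𝟘-at zero    = refl
𝟘-at (suc n) = refl

const-⊛-at : ∀ c f n → (const c ⊛ f) n ≡ c * f n
const-⊛-at c f zero    = ⊛-zero (const c) f
const-⊛-at c f (suc n) = trans (⊛-suc (const c) f n) (trans (cong (_+_ (c * f (suc n))) (0-⊛ n)) (ℤ.+-identityʳ _))
  where
  0-⊛ : ∀ n → ((λ _ → + 0) ⊛ f) n ≡ + 0
  0-⊛ n = trans (∑-cong (upTo (suc n)) (λ i → ℤ.*-zeroˡ (f (n ∸ i)))) (∑-0 (upTo (suc n)))

𝟙-⊛ : ∀ f n → (𝟙 ⊛ f) n ≡ f n
𝟙-⊛ f n = trans (const-⊛-at (+ 1) f n) (ℤ.*-identityˡ (f n))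

≈-refl : f ≈ f
≈-refl .at n = refl

≈-sym : f ≈ g → g ≈ f
≈-sym p .at n = sym (p .at n)

≈-trans : f ≈ g → g ≈ h → f ≈ h
≈-trans p q .at n = trans (p .at n) (q .at n)

PSRing : CommutativeRing 0ℓ 0ℓ
PSRing = record
  { Carrier = PS ; _≈_ = _≈_ ; _+_ = _⊕_ ; _*_ = _⊛_ ; -_ = ⊝_ ; 0# = 𝟘 ; 1# = 𝟙
  ; isCommutativeRing = record
    { isRing = record
      { +-isAbelianGroup = record
        { isGroup = record
          { isMonoid = record
            { isSemigroup = record
              { isMagma = record
                { isEquivalence = record { refl = ≈-refl ; sym = ≈-sym ; trans = ≈-trans }
                ; ∙-cong = λ p q → mk λ n → cong₂ _+_ (p .at n) (q .at n) }
              ; assoc = λ f g h → mk λ n → ℤ.+-assoc (f n) (g n) (h n) }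
            ; identity = (λ f → mk λ n → trans (cong (_+ f n) (𝟘-at n)) (ℤ.+-identityˡ (f n)))
                         , (λ f → mk λ n → trans (cong (_+_ (f n)) (𝟘-at n)) (ℤ.+-identityʳ (f n))) }
          ; inverse = (λ f → mk λ n → trans (ℤ.+-inverseˡ (f n)) (sym (𝟘-at n)))
                    , (λ f → mk λ n → trans (ℤ.+-inverseʳ (f n)) (sym (𝟘-at n)))
          ; ⁻¹-cong = λ p → mk λ n → cong -_ (p .at n) }
        ; comm = λ f g → mk λ n → ℤ.+-comm (f n) (g n) }
      ; *-cong = λ p q → mk λ n → ⊛-cong~ n (λ i _ → p .at i) (λ i _ → q .at i)
      ; *-assoc = λ f g h → mk (⊛-assoc f g h)
      ; *-identity = (λ f → mk (𝟙-⊛ f)) , (λ f → mk λ n → trans (⊛-comm f 𝟙 n) (𝟙-⊛ f n))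
      ; distrib = (λ h f g → mk λ n → trans (⊛-comm h (f ⊕ g) n) (trans (⊛-distribʳ h f g n)
                     (cong₂ _+_ (⊛-comm f h n) (⊛-comm g h n))))
                , (λ h f g → mk (⊛-distribʳ h f g)) }
    ; *-comm = λ f g → mk (⊛-comm f g) } }

open CommutativeRing PSRing public using (setoid)
  renaming ( +-cong to ⊕-cong; *-cong to ⊛-cong; -‿cong to ⊝-cong; *-assoc to ⊛-≈-assoc; *-comm to ⊛-≈-comm
           ; *-identityˡ to ⊛-identityˡ; *-identityʳ to ⊛-identityʳ; distribʳ to ⊛-⊕-distribʳ; distribˡ to ⊛-⊕-distribˡ
           ; +-identityˡ to ⊕-identityˡ; +-identityʳ to ⊕-identityʳ; zeroˡ to ⊛-zeroˡ; zeroʳ to ⊛-zeroʳ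
           ; +-assoc to ⊕-assoc; +-comm to ⊕-comm)

const-⊛ : ∀ c f → const c ⊛ f ≈ c · f
const-⊛ c f = mk (const-⊛-at c f)

one≈𝟙 : one ≈ 𝟙
one≈𝟙 .at zero    = refl
one≈𝟙 .at (suc n) = refl

const-hom : ℤ.+-*-rawRing -Raw-AlmostCommutative⟶ fromCommutativeRing PSRing
const-hom = record
  { ⟦_⟧ = const
  ; +-homo = λ a b → mk λ { zero → refl ; (suc n) → refl }
  ; *-homo = λ a b → mk λ { zero → sym (ℤ.+-identityʳ _)
                          ; (suc n) → sym (trans (const-⊛ a (const b) .at (suc n)) (ℤ.*-zeroʳ a)) }
  ; -‿homo = λ a → mk λ { zero → refl ; (suc n) → refl }
  ; 0-homo = ≈-refl
  ; 1-homo = ≈-refl }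

const≟ : ∀ a b → Maybe (const a ≈ const b)
const≟ a b with a ≟ b
... | yes refl = just ≈-refl
... | no _     = nothing

open import Algebra.Solver.Ring ℤ.+-*-rawRing (fromCommutativeRing PSRing) const-hom const≟
  using (Polynomial; con; _:+_; _:*_; _:-_; :-_; _:=_; solve) public

open import Relation.Binary.Reasoning.Setoid setoid public
  using (begin_; step-≈-⟩; step-≈-⟨; _∎)

≡⇒≈ : f ≡ g → f ≈ g
≡⇒≈ refl = ≈-refl

~⇒≈ : (∀ n → f ~[ n ] g) → f ≈ g
~⇒≈ p .at n = p n n ℕ.≤-refl

~-sym : f ~[ n ] g → g ~[ n ] f
~-sym p i i≤n = sym (p i i≤n)

~-mono : ∀ {m n} → m ≤ n → f ~[ n ] g → f ~[ m ] g
~-mono m≤n p i i≤m = p i (ℕ.≤-trans i≤m m≤n)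

~-⊛ : ∀ {f f′ g g′ n} → f ~[ n ] f′ → g ~[ n ] g′ → f ⊛ g ~[ n ] f′ ⊛ g′
~-⊛ {f} {f′} {g} {g′} p q i i≤n = ⊛-cong~ {f} {f′} {g} {g′} i (~-mono {f} {f′} i≤n p) (~-mono {g} {g′} i≤n q)

⊛-congˡ : ∀ f {g h} → g ≈ h → f ⊛ g ≈ f ⊛ h
⊛-congˡ f = ⊛-cong (≈-refl {f})

⊛-congʳ : ∀ h {f g} → f ≈ g → f ⊛ h ≈ g ⊛ h
⊛-congʳ h p = ⊛-cong p (≈-refl {h})

⊕-congˡ : ∀ f {g h} → g ≈ h → f ⊕ g ≈ f ⊕ h
⊕-congˡ f = ⊕-cong (≈-refl {f})

⊕-congʳ : ∀ h {f g} → f ≈ g → f ⊕ h ≈ g ⊕ h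
⊕-congʳ h p = ⊕-cong p (≈-refl {h})

⊖-cong : ∀ {f f′ g g′} → f ≈ f′ → g ≈ g′ → f ⊖ g ≈ f′ ⊖ g′
⊖-cong p q = ⊕-cong p (⊝-cong q)

one-⊛ : ∀ f → one ⊛ f ≈ f
one-⊛ f = ≈-trans (⊛-congʳ f one≈𝟙) (⊛-identityˡ f)

-- Monomials, inverses and cancellation

mono-⊛-0 : ∀ k f → (mono (suc k) ⊛ f) 0 ≡ + 0
mono-⊛-0 k f = trans (⊛-zero (mono (suc k)) f) (ℤ.*-zeroˡ (f 0))

mono-⊛-suc : ∀ k f n → (mono (suc k) ⊛ f) (suc n) ≡ (mono k ⊛ f) n
mono-⊛-suc k f n = trans (⊛-suc (mono (suc k)) f n) (trans (cong (_+ (mono k ⊛ f) n) (ℤ.*-zeroˡ (f (suc n)))) (ℤ.+-identityˡ _))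

mono-⊛-shift : ∀ k f n → (mono k ⊛ f) (k ℕ.+ n) ≡ f n
mono-⊛-shift zero    f n = one-⊛ f .at n
mono-⊛-shift (suc k) f n = trans (mono-⊛-suc k f (k ℕ.+ n)) (mono-⊛-shift k f n)

mono-⊛-small : ∀ k f n → n < k → (mono k ⊛ f) n ≡ + 0
mono-⊛-small (suc k) f zero    _         = mono-⊛-0 k f
mono-⊛-small (suc k) f (suc n) (s≤s n<k) = trans (mono-⊛-suc k f n) (mono-⊛-small k f n n<k)

mono-cancel : ∀ k → mono k ⊛ f ≈ mono k ⊛ g → f ≈ g
mono-cancel {f} {g} k p .at n = trans (sym (mono-⊛-shift k f n)) (trans (p .at (k ℕ.+ n)) (mono-⊛-shift k g n))

-- Multiplication by q^k gains k coefficients of precision. This gain drives the induction in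
-- `substPow-⊛` and the use of orders in `Ord-~`.
mono-~ : ∀ k {f g n} → f ~[ n ] g → mono k ⊛ f ~[ k ℕ.+ n ] mono k ⊛ g
mono-~ zero    {f} {g} p i       i≤n       = trans (one-⊛ f .at i) (trans (p i i≤n) (sym (one-⊛ g .at i)))
mono-~ (suc k) {f} {g} p zero    _         = trans (mono-⊛-0 k f) (sym (mono-⊛-0 k g))
mono-~ (suc k) {f} {g} p (suc i) (s≤s i≤n) = trans (mono-⊛-suc k f i) (trans (mono-~ k {f} {g} p i i≤n) (sym (mono-⊛-suc k g i)))

mono-+ : ∀ a b → mono a ⊛ mono b ≈ mono (a ℕ.+ b)
mono-+ zero    b .at n       = one-⊛ (mono b) .at n
mono-+ (suc a) b .at zero    = mono-⊛-0 a (mono b)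
mono-+ (suc a) b .at (suc n) = trans (mono-⊛-suc a (mono b) n) (mono-+ a b .at n)

≤ᵇ-true : ∀ {m n} → m ≤ n → (m ≤ᵇ n) ≡ true
≤ᵇ-true {m} {n} p with m ≤ᵇ n | ℕ.≤⇒≤ᵇ p
... | true | _ = refl

≤ᵇ-false : ∀ n → (suc n ≤ᵇ n) ≡ false
≤ᵇ-false n with suc n ≤ᵇ n in eq
... | false = refl
... | true  = ⊥-elim (ℕ.1+n≰n (ℕ.≤ᵇ⇒≤ (suc n) n (subst T (sym eq) _)))

≡ᵇ-refl : ∀ n → (n ≡ᵇ n) ≡ true
≡ᵇ-refl zero    = refl
≡ᵇ-refl (suc n) = ≡ᵇ-refl n

-- The approximations extend one another, so their diagonal `inv1` satisfies the recursion that
-- defines the inverse.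
invUpTo-stable : ∀ f N k → k ≤ N → invUpTo f N k ≡ inv1 f k
invUpTo-stable f zero    zero k≤N = refl
invUpTo-stable f (suc N) k    k≤N with ℕ.m≤n⇒m<n∨m≡n k≤N
... | inj₁ (s≤s k≤N′) rewrite ≤ᵇ-true k≤N′ = invUpTo-stable f N k k≤N′
... | inj₂ refl = refl

inv1-suc : ∀ f N → inv1 f (suc N) ≡ - ((f ∘ suc) ⊛ inv1 f) N
inv1-suc f N rewrite ≤ᵇ-false N | ≡ᵇ-refl N =
  cong -_ (∑-cong (upTo (suc N)) (λ i → cong (f (suc i) ℤ.*_) (invUpTo-stable f N (N ∸ i) (ℕ.m∸n≤m N i))))

inv1-inverse : f 0 ≡ + 1 → f ⊛ inv1 f ≈ 𝟙
inv1-inverse {f} f0 .at zero    = trans (⊛-zero f (inv1 f)) (cong (_* + 1) f0)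
inv1-inverse {f} f0 .at (suc n) = trans (⊛-suc f (inv1 f) n)
  (trans (cong₂ (λ a b → a * b + ((f ∘ suc) ⊛ inv1 f) n) f0 (inv1-suc f n)) (1*-x+x (((f ∘ suc) ⊛ inv1 f) n)))
  where
  1*-x+x : ∀ x → + 1 * (- x) + x ≡ + 0
  1*-x+x = solve-∀

unit-cancel : ∀ u v → u ⊛ v ≈ 𝟙 → u ⊛ f ≈ u ⊛ g → f ≈ g
unit-cancel {f} {g} u v uv p = begin
  f             ≈⟨ ⊛-identityˡ f ⟨
  𝟙 ⊛ f         ≈⟨ ⊛-congʳ f uv ⟨
  u ⊛ v ⊛ f     ≈⟨ solve 3 (λ u v f → u :* v :* f := v :* (u :* f)) ≈-refl u v f ⟩
  v ⊛ (u ⊛ f)   ≈⟨ ⊛-congˡ v p ⟩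
  v ⊛ (u ⊛ g)   ≈⟨ solve 3 (λ u v f → u :* v :* f := v :* (u :* f)) ≈-refl u v g ⟨
  u ⊛ v ⊛ g     ≈⟨ ⊛-congʳ g uv ⟩
  𝟙 ⊛ g         ≈⟨ ⊛-identityˡ g ⟩
  g             ∎

inv-cancel : ∀ u → u 0 ≡ + 1 → u ⊛ f ≈ u ⊛ g → f ≈ g
inv-cancel u u0 = unit-cancel u (inv1 u) (inv1-inverse {u} u0)

⊛-at-0 : f 0 ≡ + 1 → g 0 ≡ + 1 → (f ⊛ g) 0 ≡ + 1
⊛-at-0 {f} {g} p q = trans (⊛-zero f g) (cong₂ _*_ p q)

-- q ↦ q^k and q ↦ -q

if-cong : ∀ (b : Bool) {x x′ y y′ : ℤ} → x ≡ x′ → y ≡ y′ → (if b then x else y) ≡ (if b then x′ else y′)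
if-cong true  p q = p
if-cong false p q = q

substPow-cong : ∀ k .{{_ : NonZero k}} → f ≈ g → substPow k f ≈ substPow k g
substPow-cong k p .at n = if-cong ((n % k) ≡ᵇ 0) (p .at (n / k)) refl

substPow-~ : ∀ k .{{_ : NonZero k}} → f ~[ n ] g → substPow k f ~[ n ] substPow k g
substPow-~ k p i i≤n = if-cong ((i % k) ≡ᵇ 0) (p (i / k) (ℕ.≤-trans (ℕ.m/n≤m i k) i≤n)) refl

substPow-⊕ : ∀ k .{{_ : NonZero k}} f g → substPow k (f ⊕ g) ≈ substPow k f ⊕ substPow k g
substPow-⊕ k f g .at n with (n % k) ≡ᵇ 0
... | true  = refl
... | false = refl

substPow-· : ∀ k .{{_ : NonZero k}} c f → substPow k (c · f) ≈ c · substPow k f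
substPow-· k c f .at n with (n % k) ≡ᵇ 0
... | true  = refl
... | false = sym (ℤ.*-zeroʳ c)

substPow-⊖ : ∀ k .{{_ : NonZero k}} f g → substPow k (f ⊖ g) ≈ substPow k f ⊖ substPow k g
substPow-⊖ k f g .at n with (n % k) ≡ᵇ 0
... | true  = refl
... | false = refl

substPow-0 : ∀ k .{{_ : NonZero k}} f → substPow k f 0 ≡ f 0
substPow-0 (suc k) f = refl

substPow-shift : ∀ k .{{_ : NonZero k}} f n → substPow k f (k ℕ.+ n) ≡ substPow k (f ∘ suc) n
substPow-shift k f n = cong₂ (λ a b → if a ≡ᵇ 0 then f b else + 0) %-eq /-eq
  where
  %-eq : (k ℕ.+ n) % k ≡ n % k
  %-eq = trans (cong (_% k) (ℕ.+-comm k n)) (ℕ.[m+n]%n≡m%n n k)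
  /-eq : (k ℕ.+ n) / k ≡ suc (n / k)
  /-eq = trans (ℕ.m/n≡1+[m∸n]/n (ℕ.m≤m+n k n)) (cong (λ z → suc (z / k)) (ℕ.m+n∸m≡n k n))

substPow-small : ∀ k .{{_ : NonZero k}} f n → suc n < k → substPow k f (suc n) ≡ + 0
substPow-small k f n n<k = cong (λ a → if a ≡ᵇ 0 then f (suc n / k) else + 0) (ℕ.m<n⇒m%n≡m n<k)

-- The image of f = f(0) + q · (`f ∘ suc`) under q ↦ q^k. It replaces computations with remainders
-- by a recursion.
substPow-decomp : ∀ k .{{_ : NonZero k}} f → substPow k f ≈ const (f 0) ⊕ mono k ⊛ substPow k (f ∘ suc)
substPow-decomp k@(suc k′) f .at zero = trans (substPow-0 k f)
  (sym (trans (cong (_+_ (f 0)) (mono-⊛-0 k′ (substPow k (f ∘ suc)))) (ℤ.+-identityʳ _)))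
substPow-decomp k f .at (suc n) with suc n ℕ.<? k
... | yes n<k = trans (substPow-small k f n n<k)
                  (sym (trans (ℤ.+-identityˡ _) (mono-⊛-small k (substPow k (f ∘ suc)) (suc n) n<k)))
... | no  n≮k = subst (λ m → substPow k f m ≡ + 0 + (mono k ⊛ substPow k (f ∘ suc)) m)
                  (ℕ.m+[n∸m]≡n (ℕ.≮⇒≥ n≮k))
                  (trans (substPow-shift k f _) (sym (trans (ℤ.+-identityˡ _) (mono-⊛-shift k (substPow k (f ∘ suc)) _))))

-- Both sides satisfy the recursion X(f, g) = f(0) g(q^k) + q^k X(`f ∘ suc`, g). As k ≥ 1, each use
-- of it yields at least one more correct coefficient, so the induction is on the precision, for all
-- f at once.
substPow-⊛ : ∀ k .{{_ : NonZero k}} f g → substPow k (f ⊛ g) ≈ substPow k f ⊛ substPow k g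
substPow-⊛ k f g = ~⇒≈ (λ n → go n f g)
  where
  S = substPow k
  const-⊛-const : ∀ f g → const ((f ⊛ g) 0) ≈ const (f 0) ⊛ const (g 0)
  const-⊛-const f g .at zero    = trans (⊛-zero f g) (sym (const-⊛ (f 0) (const (g 0)) .at 0))
  const-⊛-const f g .at (suc n) = sym (trans (const-⊛ (f 0) (const (g 0)) .at (suc n)) (ℤ.*-zeroʳ (f 0)))
  lhs : ∀ f g → S (f ⊛ g) ≈ const (f 0) ⊛ S g ⊕ mono k ⊛ S ((f ∘ suc) ⊛ g)
  lhs f g = begin
    S (f ⊛ g)
      ≈⟨ substPow-decomp k (f ⊛ g) ⟩
    const ((f ⊛ g) 0) ⊕ mono k ⊛ S ((f ⊛ g) ∘ suc)
      ≈⟨ ⊕-cong (const-⊛-const f g)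
           (⊛-congˡ (mono k) (≈-trans (substPow-cong k (mk (⊛-suc f g)))
             (≈-trans (substPow-⊕ k (f 0 · (g ∘ suc)) ((f ∘ suc) ⊛ g))
               (⊕-congʳ (S ((f ∘ suc) ⊛ g)) (≈-trans (substPow-· k (f 0) (g ∘ suc)) (≈-sym (const-⊛ (f 0) (S (g ∘ suc))))))))) ⟩
    const (f 0) ⊛ const (g 0) ⊕ mono k ⊛ (const (f 0) ⊛ S (g ∘ suc) ⊕ S ((f ∘ suc) ⊛ g))
      ≈⟨ solve 5 (λ a b c d e → a :* b :+ c :* (a :* d :+ e) := a :* (b :+ c :* d) :+ c :* e) ≈-refl
           (const (f 0)) (const (g 0)) (mono k) (S (g ∘ suc)) (S ((f ∘ suc) ⊛ g)) ⟩
    const (f 0) ⊛ (const (g 0) ⊕ mono k ⊛ S (g ∘ suc)) ⊕ mono k ⊛ S ((f ∘ suc) ⊛ g)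
      ≈⟨ ⊕-congʳ (mono k ⊛ S ((f ∘ suc) ⊛ g)) (⊛-congˡ (const (f 0)) (≈-sym (substPow-decomp k g))) ⟩
    const (f 0) ⊛ S g ⊕ mono k ⊛ S ((f ∘ suc) ⊛ g) ∎
  rhs : ∀ f g → S f ⊛ S g ≈ const (f 0) ⊛ S g ⊕ mono k ⊛ (S (f ∘ suc) ⊛ S g)
  rhs f g = ≈-trans (⊛-congʳ (S g) (substPow-decomp k f))
    (solve 4 (λ a b c d → (a :+ b :* c) :* d := a :* d :+ b :* (c :* d)) ≈-refl
       (const (f 0)) (mono k) (S (f ∘ suc)) (S g))
  tail~ : ∀ n f g → mono k ⊛ S ((f ∘ suc) ⊛ g) ~[ n ] mono k ⊛ (S (f ∘ suc) ⊛ S g)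
  go : ∀ n f g → S (f ⊛ g) ~[ n ] S f ⊛ S g
  go n f g i i≤n = trans (lhs f g .at i) (trans (cong (_+_ ((const (f 0) ⊛ S g) i)) (tail~ n f g i i≤n)) (sym (rhs f g .at i)))
  tail~ zero    f g zero    _   = trans (mono-⊛-small k (S ((f ∘ suc) ⊛ g)) 0 (ℕ.>-nonZero⁻¹ k))
                                        (sym (mono-⊛-small k (S (f ∘ suc) ⊛ S g) 0 (ℕ.>-nonZero⁻¹ k)))
  tail~ (suc n) f g i       i≤n = mono-~ k {S ((f ∘ suc) ⊛ g)} {S (f ∘ suc) ⊛ S g} (go n (f ∘ suc) g) i (ℕ.≤-trans i≤n (ℕ.+-monoˡ-≤ n (ℕ.>-nonZero⁻¹ k)))

substPow-one : ∀ k .{{_ : NonZero k}} → substPow k one ≈ one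
substPow-one k@(suc _) .at zero    = refl
substPow-one k         .at (suc n) with suc n % k in eq
... | suc _ = refl
... | zero with suc n / k in eq′
...   | suc _ = refl
...   | zero with () ← trans (ℕ.m≡m%n+[m/n]*n (suc n) k) (cong₂ (λ a b → a ℕ.+ b ℕ.* k) eq eq′)

substPow-mono : ∀ k .{{_ : NonZero k}} a → substPow k (mono a) ≈ mono (k ℕ.* a)
substPow-mono k zero    = ≈-trans (substPow-one k) (≡⇒≈ (cong mono (sym (ℕ.*-zeroʳ k))))
substPow-mono k (suc a) = begin
  substPow k (mono (suc a))                   ≈⟨ substPow-decomp k (mono (suc a)) ⟩
  𝟘 ⊕ mono k ⊛ substPow k (mono a)            ≈⟨ ⊕-congˡ 𝟘 (⊛-congˡ (mono k) (substPow-mono k a)) ⟩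
  𝟘 ⊕ mono k ⊛ mono (k ℕ.* a)                 ≈⟨ ⊕-identityˡ _ ⟩
  mono k ⊛ mono (k ℕ.* a)                     ≈⟨ mono-+ k (k ℕ.* a) ⟩
  mono (k ℕ.+ k ℕ.* a)                        ≈⟨ ≡⇒≈ (cong mono (sym (ℕ.*-suc k a))) ⟩
  mono (k ℕ.* suc a)                          ∎

negArg-suc : ∀ f n → negArg f (suc n) ≡ - negArg (f ∘ suc) n
negArg-suc f zero          = refl
negArg-suc f (suc zero)    = sym (ℤ.neg-involutive (f 2))
negArg-suc f (suc (suc n)) = negArg-suc (λ i → f (suc (suc i))) n

negArg-cong : f ≈ g → negArg f ≈ negArg g
negArg-cong p .at n = if-cong ((n % 2) ≡ᵇ 0) (p .at n) (cong -_ (p .at n))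

negArg-~ : f ~[ n ] g → negArg f ~[ n ] negArg g
negArg-~ p i i≤n = if-cong ((i % 2) ≡ᵇ 0) (p i i≤n) (cong -_ (p i i≤n))

negArg-⊕ : ∀ f g → negArg (f ⊕ g) ≈ negArg f ⊕ negArg g
negArg-⊕ f g .at n with (n % 2) ≡ᵇ 0
... | true  = refl
... | false = ℤ.neg-distrib-+ (f n) (g n)

negArg-· : ∀ c f → negArg (c · f) ≈ c · negArg f
negArg-· c f .at n with (n % 2) ≡ᵇ 0
... | true  = refl
... | false = ℤ.neg-distribʳ-* c (f n)

negArg-⊛ : ∀ f g → negArg (f ⊛ g) ≈ negArg f ⊛ negArg g
negArg-⊛ f g .at n = go n f g
  where
  go : ∀ n f g → negArg (f ⊛ g) n ≡ (negArg f ⊛ negArg g) n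
  go zero    f g = refl
  go (suc n) f g = begin′
    negArg (f ⊛ g) (suc n)
      ≡⟨ negArg-suc (f ⊛ g) n ⟩
    - negArg ((f ⊛ g) ∘ suc) n
      ≡⟨ cong -_ (trans (negArg-cong {g = (f 0 · (g ∘ suc)) ⊕ ((f ∘ suc) ⊛ g)} (mk (⊛-suc f g)) .at n)
           (trans (negArg-⊕ (f 0 · (g ∘ suc)) ((f ∘ suc) ⊛ g) .at n)
                  (cong₂ _+_ (negArg-· (f 0) (g ∘ suc) .at n) (go n (f ∘ suc) g)))) ⟩
    - (f 0 * negArg (g ∘ suc) n + (negArg (f ∘ suc) ⊛ negArg g) n)
      ≡⟨ regroup (f 0) (negArg (g ∘ suc) n) ((negArg (f ∘ suc) ⊛ negArg g) n) ⟩
    f 0 * (- negArg (g ∘ suc) n) + (- + 1) * (negArg (f ∘ suc) ⊛ negArg g) n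
      ≡⟨ cong₂ (λ a b → f 0 * a + b) (sym (negArg-suc g n)) (sym (⊛-scale (- + 1) (negArg (f ∘ suc)) (negArg g) n)) ⟩
    f 0 * negArg g (suc n) + (((- + 1) · negArg (f ∘ suc)) ⊛ negArg g) n
      ≡⟨ cong (_+_ (f 0 * negArg g (suc n)))
           (⊛-cong~ {g = negArg g} n (λ i _ → trans (ℤ.-1*i≡-i (negArg (f ∘ suc) i)) (sym (negArg-suc f i))) (λ _ _ → refl)) ⟩
    f 0 * negArg g (suc n) + ((negArg f ∘ suc) ⊛ negArg g) n
      ≡⟨ sym (⊛-suc (negArg f) (negArg g) n) ⟩
    (negArg f ⊛ negArg g) (suc n) ∎′
    where
    open ≡-Reasoning renaming (begin_ to begin′_; _∎ to _∎′)
    regroup : ∀ a b c → - (a * b + c) ≡ a * (- b) + (- + 1) * c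
    regroup = solve-∀

negArg-involutive : ∀ f → negArg (negArg f) ≈ f
negArg-involutive f .at n with (n % 2) ≡ᵇ 0
... | true  = refl
... | false = ℤ.neg-involutive (f n)

negArg-substPow-2 : ∀ f → negArg (substPow 2 f) ≈ substPow 2 f
negArg-substPow-2 f .at n with (n % 2) ≡ᵇ 0
... | true  = refl
... | false = refl

-- Infinite products

∏ : ℕ → (ℕ → PS) → PS
∏ n F = prodPS (map F (upTo n))

∏-suc : ∀ n F → ∏ (suc n) F ≡ F 0 ⊛ ∏ n (F ∘ suc)
∏-suc n F = cong (λ l → F 0 ⊛ prodPS l) (trans (List.map-applyUpTo suc F n) (sym (List.map-applyUpTo id (F ∘ suc) n)))

∏-last : ∀ n F → ∏ (suc n) F ≈ ∏ n F ⊛ F n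
∏-last zero    F = ⊛-≈-comm (F 0) one
∏-last (suc n) F = begin
  ∏ (suc (suc n)) F                   ≈⟨ ≡⇒≈ (∏-suc (suc n) F) ⟩
  F 0 ⊛ ∏ (suc n) (F ∘ suc)           ≈⟨ ⊛-congˡ (F 0) (∏-last n (F ∘ suc)) ⟩
  F 0 ⊛ (∏ n (F ∘ suc) ⊛ F (suc n))   ≈⟨ ⊛-≈-assoc (F 0) (∏ n (F ∘ suc)) (F (suc n)) ⟨
  F 0 ⊛ ∏ n (F ∘ suc) ⊛ F (suc n)     ≈⟨ ⊛-congʳ (F (suc n)) (≡⇒≈ (sym (∏-suc n F))) ⟩
  ∏ (suc n) F ⊛ F (suc n)             ∎

-- Reads coefficient n off the n-th partial product, exactly as `E` is defined, so that `E` is such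
-- a limit by computation.
lim : (ℕ → PS) → PS
lim F n = ∏ n F n

∏-stable : ∀ F → (∀ k → F k ~[ k ] one) → ∀ n d → ∏ (d ℕ.+ n) F ~[ n ] ∏ n F
∏-stable F F~1 n zero    i i≤n = refl
∏-stable F F~1 n (suc d) i i≤n =
  trans (∏-last (d ℕ.+ n) F .at i)
    (trans (~-⊛ {∏ (d ℕ.+ n) F} {∏ n F} {F (d ℕ.+ n)} {one} {n} (∏-stable F F~1 n d)
              (~-mono {F (d ℕ.+ n)} {one} (ℕ.m≤n+m n d) (F~1 (d ℕ.+ n))) i i≤n)
           (trans (⊛-≈-comm (∏ n F) one .at i) (one-⊛ (∏ n F) .at i)))

∏~lim : ∀ F → (∀ k → F k ~[ k ] one) → ∀ N → ∏ N F ~[ N ] lim F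
∏~lim F F~1 N i i≤N = subst (λ m → ∏ m F i ≡ ∏ i F i) (ℕ.m∸n+n≡m i≤N) (∏-stable F F~1 i (N ∸ i) i ℕ.≤-refl)

mono-vanish : ∀ k i → i < k → mono k i ≡ + 0
mono-vanish (suc k) zero    _         = refl
mono-vanish (suc k) (suc i) (s≤s i<k) = mono-vanish k i i<k

one-mono~ : ∀ k → one ⊖ mono (suc k) ~[ k ] one
one-mono~ k i i≤k = trans (cong (λ z → one i - z) (mono-vanish (suc k) i (s≤s i≤k))) (ℤ.+-identityʳ _)

qPoch~E : ∀ N → qPoch N ~[ N ] E
qPoch~E = ∏~lim (λ k → one ⊖ mono (suc k)) one-mono~

mono-≡ : ∀ {a b} → a ≡ b → mono a ≈ mono b
mono-≡ p = ≡⇒≈ (cong mono p)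

mono-split : ∀ {c} a b → c ≡ a ℕ.+ b → mono c ≈ mono a ⊛ mono b
mono-split a b p = ≈-trans (mono-≡ p) (≈-sym (mono-+ a b))

-- Sums over i + j = n

conv : ℕ → (ℕ → ℕ → PS) → PS
conv zero    F = F 0 0
conv (suc n) F = F 0 (suc n) ⊕ conv n (λ i j → F (suc i) j)

conv-cong : ∀ n {F G : ℕ → ℕ → PS} → (∀ i j → i ℕ.+ j ≡ n → F i j ≈ G i j) → conv n F ≈ conv n G
conv-cong zero    eq = eq 0 0 refl
conv-cong (suc n) eq = ⊕-cong (eq 0 (suc n) refl) (conv-cong n (λ i j p → eq (suc i) j (cong suc p)))

conv-last : ∀ n F → conv (suc n) F ≈ conv n (λ i j → F i (suc j)) ⊕ F (suc n) 0
conv-last zero    F = ≈-refl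
conv-last (suc n) F = ≈-trans (⊕-congˡ (F 0 (suc (suc n))) (conv-last n (λ i j → F (suc i) j)))
  (≈-sym (⊕-assoc (F 0 (suc (suc n))) (conv n (λ i j → F (suc i) (suc j))) (F (suc (suc n)) 0)))

conv-⊕ : ∀ n F G → conv n (λ i j → F i j ⊕ G i j) ≈ conv n F ⊕ conv n G
conv-⊕ zero    F G = ≈-refl
conv-⊕ (suc n) F G = ≈-trans (⊕-congˡ (F 0 (suc n) ⊕ G 0 (suc n)) (conv-⊕ n _ _))
  (solve 4 (λ a b c d → (a :+ b) :+ (c :+ d) := (a :+ c) :+ (b :+ d)) ≈-refl
    (F 0 (suc n)) (G 0 (suc n)) (conv n (λ i j → F (suc i) j)) (conv n (λ i j → G (suc i) j)))

conv-⊛ : ∀ n c F → c ⊛ conv n F ≈ conv n (λ i j → c ⊛ F i j)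
conv-⊛ zero    c F = ≈-refl
conv-⊛ (suc n) c F = ≈-trans (⊛-⊕-distribˡ c (F 0 (suc n)) (conv n (λ i j → F (suc i) j)))
  (⊕-congˡ (c ⊛ F 0 (suc n)) (conv-⊛ n c (λ i j → F (suc i) j)))

conv-assoc : ∀ n (F : ℕ → ℕ → ℕ → PS) →
  conv n (λ s u → conv s (λ r t → F r t u)) ≈ conv n (λ r v → conv v (λ t u → F r t u))
conv-assoc zero    F = ≈-refl
conv-assoc (suc n) F = begin
  F 0 0 (suc n) ⊕ conv n (λ s u → F 0 (suc s) u ⊕ conv s (λ r t → F (suc r) t u))
    ≈⟨ ⊕-congˡ (F 0 0 (suc n)) (conv-⊕ n (λ s u → F 0 (suc s) u) (λ s u → conv s (λ r t → F (suc r) t u))) ⟩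
  F 0 0 (suc n) ⊕ (conv n (λ s u → F 0 (suc s) u) ⊕ conv n (λ s u → conv s (λ r t → F (suc r) t u)))
    ≈⟨ ⊕-assoc (F 0 0 (suc n)) (conv n (λ s u → F 0 (suc s) u)) (conv n (λ s u → conv s (λ r t → F (suc r) t u))) ⟨
  F 0 0 (suc n) ⊕ conv n (λ s u → F 0 (suc s) u) ⊕ conv n (λ s u → conv s (λ r t → F (suc r) t u))
    ≈⟨ ⊕-congˡ (F 0 0 (suc n) ⊕ conv n (λ s u → F 0 (suc s) u)) (conv-assoc n (λ r → F (suc r))) ⟩
  F 0 0 (suc n) ⊕ conv n (λ s u → F 0 (suc s) u) ⊕ conv n (λ r v → conv v (λ t u → F (suc r) t u)) ∎

conv-𝟘 : ∀ n → conv n (λ _ _ → 𝟘) ≈ 𝟘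
conv-𝟘 zero    = ≈-refl
conv-𝟘 (suc n) = ≈-trans (⊕-identityˡ (conv n (λ _ _ → 𝟘))) (conv-𝟘 n)

conv-first : ∀ n F → (∀ i j → F (suc i) j ≈ 𝟘) → conv n F ≈ F 0 n
conv-first zero    F F≈0 = ≈-refl
conv-first (suc n) F F≈0 = ≈-trans (⊕-congˡ (F 0 (suc n)) (≈-trans (conv-cong n (λ i j _ → F≈0 i j)) (conv-𝟘 n)))
  (⊕-identityʳ (F 0 (suc n)))

-- `P r a` is a closed form for the sum of the terms with first index at most r; the hypotheses are
-- its initial value and its increment.
conv-telescope : ∀ n (F P : ℕ → ℕ → PS) → F 0 n ≈ P 0 n →
  (∀ r a → r ℕ.+ suc a ≡ n → P r (suc a) ⊕ F (suc r) a ≈ P (suc r) a) → conv n F ≈ P n 0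
conv-telescope zero    F P base step = base
conv-telescope (suc n) F P base step = ≈-trans (merge n F) (conv-telescope n (merged F) (λ i → P (suc i))
    (≈-trans (⊕-congʳ (F 1 n) base) (step 0 n refl))
    (λ r a p → step (suc r) a (cong suc p)))
  where
  merged : (ℕ → ℕ → PS) → ℕ → ℕ → PS
  merged F zero    j = F 0 (suc j) ⊕ F 1 j
  merged F (suc i) j = F (suc (suc i)) j
  merge : ∀ n F → conv (suc n) F ≈ conv n (merged F)
  merge zero    F = ≈-refl
  merge (suc n) F = ≈-sym (⊕-assoc (F 0 (suc (suc n))) (F 1 (suc n)) (conv n (λ i j → F (suc (suc i)) j)))

1-q^ : ℕ → PS
1-q^ n = 𝟙 ⊖ mono n

1-q^0 : ∀ f → 1-q^ 0 ⊛ f ≈ 𝟘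
1-q^0 f = ≈-trans (⊛-congʳ f (⊖-cong (≈-refl {𝟙}) one≈𝟙)) (solve 1 (λ f → (con (+ 1) :- con (+ 1)) :* f := con (+ 0)) ≈-refl f)

-- The splitting 1 - q^(A+1) = (1 - q^a) + q^a (1 - q^r) for r + a = A + 1, with q^(p n) in place of q^n.
conv-difference : ∀ (p : ℕ → ℕ) → p 0 ≡ 0 → (∀ m n → p (m ℕ.+ n) ≡ p m ℕ.+ p n) → ∀ A F →
  1-q^ (p (suc A)) ⊛ conv (suc A) F
    ≈ conv A (λ r a → 1-q^ (p (suc a)) ⊛ F r (suc a))
      ⊕ conv A (λ r a → mono (p a) ⊛ (1-q^ (p (suc r)) ⊛ F (suc r) a))
conv-difference p p0 p+ A F = begin
  1-q^ (p (suc A)) ⊛ conv (suc A) F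
    ≈⟨ conv-⊛ (suc A) (1-q^ (p (suc A))) F ⟩
  conv (suc A) (λ r a → 1-q^ (p (suc A)) ⊛ F r a)
    ≈⟨ conv-cong (suc A) split ⟩
  conv (suc A) (λ r a → X r a ⊕ Y r a)
    ≈⟨ conv-⊕ (suc A) X Y ⟩
  conv (suc A) X ⊕ conv (suc A) Y
    ≈⟨ ⊕-cong (≈-trans (conv-last A X) (≈-trans (⊕-congˡ X′ X0) (⊕-identityʳ X′)))
              (≈-trans (⊕-congʳ Y′ Y0) (⊕-identityˡ Y′)) ⟩
  X′ ⊕ Y′ ∎
  where
  X Y : ℕ → ℕ → PS
  X r a = 1-q^ (p a) ⊛ F r a
  Y r a = mono (p a) ⊛ (1-q^ (p r) ⊛ F r a)
  X′ Y′ : PS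
  X′ = conv A (λ r a → X r (suc a))
  Y′ = conv A (λ r a → Y (suc r) a)
  split : ∀ r a → r ℕ.+ a ≡ suc A → 1-q^ (p (suc A)) ⊛ F r a ≈ X r a ⊕ Y r a
  split r a eq = ≈-trans
    (⊛-congʳ (F r a) (⊖-cong (≈-refl {𝟙}) (mono-split (p r) (p a) (trans (cong p (sym eq)) (p+ r a)))))
    (solve 3 (λ x y f → (con (+ 1) :- x :* y) :* f := (con (+ 1) :- y) :* f :+ y :* ((con (+ 1) :- x) :* f)) ≈-refl
      (mono (p r)) (mono (p a)) (F r a))
  vanish : ∀ f → 1-q^ (p 0) ⊛ f ≈ 𝟘
  vanish f = ≈-trans (⊛-congʳ f (⊖-cong (≈-refl {𝟙}) (mono-≡ p0))) (1-q^0 f)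
  X0 : X (suc A) 0 ≈ 𝟘
  X0 = vanish (F (suc A) 0)
  Y0 : Y 0 (suc A) ≈ 𝟘
  Y0 = ≈-trans (⊛-congˡ (mono (p (suc A))) (vanish (F 0 (suc A)))) (⊛-zeroʳ (mono (p (suc A))))

-- Reciprocals of (q)_n and the Bailey lemma

qPoch-suc : ∀ n → qPoch (suc n) ≈ qPoch n ⊛ 1-q^ (suc n)
qPoch-suc n = ≈-trans (∏-last n (λ k → one ⊖ mono (suc k)))
  (⊛-congˡ (qPoch n) (⊖-cong one≈𝟙 (≈-refl {mono (suc n)})))

qPoch-0 : ∀ n → qPoch n 0 ≡ + 1
qPoch-0 zero    = refl
qPoch-0 (suc n) = trans (qPoch-suc n .at 0) (⊛-at-0 {qPoch n} {1-q^ (suc n)} (qPoch-0 n) refl)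

iq : ℕ → PS
iq n = inv1 (qPoch n)

qPoch-iq : ∀ n → qPoch n ⊛ iq n ≈ 𝟙
qPoch-iq n = inv1-inverse {qPoch n} (qPoch-0 n)

iq-0 : iq 0 ≈ 𝟙
iq-0 = ≈-trans (≈-sym (one-⊛ (iq 0))) (qPoch-iq 0)

iq-step : ∀ n → 1-q^ (suc n) ⊛ iq (suc n) ≈ iq n
iq-step n = inv-cancel (qPoch n) (qPoch-0 n) (begin
  qPoch n ⊛ (1-q^ (suc n) ⊛ iq (suc n))  ≈⟨ ⊛-≈-assoc (qPoch n) (1-q^ (suc n)) (iq (suc n)) ⟨
  qPoch n ⊛ 1-q^ (suc n) ⊛ iq (suc n)    ≈⟨ ⊛-congʳ (iq (suc n)) (≈-sym (qPoch-suc n)) ⟩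
  qPoch (suc n) ⊛ iq (suc n)             ≈⟨ qPoch-iq (suc n) ⟩
  𝟙                                      ≈⟨ qPoch-iq n ⟨
  qPoch n ⊛ iq n                         ∎)

-- A limiting case of the q-Chu-Vandermonde sum. Multiplication by 1 - q^(A+1), split by
-- `conv-difference`, produces the sums for (A, c) and (A, c + 1), hence an induction on A with c
-- free.
qVandermonde : ∀ A c → conv A (λ r a → mono (r ℕ.* (r ℕ.+ c)) ⊛ (iq a ⊛ (iq r ⊛ iq (r ℕ.+ c)))) ≈ iq A ⊛ iq (A ℕ.+ c)
qVandermonde zero c = ≈-trans (one-⊛ (iq 0 ⊛ (iq 0 ⊛ iq c)))
  (⊛-congˡ (iq 0) (≈-trans (⊛-congʳ (iq c) iq-0) (⊛-identityˡ (iq c))))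
qVandermonde (suc A) c = inv-cancel (1-q^ (suc A)) refl (begin
  1-q^ (suc A) ⊛ conv (suc A) (t c)
    ≈⟨ conv-difference id refl (λ _ _ → refl) A (t c) ⟩
  conv A (λ r a → 1-q^ (suc a) ⊛ t c r (suc a)) ⊕ conv A (λ r a → mono a ⊛ (1-q^ (suc r) ⊛ t c (suc r) a))
    ≈⟨ ⊕-cong (conv-cong A (λ r a _ → left r a)) (≈-trans (conv-cong A right) (≈-sym (conv-⊛ A (mono (suc (A ℕ.+ c))) (t (suc c))))) ⟩
  conv A (t c) ⊕ mono (suc (A ℕ.+ c)) ⊛ conv A (t (suc c))
    ≈⟨ ⊕-cong (qVandermonde A c) (⊛-congˡ (mono (suc (A ℕ.+ c))) (qVandermonde A (suc c))) ⟩
  iq A ⊛ iq (A ℕ.+ c) ⊕ mono (suc (A ℕ.+ c)) ⊛ (iq A ⊛ iq (A ℕ.+ suc c))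
    ≈⟨ ⊕-cong (⊛-congˡ (iq A) (≈-sym (iq-step (A ℕ.+ c))))
         (⊛-congˡ (mono (suc (A ℕ.+ c))) (⊛-congˡ (iq A) (≡⇒≈ (cong iq (ℕ.+-suc A c))))) ⟩
  iq A ⊛ (1-q^ (suc (A ℕ.+ c)) ⊛ iq (suc (A ℕ.+ c))) ⊕ mono (suc (A ℕ.+ c)) ⊛ (iq A ⊛ iq (suc (A ℕ.+ c)))
    ≈⟨ solve 3 (λ i j m → i :* ((con (+ 1) :- m) :* j) :+ m :* (i :* j) := i :* j) ≈-refl
         (iq A) (iq (suc (A ℕ.+ c))) (mono (suc (A ℕ.+ c))) ⟩
  iq A ⊛ iq (suc (A ℕ.+ c))
    ≈⟨ ⊛-congʳ (iq (suc (A ℕ.+ c))) (≈-sym (iq-step A)) ⟩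
  1-q^ (suc A) ⊛ iq (suc A) ⊛ iq (suc (A ℕ.+ c))
    ≈⟨ ⊛-≈-assoc (1-q^ (suc A)) (iq (suc A)) (iq (suc (A ℕ.+ c))) ⟩
  1-q^ (suc A) ⊛ (iq (suc A) ⊛ iq (suc (A ℕ.+ c))) ∎)
  where
  t : ℕ → ℕ → ℕ → PS
  t c r a = mono (r ℕ.* (r ℕ.+ c)) ⊛ (iq a ⊛ (iq r ⊛ iq (r ℕ.+ c)))
  left : ∀ r a → 1-q^ (suc a) ⊛ t c r (suc a) ≈ t c r a
  left r a = ≈-trans
    (solve 4 (λ x m i j → x :* (m :* (i :* j)) := m :* ((x :* i) :* j)) ≈-refl
      (1-q^ (suc a)) (mono (r ℕ.* (r ℕ.+ c))) (iq (suc a)) (iq r ⊛ iq (r ℕ.+ c)))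
    (⊛-congˡ (mono (r ℕ.* (r ℕ.+ c))) (⊛-congʳ (iq r ⊛ iq (r ℕ.+ c)) (iq-step a)))
  right : ∀ r a → r ℕ.+ a ≡ A → mono a ⊛ (1-q^ (suc r) ⊛ t c (suc r) a) ≈ mono (suc (A ℕ.+ c)) ⊛ t (suc c) r a
  right r a refl = begin
    mono a ⊛ (1-q^ (suc r) ⊛ (mono (suc r ℕ.* (suc r ℕ.+ c)) ⊛ (iq a ⊛ (iq (suc r) ⊛ iq (suc r ℕ.+ c)))))
      ≈⟨ solve 6 (λ m x m′ i j k → m :* (x :* (m′ :* (i :* (j :* k)))) := (m :* m′) :* (i :* ((x :* j) :* k))) ≈-refl
           (mono a) (1-q^ (suc r)) (mono (suc r ℕ.* (suc r ℕ.+ c))) (iq a) (iq (suc r)) (iq (suc r ℕ.+ c)) ⟩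
    mono a ⊛ mono (suc r ℕ.* (suc r ℕ.+ c)) ⊛ (iq a ⊛ (1-q^ (suc r) ⊛ iq (suc r) ⊛ iq (suc r ℕ.+ c)))
      ≈⟨ ⊛-cong (≈-trans (mono-+ a (suc r ℕ.* (suc r ℕ.+ c))) (mono-split (suc (r ℕ.+ a ℕ.+ c)) (r ℕ.* (r ℕ.+ suc c)) (exponent r a c)))
           (⊛-congˡ (iq a) (⊛-cong (iq-step r) (≡⇒≈ (cong iq (sym (ℕ.+-suc r c)))))) ⟩
    mono (suc (r ℕ.+ a ℕ.+ c)) ⊛ mono (r ℕ.* (r ℕ.+ suc c)) ⊛ (iq a ⊛ (iq r ⊛ iq (r ℕ.+ suc c)))
      ≈⟨ ⊛-≈-assoc (mono (suc (r ℕ.+ a ℕ.+ c))) (mono (r ℕ.* (r ℕ.+ suc c))) (iq a ⊛ (iq r ⊛ iq (r ℕ.+ suc c))) ⟩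
    mono (suc (r ℕ.+ a ℕ.+ c)) ⊛ t (suc c) r a ∎
    where
    exponent : ∀ r a c → a ℕ.+ suc r ℕ.* (suc r ℕ.+ c) ≡ suc (r ℕ.+ a ℕ.+ c) ℕ.+ r ℕ.* (r ℕ.+ suc c)
    exponent = ℕ-solve-∀

-- α and β form a Bailey pair relative to a = q^c.
β : ℕ → (ℕ → PS) → ℕ → PS
β c α N = conv N (λ r a → α r ⊛ (iq a ⊛ iq (a ℕ.+ (r ℕ.+ r ℕ.+ c))))

-- The step of the Bailey chain with both parameters sent to infinity: α is multiplied by a^r
-- q^(r²), where a = q^c.
baileyα : ℕ → (ℕ → PS) → ℕ → PS
baileyα c α r = mono (r ℕ.* (r ℕ.+ c)) ⊛ α r

baileyβ : ℕ → (ℕ → PS) → ℕ → PS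
baileyβ c β N = conv N (λ s u → mono (s ℕ.* (s ℕ.+ c)) ⊛ (iq u ⊛ β s))

-- With s = r + t the weight factors, s(s + c) = r(r + c) + t(t + 2r + c). After interchanging the
-- sums, the inner sum over t is `qVandermonde` with 2r + c in place of c.
bailey : ∀ c α N → β c (baileyα c α) N ≈ baileyβ c (β c α) N
bailey c α N = ≈-sym (begin
  conv N (λ s u → mono (s ℕ.* (s ℕ.+ c)) ⊛ (iq u ⊛ β c α s))
    ≈⟨ conv-cong N (λ s u _ → expand s u) ⟩
  conv N (λ s u → conv s (λ r t → F r t u))
    ≈⟨ conv-assoc N F ⟩
  conv N (λ r v → conv v (λ t u → F r t u))
    ≈⟨ conv-cong N (λ r v _ → collapse r v) ⟩
  conv N (λ r a → baileyα c α r ⊛ (iq a ⊛ iq (a ℕ.+ (r ℕ.+ r ℕ.+ c)))) ∎)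
  where
  w : ℕ → ℕ → ℕ → PS
  w r t u = mono (t ℕ.* (t ℕ.+ (r ℕ.+ r ℕ.+ c))) ⊛ (iq u ⊛ (iq t ⊛ iq (t ℕ.+ (r ℕ.+ r ℕ.+ c))))
  F : ℕ → ℕ → ℕ → PS
  F r t u = baileyα c α r ⊛ w r t u
  exponent : ∀ r t c → (r ℕ.+ t) ℕ.* (r ℕ.+ t ℕ.+ c) ≡ r ℕ.* (r ℕ.+ c) ℕ.+ t ℕ.* (t ℕ.+ (r ℕ.+ r ℕ.+ c))
  exponent = ℕ-solve-∀
  expand : ∀ s u → mono (s ℕ.* (s ℕ.+ c)) ⊛ (iq u ⊛ β c α s) ≈ conv s (λ r t → F r t u)
  expand s u = ≈-trans (≈-sym (⊛-≈-assoc (mono (s ℕ.* (s ℕ.+ c))) (iq u) (β c α s)))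
    (≈-trans (conv-⊛ s (mono (s ℕ.* (s ℕ.+ c)) ⊛ iq u) (λ r t → α r ⊛ (iq t ⊛ iq (t ℕ.+ (r ℕ.+ r ℕ.+ c)))))
      (conv-cong s regroup))
    where
    regroup : ∀ r t → r ℕ.+ t ≡ s → mono (s ℕ.* (s ℕ.+ c)) ⊛ iq u ⊛ (α r ⊛ (iq t ⊛ iq (t ℕ.+ (r ℕ.+ r ℕ.+ c)))) ≈ F r t u
    regroup r t refl = ≈-trans
      (⊛-congʳ (α r ⊛ (iq t ⊛ iq (t ℕ.+ (r ℕ.+ r ℕ.+ c)))) (⊛-congʳ (iq u)
        (mono-split (r ℕ.* (r ℕ.+ c)) (t ℕ.* (t ℕ.+ (r ℕ.+ r ℕ.+ c))) (exponent r t c))))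
      (solve 5 (λ x y i a j → (x :* y) :* i :* (a :* j) := (x :* a) :* (y :* (i :* j))) ≈-refl
        (mono (r ℕ.* (r ℕ.+ c))) (mono (t ℕ.* (t ℕ.+ (r ℕ.+ r ℕ.+ c)))) (iq u) (α r) (iq t ⊛ iq (t ℕ.+ (r ℕ.+ r ℕ.+ c))))
  collapse : ∀ r v → conv v (λ t u → F r t u) ≈ baileyα c α r ⊛ (iq v ⊛ iq (v ℕ.+ (r ℕ.+ r ℕ.+ c)))
  collapse r v = ≈-trans (≈-sym (conv-⊛ v (baileyα c α r) (w r))) (⊛-congˡ (baileyα c α r) (qVandermonde v (r ℕ.+ r ℕ.+ c)))

-- n (n - 1) / 2
tp : ℕ → ℕ
tp zero    = 0
tp (suc n) = n ℕ.+ tp n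

alt : ℕ → PS
alt zero    = 𝟙
alt (suc n) = ⊝ alt n

-- The pairs with β = 1, 0, 0, ... relative to a = 1 and a = q. The second is 1 - q times the
-- customary α, because `β` has (q)_(N+r+1) where the customary definition has (q²;q)_(N+r).
unitα₀ unitα₁ : ℕ → PS
unitα₀ zero    = 𝟙
unitα₀ (suc r) = alt (suc r) ⊛ (mono (tp (suc r)) ⊕ mono (tp (suc (suc r))))
unitα₁ r       = alt r ⊛ (mono (tp r) ⊖ mono (tp (suc (suc r))))

-- Both unit pairs telescope: (1 - q^N) times the partial sum up to r, N = r + a, is
-- (-1)^r q^(r(r+1)/2) (1 - q^a) / ((q)_a (q)_(a+2r))                      for c = 0,
-- (-1)^r q^(r(r+1)/2) (1 - q^(r+1)) (1 - q^a) / ((q)_a (q)_(a+2r+1))      for c = 1.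
unitβ₀ : ∀ N → β 0 unitα₀ (suc N) ≈ 𝟘
unitβ₀ N = inv-cancel (1-q^ (suc N)) refl (begin
  1-q^ (suc N) ⊛ β 0 unitα₀ (suc N)
    ≈⟨ conv-⊛ (suc N) (1-q^ (suc N)) (λ r a → unitα₀ r ⊛ I r a) ⟩
  conv (suc N) (λ r a → 1-q^ (suc N) ⊛ (unitα₀ r ⊛ I r a))
    ≈⟨ conv-telescope (suc N) (λ r a → 1-q^ (suc N) ⊛ (unitα₀ r ⊛ I r a)) P base step ⟩
  P (suc N) 0
    ≈⟨ ≈-trans (⊛-congˡ (alt (suc N) ⊛ mono (tp (suc (suc N)))) (1-q^0 (I (suc N) 0))) (⊛-zeroʳ (alt (suc N) ⊛ mono (tp (suc (suc N))))) ⟩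
  𝟘
    ≈⟨ ⊛-zeroʳ (1-q^ (suc N)) ⟨
  1-q^ (suc N) ⊛ 𝟘 ∎)
  where
  I P : ℕ → ℕ → PS
  I r a = iq a ⊛ iq (a ℕ.+ (r ℕ.+ r ℕ.+ 0))
  P r a = alt r ⊛ mono (tp (suc r)) ⊛ (1-q^ a ⊛ I r a)
  base : 1-q^ (suc N) ⊛ (𝟙 ⊛ I 0 (suc N)) ≈ P 0 (suc N)
  base = ≈-trans (solve 2 (λ x i → x :* (con (+ 1) :* i) := con (+ 1) :* con (+ 1) :* (x :* i)) ≈-refl (1-q^ (suc N)) (I 0 (suc N)))
    (⊛-congʳ (1-q^ (suc N) ⊛ I 0 (suc N)) (⊛-congˡ 𝟙 (≈-sym one≈𝟙)))
  step : ∀ r a → r ℕ.+ suc a ≡ suc N → P r (suc a) ⊕ 1-q^ (suc N) ⊛ (unitα₀ (suc r) ⊛ I (suc r) a) ≈ P (suc r) a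
  step r a eq = begin
    alt r ⊛ mono (tp (suc r)) ⊛ (1-q^ (suc a) ⊛ (iq (suc a) ⊛ iq (suc a ℕ.+ (r ℕ.+ r ℕ.+ 0))))
      ⊕ 1-q^ (suc N) ⊛ ((⊝ alt r) ⊛ (mono (tp (suc r)) ⊕ mono (tp (suc (suc r)))) ⊛ I (suc r) a)
      ≈⟨ ⊕-cong (⊛-congˡ (alt r ⊛ mono (tp (suc r))) shift)
           (⊛-cong (⊖-cong (≈-refl {𝟙}) xy) (⊛-congʳ (I (suc r) a) (⊛-congˡ (⊝ alt r) (⊕-congˡ (mono (tp (suc r))) tp-split)))) ⟩
    alt r ⊛ mono (tp (suc r)) ⊛ (iq a ⊛ ((𝟙 ⊖ x ⊛ x ⊛ y) ⊛ iq J))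
      ⊕ (𝟙 ⊖ x ⊛ y) ⊛ ((⊝ alt r) ⊛ (mono (tp (suc r)) ⊕ x ⊛ mono (tp (suc r))) ⊛ (iq a ⊛ iq J))
      ≈⟨ solve 6 (λ s m x y i j → s :* m :* (i :* ((con (+ 1) :- x :* x :* y) :* j))
             :+ (con (+ 1) :- x :* y) :* ((:- s) :* (m :+ x :* m) :* (i :* j))
           := (:- s) :* (x :* m) :* ((con (+ 1) :- y) :* (i :* j))) ≈-refl
           (alt r) (mono (tp (suc r))) x y (iq a) (iq J) ⟩
    (⊝ alt r) ⊛ (x ⊛ mono (tp (suc r))) ⊛ (1-q^ a ⊛ I (suc r) a)
      ≈⟨ ⊛-congʳ (1-q^ a ⊛ I (suc r) a) (⊛-congˡ (⊝ alt r) (≈-sym tp-split)) ⟩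
    P (suc r) a ∎
    where
    x y : PS
    x = mono (suc r)
    y = mono a
    J = a ℕ.+ (suc r ℕ.+ suc r ℕ.+ 0)
    tp-split : mono (tp (suc (suc r))) ≈ x ⊛ mono (tp (suc r))
    tp-split = mono-split (suc r) (tp (suc r)) refl
    xy : mono (suc N) ≈ x ⊛ y
    xy = mono-split (suc r) a (trans (sym eq) (ℕ.+-suc r a))
    index : ∀ a r → a ℕ.+ (suc r ℕ.+ suc r ℕ.+ 0) ≡ suc (suc (a ℕ.+ (r ℕ.+ r ℕ.+ 0)))
    index = ℕ-solve-∀
    x²y : ∀ a r → suc (suc (a ℕ.+ (r ℕ.+ r ℕ.+ 0))) ≡ suc r ℕ.+ suc r ℕ.+ a
    x²y = ℕ-solve-∀
    lower : iq (suc a ℕ.+ (r ℕ.+ r ℕ.+ 0)) ≈ (𝟙 ⊖ x ⊛ x ⊛ y) ⊛ iq J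
    lower = ≈-trans (≈-sym (iq-step (suc a ℕ.+ (r ℕ.+ r ℕ.+ 0))))
      (⊛-cong (⊖-cong (≈-refl {𝟙}) (≈-trans (mono-split (suc r ℕ.+ suc r) a (x²y a r)) (⊛-congʳ y (≈-sym (mono-+ (suc r) (suc r))))))
              (≡⇒≈ (cong iq (sym (index a r)))))
    shift : 1-q^ (suc a) ⊛ (iq (suc a) ⊛ iq (suc a ℕ.+ (r ℕ.+ r ℕ.+ 0))) ≈ iq a ⊛ ((𝟙 ⊖ x ⊛ x ⊛ y) ⊛ iq J)
    shift = ≈-trans (≈-sym (⊛-≈-assoc (1-q^ (suc a)) (iq (suc a)) (iq (suc a ℕ.+ (r ℕ.+ r ℕ.+ 0))))) (⊛-cong (iq-step a) lower)

unitβ₁ : ∀ N → β 1 unitα₁ (suc N) ≈ 𝟘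
unitβ₁ N = inv-cancel (1-q^ (suc N)) refl (begin
  1-q^ (suc N) ⊛ β 1 unitα₁ (suc N)
    ≈⟨ conv-⊛ (suc N) (1-q^ (suc N)) (λ r a → unitα₁ r ⊛ I r a) ⟩
  conv (suc N) (λ r a → 1-q^ (suc N) ⊛ (unitα₁ r ⊛ I r a))
    ≈⟨ conv-telescope (suc N) (λ r a → 1-q^ (suc N) ⊛ (unitα₁ r ⊛ I r a)) P base step ⟩
  P (suc N) 0
    ≈⟨ ≈-trans (⊛-congˡ (alt (suc N) ⊛ mono (tp (suc (suc N))) ⊛ 1-q^ (suc (suc N))) (1-q^0 (I (suc N) 0)))
         (⊛-zeroʳ (alt (suc N) ⊛ mono (tp (suc (suc N))) ⊛ 1-q^ (suc (suc N)))) ⟩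
  𝟘
    ≈⟨ ⊛-zeroʳ (1-q^ (suc N)) ⟨
  1-q^ (suc N) ⊛ 𝟘 ∎)
  where
  I P : ℕ → ℕ → PS
  I r a = iq a ⊛ iq (a ℕ.+ (r ℕ.+ r ℕ.+ 1))
  P r a = alt r ⊛ mono (tp (suc r)) ⊛ 1-q^ (suc r) ⊛ (1-q^ a ⊛ I r a)
  base : 1-q^ (suc N) ⊛ (unitα₁ 0 ⊛ I 0 (suc N)) ≈ P 0 (suc N)
  base = ≈-trans
    (⊛-congˡ (1-q^ (suc N)) (⊛-congʳ (I 0 (suc N)) (⊛-congˡ 𝟙 (⊖-cong one≈𝟙 (≈-refl {mono 1})))))
    (≈-trans (solve 3 (λ x i m → x :* (con (+ 1) :* (con (+ 1) :- m) :* i) := con (+ 1) :* con (+ 1) :* (con (+ 1) :- m) :* (x :* i)) ≈-refl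
       (1-q^ (suc N)) (I 0 (suc N)) (mono 1))
    (⊛-congʳ (1-q^ (suc N) ⊛ I 0 (suc N)) (⊛-congʳ (1-q^ 1) (⊛-congˡ 𝟙 (≈-sym one≈𝟙)))))
  step : ∀ r a → r ℕ.+ suc a ≡ suc N → P r (suc a) ⊕ 1-q^ (suc N) ⊛ (unitα₁ (suc r) ⊛ I (suc r) a) ≈ P (suc r) a
  step r a eq = begin
    alt r ⊛ m ⊛ 1-q^ (suc r) ⊛ (1-q^ (suc a) ⊛ (iq (suc a) ⊛ iq (suc a ℕ.+ (r ℕ.+ r ℕ.+ 1))))
      ⊕ 1-q^ (suc N) ⊛ ((⊝ alt r) ⊛ (m ⊖ mono (tp (suc (suc (suc r))))) ⊛ I (suc r) a)
      ≈⟨ ⊕-cong (⊛-congˡ (alt r ⊛ m ⊛ 1-q^ (suc r)) shift)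
           (⊛-cong (⊖-cong (≈-refl {𝟙}) xy) (⊛-congʳ (I (suc r) a) (⊛-congˡ (⊝ alt r) (⊖-cong (≈-refl {m}) tp-split₂)))) ⟩
    alt r ⊛ m ⊛ (𝟙 ⊖ x) ⊛ (iq a ⊛ ((𝟙 ⊖ x ⊛ (z ⊛ x) ⊛ y) ⊛ iq J))
      ⊕ (𝟙 ⊖ x ⊛ y) ⊛ ((⊝ alt r) ⊛ (m ⊖ z ⊛ x ⊛ (x ⊛ m)) ⊛ (iq a ⊛ iq J))
      ≈⟨ solve 7 (λ s m x y z i j → s :* m :* (con (+ 1) :- x) :* (i :* ((con (+ 1) :- x :* (z :* x) :* y) :* j))
             :+ (con (+ 1) :- x :* y) :* ((:- s) :* (m :- z :* x :* (x :* m)) :* (i :* j))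
           := (:- s) :* (x :* m) :* (con (+ 1) :- z :* x) :* ((con (+ 1) :- y) :* (i :* j))) ≈-refl
           (alt r) m x y z (iq a) (iq J) ⟩
    (⊝ alt r) ⊛ (x ⊛ m) ⊛ (𝟙 ⊖ z ⊛ x) ⊛ (1-q^ a ⊛ I (suc r) a)
      ≈⟨ ⊛-congʳ (1-q^ a ⊛ I (suc r) a) (⊛-cong (⊛-congˡ (⊝ alt r) (≈-sym tp-split)) (⊖-cong (≈-refl {𝟙}) (≈-sym zx))) ⟩
    P (suc r) a ∎
    where
    x y z m : PS
    x = mono (suc r)
    y = mono a
    z = mono 1
    m = mono (tp (suc r))
    J = a ℕ.+ (suc r ℕ.+ suc r ℕ.+ 1)
    zx : mono (suc (suc r)) ≈ z ⊛ x
    zx = mono-split 1 (suc r) refl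
    tp-split : mono (tp (suc (suc r))) ≈ x ⊛ m
    tp-split = mono-split (suc r) (tp (suc r)) refl
    tp-split₂ : mono (tp (suc (suc (suc r)))) ≈ z ⊛ x ⊛ (x ⊛ m)
    tp-split₂ = ≈-trans (mono-split (suc (suc r)) (tp (suc (suc r))) refl) (⊛-cong zx tp-split)
    xy : mono (suc N) ≈ x ⊛ y
    xy = mono-split (suc r) a (trans (sym eq) (ℕ.+-suc r a))
    index : ∀ a r → a ℕ.+ (suc r ℕ.+ suc r ℕ.+ 1) ≡ suc (suc (a ℕ.+ (r ℕ.+ r ℕ.+ 1)))
    index = ℕ-solve-∀
    x²yz : ∀ a r → suc (suc (a ℕ.+ (r ℕ.+ r ℕ.+ 1))) ≡ suc r ℕ.+ suc (suc r) ℕ.+ a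
    x²yz = ℕ-solve-∀
    lower : iq (suc a ℕ.+ (r ℕ.+ r ℕ.+ 1)) ≈ (𝟙 ⊖ x ⊛ (z ⊛ x) ⊛ y) ⊛ iq J
    lower = ≈-trans (≈-sym (iq-step (suc a ℕ.+ (r ℕ.+ r ℕ.+ 1))))
      (⊛-cong (⊖-cong (≈-refl {𝟙}) (≈-trans (mono-split (suc r ℕ.+ suc (suc r)) a (x²yz a r))
                (⊛-congʳ y (≈-trans (≈-sym (mono-+ (suc r) (suc (suc r)))) (⊛-congˡ x zx)))))
              (≡⇒≈ (cong iq (sym (index a r)))))
    shift : 1-q^ (suc a) ⊛ (iq (suc a) ⊛ iq (suc a ℕ.+ (r ℕ.+ r ℕ.+ 1))) ≈ iq a ⊛ ((𝟙 ⊖ x ⊛ (z ⊛ x) ⊛ y) ⊛ iq J)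
    shift = ≈-trans (≈-sym (⊛-≈-assoc (1-q^ (suc a)) (iq (suc a)) (iq (suc a ℕ.+ (r ℕ.+ r ℕ.+ 1))))) (⊛-cong (iq-step a) lower)

-- Limits of finite sums

Ord : ℕ → PS → Set
Ord r f = ∀ i → i < r → f i ≡ + 0

Ord-mono : ∀ k f r → r ≤ k → Ord r (mono k ⊛ f)
Ord-mono k f r r≤k i i<r = mono-⊛-small k f i (ℕ.<-≤-trans i<r r≤k)

Ord-≈ : ∀ {r} → f ≈ g → Ord r f → Ord r g
Ord-≈ p o i i<r = trans (sym (p .at i)) (o i i<r)

Ord-decomp : ∀ r f → Ord r f → f ≈ mono r ⊛ (λ n → f (r ℕ.+ n))
Ord-decomp r f o .at n with n ℕ.<? r
... | yes n<r = trans (o n n<r) (sym (mono-⊛-small r (λ n → f (r ℕ.+ n)) n n<r))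
... | no  n≮r = subst (λ m → f m ≡ (mono r ⊛ (λ n → f (r ℕ.+ n))) m) (ℕ.m+[n∸m]≡n (ℕ.≮⇒≥ n≮r))
                  (sym (mono-⊛-shift r (λ n → f (r ℕ.+ n)) (n ∸ r)))

-- A factor q^r can be taken out of f, so r coefficients of precision are gained in the other
-- factor.
Ord-~ : ∀ r f g h n → Ord r f → g ~[ n ] h → f ⊛ g ~[ r ℕ.+ n ] f ⊛ h
Ord-~ r f g h n o p i i≤ = trans (split g .at i) (trans (mono-~ r {f′ ⊛ g} {f′ ⊛ h} (~-⊛ {f′} {f′} {g} {h} (λ _ _ → refl) p) i i≤) (sym (split h .at i)))
  where
  f′ : PS
  f′ n = f (r ℕ.+ n)
  split : ∀ g → f ⊛ g ≈ mono r ⊛ (f′ ⊛ g)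
  split g = ≈-trans (⊛-congʳ g (Ord-decomp r f o)) (⊛-≈-assoc (mono r) f′ g)

-- This is the infinite sum provided that the r-th term has order at least r, as it does for all the
-- sums formed here.
limsum : (ℕ → PS) → PS
limsum F n = ∑ (upTo (suc n)) (λ r → F r n)

conv-at : ∀ N (F : ℕ → PS) i → conv N (λ r _ → F r) i ≡ ∑ (upTo (suc N)) (λ r → F r i)
conv-at zero    F i = sym (ℤ.+-identityʳ _)
conv-at (suc N) F i = trans (cong (_+_ (F 0 i)) (conv-at N (F ∘ suc) i)) (sym (∑-upTo-suc (suc N) (λ r → F r i)))

∑-upTo-truncate : ∀ (φ : ℕ → ℤ) i d → (∀ r → i < r → φ r ≡ + 0) → ∑ (upTo (suc (d ℕ.+ i))) φ ≡ ∑ (upTo (suc i)) φ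
∑-upTo-truncate φ i zero    φ≡0 = refl
∑-upTo-truncate φ i (suc d) φ≡0 = trans (∑-upTo-last (suc (d ℕ.+ i)) φ)
  (trans (cong₂ _+_ (∑-upTo-truncate φ i d φ≡0) (φ≡0 (suc (d ℕ.+ i)) (s≤s (ℕ.m≤n+m i d)))) (ℤ.+-identityʳ _))

conv-~ : ∀ N n {F G : ℕ → ℕ → PS} → (∀ r a → r ℕ.+ a ≡ N → F r a ~[ n ] G r a) → conv N F ~[ n ] conv N G
conv-~ zero    n p = p 0 0 refl
conv-~ (suc N) n {F} {G} p i i≤n = cong₂ _+_ (p 0 (suc N) refl i i≤n)
  (conv-~ N n (λ r a eq → p (suc r) a (cong suc eq)) i i≤n)

conv~limsum : ∀ N (F : ℕ → ℕ → PS) (H : ℕ → PS) → (∀ r a → F r a ~[ r ℕ.+ a ] H r) → (∀ r → Ord r (H r)) →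
  conv N F ~[ N ] limsum H
conv~limsum N F H F~H o i i≤N = trans (conv-~ N N {F} {λ r _ → H r} (λ { r a refl → F~H r a }) i i≤N)
  (trans (conv-at N H i) (subst (λ M → ∑ (upTo (suc M)) (λ r → H r i) ≡ limsum H i) (ℕ.m∸n+n≡m i≤N)
    (∑-upTo-truncate (λ r → H r i) i (N ∸ i) (λ r i<r → o r i i<r))))

zsum : ℕ → (ℤ → PS) → PS
zsum zero    Φ = Φ (+ 0)
zsum (suc n) Φ = zsum n Φ ⊕ (Φ (+ suc n) ⊕ Φ -[1+ n ])

limZ : (ℤ → PS) → PS
limZ Φ n = zsum n Φ n

zsum-cong : ∀ n {Φ Ψ : ℤ → PS} → (∀ j → Φ j ≈ Ψ j) → zsum n Φ ≈ zsum n Ψ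
zsum-cong zero    p = p (+ 0)
zsum-cong (suc n) p = ⊕-cong (zsum-cong n p) (⊕-cong (p (+ suc n)) (p -[1+ n ]))

zsum-⊛ : ∀ n c Φ → c ⊛ zsum n Φ ≈ zsum n (λ j → c ⊛ Φ j)
zsum-⊛ zero    c Φ = ≈-refl
zsum-⊛ (suc n) c Φ = ≈-trans (⊛-⊕-distribˡ c (zsum n Φ) (Φ (+ suc n) ⊕ Φ -[1+ n ]))
  (⊕-cong (zsum-⊛ n c Φ) (⊛-⊕-distribˡ c (Φ (+ suc n)) (Φ -[1+ n ])))

zsum-~ : ∀ N n {Φ Ψ : ℤ → PS} → (∀ j → ∣ j ∣ ≤ N → Φ j ~[ n ] Ψ j) → zsum N Φ ~[ n ] zsum N Ψ
zsum-~ zero    n p = p (+ 0) z≤n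
zsum-~ (suc N) n p i i≤n = cong₂ _+_ (zsum-~ N n (λ j j≤N → p j (ℕ.m≤n⇒m≤1+n j≤N)) i i≤n)
  (cong₂ _+_ (p (+ suc N) ℕ.≤-refl i i≤n) (p -[1+ N ] ℕ.≤-refl i i≤n))

zsum~limZ : ∀ N Φ → (∀ j → Ord ∣ j ∣ (Φ j)) → zsum N Φ ~[ N ] limZ Φ
zsum~limZ N Φ o i i≤N = subst (λ m → zsum m Φ i ≡ zsum i Φ i) (ℕ.m∸n+n≡m i≤N) (go (N ∸ i))
  where
  go : ∀ d → zsum (d ℕ.+ i) Φ i ≡ zsum i Φ i
  go zero    = refl
  go (suc d) = trans (cong₂ _+_ (go d) (cong₂ _+_ (o (+ suc (d ℕ.+ i)) i i<) (o -[1+ d ℕ.+ i ] i i<))) (ℤ.+-identityʳ _)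
    where
    i< : i < suc (d ℕ.+ i)
    i< = s≤s (ℕ.m≤n+m i d)

limsum≈limZ₀ : ∀ α Φ → α 0 ≈ Φ (+ 0) → (∀ r → α (suc r) ≈ Φ (+ suc r) ⊕ Φ -[1+ r ]) → limsum α ≈ limZ Φ
limsum≈limZ₀ α Φ p₀ p .at n = go n
  where
  go : ∀ m → ∑ (upTo (suc m)) (λ r → α r n) ≡ zsum m Φ n
  go zero    = trans (ℤ.+-identityʳ _) (p₀ .at n)
  go (suc m) = trans (∑-upTo-last (suc m) (λ r → α r n)) (cong₂ _+_ (go m) (p m .at n))

-- Here α r collects j = r and j = - r - 1, so the partial sums are ahead of `zsum` by the single
-- term j = - n - 1. Its order exceeds n, so it does not reach coefficient n.
limsum≈limZ₁ : ∀ α Φ → (∀ j → Ord ∣ j ∣ (Φ j)) → (∀ r → α r ≈ Φ (+ r) ⊕ Φ -[1+ r ]) → limsum α ≈ limZ Φ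
limsum≈limZ₁ α Φ o p .at n = trans (go n) (trans (cong (_+_ (zsum n Φ n)) (o -[1+ n ] n ℕ.≤-refl)) (ℤ.+-identityʳ _))
  where
  go : ∀ m → ∑ (upTo (suc m)) (λ r → α r n) ≡ zsum m Φ n + Φ -[1+ m ] n
  go zero    = trans (ℤ.+-identityʳ _) (p 0 .at n)
  go (suc m) = trans (∑-upTo-last (suc m) (λ r → α r n))
    (trans (cong₂ _+_ (go m) (p (suc m) .at n))
      (regroup (zsum m Φ n) (Φ -[1+ m ] n) (Φ (+ suc m) n) (Φ -[1+ suc m ] n)))
    where
    regroup : ∀ a b c d → a + b + (c + d) ≡ a + (c + b) + d
    regroup = solve-∀

-- E, E G and E H as theta series

E-iq : ∀ a → E ⊛ iq a ~[ a ] 𝟙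
E-iq a i i≤a = trans (~-⊛ {E} {qPoch a} {iq a} {iq a} (~-sym {qPoch a} {g = E} (qPoch~E a)) (λ _ _ → refl) i i≤a) (qPoch-iq a .at i)

-- E / (q)_a is 1 up to q^a, where a = N - r; the missing r coefficients are supplied by the order
-- of α r.
β-limit : ∀ c α → (∀ r → Ord r (α r)) → ∀ N → E ⊛ E ⊛ β c α N ~[ N ] limsum α
β-limit c α o N i i≤N = trans (conv-⊛ N (E ⊛ E) (λ r a → α r ⊛ (iq a ⊛ iq (a ℕ.+ (r ℕ.+ r ℕ.+ c)))) .at i)
  (conv~limsum N _ α term~ o i i≤N)
  where
  term~ : ∀ r a → E ⊛ E ⊛ (α r ⊛ (iq a ⊛ iq (a ℕ.+ (r ℕ.+ r ℕ.+ c)))) ~[ r ℕ.+ a ] α r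
  term~ r a j j≤ = trans
    (solve 4 (λ e α i i′ → e :* e :* (α :* (i :* i′)) := α :* ((e :* i) :* (e :* i′))) ≈-refl E (α r) (iq a) (iq b) .at j)
    (trans (Ord-~ r (α r) (E ⊛ iq a ⊛ (E ⊛ iq b)) (𝟙 ⊛ 𝟙) a (o r)
              (~-⊛ {E ⊛ iq a} {𝟙} {E ⊛ iq b} {𝟙} (E-iq a) (~-mono {E ⊛ iq b} {𝟙} (ℕ.m≤m+n a _) (E-iq b))) j j≤)
           (solve 1 (λ α → α :* (con (+ 1) :* con (+ 1)) := α) ≈-refl (α r) .at j))
    where b = a ℕ.+ (r ℕ.+ r ℕ.+ c)

Ord-baileyα : ∀ c α r → Ord r (baileyα c α r)
Ord-baileyα c α r = Ord-mono (r ℕ.* (r ℕ.+ c)) (α r) r (r≤ r)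
  where
  r≤ : ∀ r → r ≤ r ℕ.* (r ℕ.+ c)
  r≤ zero    = z≤n
  r≤ (suc r) = ℕ.m≤m*n (suc r) (suc r ℕ.+ c)

-- As β vanishes except at 0, only the first term of `baileyβ` survives: one step from the unit pair
-- reaches β_N = 1/(q)_N.
unit-bailey : ∀ c α → β c α 0 ≈ 𝟙 → (∀ N → β c α (suc N) ≈ 𝟘) → ∀ N → β c (baileyα c α) N ≈ iq N
unit-bailey c α β0 βs N = ≈-trans (bailey c α N) (≈-trans (conv-first N _ vanish)
    (≈-trans (one-⊛ (iq N ⊛ β c α 0)) (≈-trans (⊛-congˡ (iq N) β0) (⊛-identityʳ (iq N)))))
  where
  vanish : ∀ s u → mono (suc s ℕ.* (suc s ℕ.+ c)) ⊛ (iq u ⊛ β c α (suc s)) ≈ 𝟘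
  vanish s u = ≈-trans (⊛-congˡ (mono (suc s ℕ.* (suc s ℕ.+ c))) (≈-trans (⊛-congˡ (iq u) (βs s)) (⊛-zeroʳ (iq u))))
    (⊛-zeroʳ (mono (suc s ℕ.* (suc s ℕ.+ c))))

unitβ₀-0 : β 0 unitα₀ 0 ≈ 𝟙
unitβ₀-0 = ≈-trans (⊛-congˡ 𝟙 (⊛-cong iq-0 iq-0)) (solve 0 (con (+ 1) :* (con (+ 1) :* con (+ 1)) := con (+ 1)) ≈-refl)

unitβ₁-0 : β 1 unitα₁ 0 ≈ 𝟙
unitβ₁-0 = begin
  𝟙 ⊛ (one ⊖ mono 1) ⊛ (iq 0 ⊛ iq 1)
    ≈⟨ ⊛-cong (⊛-congˡ 𝟙 (⊖-cong one≈𝟙 (≈-refl {mono 1}))) (⊛-congʳ (iq 1) iq-0) ⟩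
  𝟙 ⊛ 1-q^ 1 ⊛ (𝟙 ⊛ iq 1)
    ≈⟨ solve 2 (λ x i → con (+ 1) :* x :* (con (+ 1) :* i) := x :* i) ≈-refl (1-q^ 1) (iq 1) ⟩
  1-q^ 1 ⊛ iq 1  ≈⟨ iq-step 0 ⟩
  iq 0           ≈⟨ iq-0 ⟩
  𝟙              ∎

rogersRamanujanSum : ℕ → PS
rogersRamanujanSum c = limsum (λ s → mono (s ℕ.* (s ℕ.+ c)) ⊛ iq s)

-- One more Bailey step from β_N = 1/(q)_N, multiplied by E² and taken to N → ∞: the α side becomes
-- the sum of the new α, and on the β side E / (q)_u tends to 1, leaving E times the
-- Rogers-Ramanujan sum.
rogersRamanujan : ∀ c α → (∀ N → β c α N ≈ iq N) → E ⊛ rogersRamanujanSum c ≈ limsum (baileyα c α)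
rogersRamanujan c α β≈iq = ~⇒≈ λ N i i≤N → trans
  (~-⊛ {E} {E} {rogersRamanujanSum c} {E ⊛ S N} (λ _ _ → refl) (~-sym {E ⊛ S N} {g = rogersRamanujanSum c} (S~ N)) i i≤N)
  (trans (sym (⊛-≈-assoc E E (S N) .at i))
    (trans (⊛-congˡ (E ⊛ E) (≈-trans (conv-cong N (λ s u _ → ⊛-congˡ (mono (s ℕ.* (s ℕ.+ c))) (⊛-congˡ (iq u) (≈-sym (β≈iq s)))))
                                     (≈-sym (bailey c α N))) .at i)
           (β-limit c (baileyα c α) (Ord-baileyα c α) N i i≤N)))
  where
  S : ℕ → PS
  S N = conv N (λ s u → mono (s ℕ.* (s ℕ.+ c)) ⊛ (iq u ⊛ iq s))
  S~ : ∀ N → E ⊛ S N ~[ N ] rogersRamanujanSum c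
  S~ N i i≤N = trans (conv-⊛ N E (λ s u → mono (s ℕ.* (s ℕ.+ c)) ⊛ (iq u ⊛ iq s)) .at i)
    (conv~limsum N _ _ term~ (Ord-baileyα c iq) i i≤N)
    where
    term~ : ∀ s u → E ⊛ (mono (s ℕ.* (s ℕ.+ c)) ⊛ (iq u ⊛ iq s)) ~[ s ℕ.+ u ] mono (s ℕ.* (s ℕ.+ c)) ⊛ iq s
    term~ s u j j≤ = trans
      (solve 4 (λ e m i i′ → e :* (m :* (i :* i′)) := (m :* i′) :* (e :* i)) ≈-refl E (mono (s ℕ.* (s ℕ.+ c))) (iq u) (iq s) .at j)
      (trans (Ord-~ s (mono (s ℕ.* (s ℕ.+ c)) ⊛ iq s) (E ⊛ iq u) 𝟙 u (Ord-baileyα c iq s) (E-iq u) j j≤)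
             (⊛-identityʳ (mono (s ℕ.* (s ℕ.+ c)) ⊛ iq s) .at j))

-- The exponent k j (j - 1) / 2 + b j for j ≥ 0, and k i (i - 1) / 2 + b′ i for j = - i; the two agree when b + b′ = k.
ex : ℕ → ℕ → ℕ → ℤ → ℕ
ex k b b′ (+ n)    = k ℕ.* tp n ℕ.+ b ℕ.* n
ex k b b′ -[1+ n ] = k ℕ.* tp (suc n) ℕ.+ b′ ℕ.* suc n

τterm : ℕ → ℕ → ℕ → ℤ → PS
τterm k b b′ j = alt ∣ j ∣ ⊛ mono (ex k b b′ j)

-- For b + b′ = k this is the triple product (q^b; q^k)_∞ (q^b′; q^k)_∞ (q^k; q^k)_∞.
τ : ℕ → ℕ → ℕ → PS
τ k b b′ = limZ (τterm k b b′)

∣j∣≤ex : ∀ k b b′ j → ∣ j ∣ ≤ ex k (suc b) (suc b′) j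
∣j∣≤ex k b b′ (+ n)    = ℕ.≤-trans (ℕ.m≤m+n n (b ℕ.* n)) (ℕ.m≤n+m _ (k ℕ.* tp n))
∣j∣≤ex k b b′ -[1+ n ] = ℕ.≤-trans (ℕ.m≤m+n (suc n) (b′ ℕ.* suc n)) (ℕ.m≤n+m _ (k ℕ.* tp (suc n)))

Ord-τterm : ∀ k b b′ j → Ord ∣ j ∣ (τterm k (suc b) (suc b′) j)
Ord-τterm k b b′ j = Ord-≈ (⊛-≈-comm (mono (ex k (suc b) (suc b′) j)) (alt ∣ j ∣))
  (Ord-mono _ (alt ∣ j ∣) ∣ j ∣ (∣j∣≤ex k b b′ j))

tp-square : ∀ n → n ℕ.* n ≡ tp n ℕ.+ tp n ℕ.+ n
tp-square zero    = refl
tp-square (suc n) = trans (expand n) (trans (cong (λ z → z ℕ.+ n ℕ.+ n ℕ.+ 1) (tp-square n)) (collect n (tp n)))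
  where
  expand : ∀ n → suc n ℕ.* suc n ≡ n ℕ.* n ℕ.+ n ℕ.+ n ℕ.+ 1
  expand = ℕ-solve-∀
  collect : ∀ n t → t ℕ.+ t ℕ.+ n ℕ.+ n ℕ.+ n ℕ.+ 1 ≡ (n ℕ.+ t) ℕ.+ (n ℕ.+ t) ℕ.+ suc n
  collect = ℕ-solve-∀

tp-+ : ∀ m n → tp (m ℕ.+ n) ≡ tp m ℕ.+ tp n ℕ.+ m ℕ.* n
tp-+ zero    n = sym (ℕ.+-identityʳ (tp n))
tp-+ (suc m) n = trans (cong (m ℕ.+ n ℕ.+_) (tp-+ m n)) (regroup m n (tp m) (tp n))
  where
  regroup : ∀ m n s t → m ℕ.+ n ℕ.+ (s ℕ.+ t ℕ.+ m ℕ.* n) ≡ m ℕ.+ s ℕ.+ t ℕ.+ (n ℕ.+ m ℕ.* n)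
  regroup = ℕ-solve-∀

-- Euler's pentagonal number theorem: a single Bailey step gives β_N = 1/(q)_N, and E² β_N tends to
-- E.
E≈τ : E ≈ τ 3 1 2
E≈τ = ≈-trans (~⇒≈ λ N i i≤N → trans
    (~-sym {E ⊛ E ⊛ iq N} {g = E} (λ i i≤N → trans (⊛-≈-assoc E E (iq N) .at i)
      (trans (~-⊛ {E} {E} {E ⊛ iq N} {𝟙} (λ _ _ → refl) (E-iq N) i i≤N) (⊛-identityʳ E .at i))) i i≤N)
    (trans (⊛-congˡ (E ⊛ E) (≈-sym (unit-bailey 0 unitα₀ unitβ₀-0 unitβ₀ N)) .at i)
           (β-limit 0 (baileyα 0 unitα₀) (Ord-baileyα 0 unitα₀) N i i≤N)))
  (limsum≈limZ₀ (baileyα 0 unitα₀) (τterm 3 1 2) (≈-trans (one-⊛ 𝟙) (≈-sym (≈-trans (⊛-identityˡ one) one≈𝟙))) term)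
  where
  term : ∀ r → baileyα 0 unitα₀ (suc r) ≈ τterm 3 1 2 (+ suc r) ⊕ τterm 3 1 2 -[1+ r ]
  term r = ≈-trans
    (solve 4 (λ m s x y → m :* (s :* (x :+ y)) := s :* (m :* x) :+ s :* (m :* y)) ≈-refl
      (mono (suc r ℕ.* (suc r ℕ.+ 0))) (alt (suc r)) (mono (tp (suc r))) (mono (tp (suc (suc r)))))
    (⊕-cong (⊛-congˡ (alt (suc r)) (≈-trans (mono-+ (suc r ℕ.* (suc r ℕ.+ 0)) (tp (suc r))) (mono-≡ e₁)))
            (⊛-congˡ (alt (suc r)) (≈-trans (mono-+ (suc r ℕ.* (suc r ℕ.+ 0)) (tp (suc (suc r)))) (mono-≡ e₂))))
    where
    t = tp (suc r)
    sq : suc r ℕ.* (suc r ℕ.+ 0) ≡ t ℕ.+ t ℕ.+ suc r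
    sq = trans (cong (suc r ℕ.*_) (ℕ.+-identityʳ (suc r))) (tp-square (suc r))
    lin₁ : ∀ t n → t ℕ.+ t ℕ.+ n ℕ.+ t ≡ 3 ℕ.* t ℕ.+ 1 ℕ.* n
    lin₁ = ℕ-solve-∀
    lin₂ : ∀ t n → t ℕ.+ t ℕ.+ n ℕ.+ (n ℕ.+ t) ≡ 3 ℕ.* t ℕ.+ 2 ℕ.* n
    lin₂ = ℕ-solve-∀
    e₁ : suc r ℕ.* (suc r ℕ.+ 0) ℕ.+ t ≡ 3 ℕ.* t ℕ.+ 1 ℕ.* suc r
    e₁ = trans (cong (ℕ._+ t) sq) (lin₁ t (suc r))
    e₂ : suc r ℕ.* (suc r ℕ.+ 0) ℕ.+ (suc r ℕ.+ t) ≡ 3 ℕ.* t ℕ.+ 2 ℕ.* suc r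
    e₂ = trans (cong (ℕ._+ (suc r ℕ.+ t)) sq) (lin₂ t (suc r))

G≈sum : G ≈ rogersRamanujanSum 0
G≈sum .at N = ∑-cong (upTo (suc N)) (λ n → ⊛-congʳ (iq n) (mono-≡ (cong (n ℕ.*_) (sym (ℕ.+-identityʳ n)))) .at N)

H≈sum : H ≈ rogersRamanujanSum 1
H≈sum .at N = ∑-cong (upTo (suc N)) (λ n → ⊛-congʳ (iq n) (mono-≡ (cong (n ℕ.*_) (ℕ.+-comm 1 n))) .at N)

E⊛G≈τ : E ⊛ G ≈ τ 5 2 3
E⊛G≈τ = ≈-trans (⊛-congˡ E G≈sum)
  (≈-trans (rogersRamanujan 0 (baileyα 0 unitα₀) (unit-bailey 0 unitα₀ unitβ₀-0 unitβ₀))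
  (limsum≈limZ₀ (baileyα 0 (baileyα 0 unitα₀)) (τterm 5 2 3)
    (≈-trans (one-⊛ (one ⊛ 𝟙)) (≈-trans (one-⊛ 𝟙) (≈-sym (≈-trans (⊛-identityˡ one) one≈𝟙)))) term))
  where
  term : ∀ r → baileyα 0 (baileyα 0 unitα₀) (suc r) ≈ τterm 5 2 3 (+ suc r) ⊕ τterm 5 2 3 -[1+ r ]
  term r = ≈-trans
    (solve 4 (λ m s x y → m :* (m :* (s :* (x :+ y))) := s :* (m :* (m :* x)) :+ s :* (m :* (m :* y))) ≈-refl
      m (alt (suc r)) (mono (tp (suc r))) (mono (tp (suc (suc r)))))
    (⊕-cong (⊛-congˡ (alt (suc r)) (≈-trans (⊛-congˡ m (mono-+ M t)) (≈-trans (mono-+ M (M ℕ.+ t)) (mono-≡ e₁))))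
            (⊛-congˡ (alt (suc r)) (≈-trans (⊛-congˡ m (mono-+ M (suc r ℕ.+ t))) (≈-trans (mono-+ M (M ℕ.+ (suc r ℕ.+ t))) (mono-≡ e₂)))))
    where
    t M : ℕ
    t = tp (suc r)
    M = suc r ℕ.* (suc r ℕ.+ 0)
    m = mono M
    sq : M ≡ t ℕ.+ t ℕ.+ suc r
    sq = trans (cong (suc r ℕ.*_) (ℕ.+-identityʳ (suc r))) (tp-square (suc r))
    lin₁ : ∀ t n → t ℕ.+ t ℕ.+ n ℕ.+ (t ℕ.+ t ℕ.+ n ℕ.+ t) ≡ 5 ℕ.* t ℕ.+ 2 ℕ.* n
    lin₁ = ℕ-solve-∀
    lin₂ : ∀ t n → t ℕ.+ t ℕ.+ n ℕ.+ (t ℕ.+ t ℕ.+ n ℕ.+ (n ℕ.+ t)) ≡ 5 ℕ.* t ℕ.+ 3 ℕ.* n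
    lin₂ = ℕ-solve-∀
    e₁ : M ℕ.+ (M ℕ.+ t) ≡ 5 ℕ.* t ℕ.+ 2 ℕ.* suc r
    e₁ = trans (cong (λ z → z ℕ.+ (z ℕ.+ t)) sq) (lin₁ t (suc r))
    e₂ : M ℕ.+ (M ℕ.+ (suc r ℕ.+ t)) ≡ 5 ℕ.* t ℕ.+ 3 ℕ.* suc r
    e₂ = trans (cong (λ z → z ℕ.+ (z ℕ.+ (suc r ℕ.+ t))) sq) (lin₂ t (suc r))

E⊛H≈τ : E ⊛ H ≈ τ 5 4 1
E⊛H≈τ = ≈-trans (⊛-congˡ E H≈sum)
  (≈-trans (rogersRamanujan 1 (baileyα 1 unitα₁) (unit-bailey 1 unitα₁ unitβ₁-0 unitβ₁))
  (limsum≈limZ₁ (baileyα 1 (baileyα 1 unitα₁)) (τterm 5 4 1) (Ord-τterm 5 3 0) term))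
  where
  term : ∀ r → baileyα 1 (baileyα 1 unitα₁) r ≈ τterm 5 4 1 (+ r) ⊕ τterm 5 4 1 -[1+ r ]
  term r = ≈-trans
    (solve 4 (λ m s x y → m :* (m :* (s :* (x :- y))) := s :* (m :* (m :* x)) :+ (:- s) :* (m :* (m :* y))) ≈-refl
      m (alt r) (mono (tp r)) (mono (tp (suc (suc r)))))
    (⊕-cong (⊛-congˡ (alt r) (≈-trans (⊛-congˡ m (mono-+ M t)) (≈-trans (mono-+ M (M ℕ.+ t)) (mono-≡ e₁))))
            (⊛-congˡ (⊝ alt r) (≈-trans (⊛-congˡ m (mono-+ M (tp (suc (suc r))))) (≈-trans (mono-+ M (M ℕ.+ tp (suc (suc r)))) (mono-≡ e₂)))))
    where
    t M : ℕ
    t = tp r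
    M = r ℕ.* (r ℕ.+ 1)
    m = mono M
    sq : M ≡ t ℕ.+ t ℕ.+ r ℕ.+ r
    sq = trans (ℕ.*-distribˡ-+ r r 1) (cong₂ ℕ._+_ (tp-square r) (ℕ.*-identityʳ r))
    lin₁ : ∀ t n → t ℕ.+ t ℕ.+ n ℕ.+ n ℕ.+ (t ℕ.+ t ℕ.+ n ℕ.+ n ℕ.+ t) ≡ 5 ℕ.* t ℕ.+ 4 ℕ.* n
    lin₁ = ℕ-solve-∀
    lin₂ : ∀ t n → t ℕ.+ t ℕ.+ n ℕ.+ n ℕ.+ (t ℕ.+ t ℕ.+ n ℕ.+ n ℕ.+ (suc n ℕ.+ (n ℕ.+ t))) ≡ 5 ℕ.* (n ℕ.+ t) ℕ.+ 1 ℕ.* suc n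
    lin₂ = ℕ-solve-∀
    e₁ : M ℕ.+ (M ℕ.+ t) ≡ 5 ℕ.* t ℕ.+ 4 ℕ.* r
    e₁ = trans (cong (λ z → z ℕ.+ (z ℕ.+ t)) sq) (lin₁ t r)
    e₂ : M ℕ.+ (M ℕ.+ tp (suc (suc r))) ≡ 5 ℕ.* tp (suc r) ℕ.+ 1 ℕ.* suc r
    e₂ = trans (cong (λ z → z ℕ.+ (z ℕ.+ tp (suc (suc r)))) sq) (lin₂ t r)

-- The Jacobi triple product

alt-+ : ∀ m n → alt (m ℕ.+ n) ≈ alt m ⊛ alt n
alt-+ zero    n = ≈-sym (⊛-identityˡ (alt n))
alt-+ (suc m) n = ≈-trans (⊝-cong (alt-+ m n)) (solve 2 (λ a b → :- (a :* b) := (:- a) :* b) ≈-refl (alt m) (alt n))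

alt-square : ∀ n → alt n ⊛ alt n ≈ 𝟙
alt-square zero    = ⊛-identityˡ 𝟙
alt-square (suc n) = ≈-trans (solve 1 (λ a → (:- a) :* (:- a) := a :* a) ≈-refl (alt n)) (alt-square n)

substPow-𝟙 : ∀ k .{{_ : NonZero k}} → substPow k 𝟙 ≈ 𝟙
substPow-𝟙 k = ≈-trans (substPow-cong k (≈-sym one≈𝟙)) (≈-trans (substPow-one k) one≈𝟙)

substPow-1-q^ : ∀ k .{{_ : NonZero k}} n → substPow k (1-q^ n) ≈ 1-q^ (k ℕ.* n)
substPow-1-q^ k n = ≈-trans (substPow-⊖ k 𝟙 (mono n)) (⊖-cong (substPow-𝟙 k) (substPow-mono k n))

∏-cong : ∀ n {F G : ℕ → PS} → (∀ i → F i ≈ G i) → ∏ n F ≈ ∏ n G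
∏-cong zero    p = ≈-refl
∏-cong (suc n) {F} {G} p = ≈-trans (∏-last n F) (≈-trans (⊛-cong (∏-cong n p) (p n)) (≈-sym (∏-last n G)))

∏-+ : ∀ m n F → ∏ (m ℕ.+ n) F ≈ ∏ m F ⊛ ∏ n (λ i → F (m ℕ.+ i))
∏-+ zero    n F = ≈-sym (one-⊛ (∏ n F))
∏-+ (suc m) n F = begin
  ∏ (suc (m ℕ.+ n)) F                                        ≈⟨ ≡⇒≈ (∏-suc (m ℕ.+ n) F) ⟩
  F 0 ⊛ ∏ (m ℕ.+ n) (F ∘ suc)                                ≈⟨ ⊛-congˡ (F 0) (∏-+ m n (F ∘ suc)) ⟩
  F 0 ⊛ (∏ m (F ∘ suc) ⊛ ∏ n (λ i → F (suc m ℕ.+ i)))        ≈⟨ ⊛-≈-assoc (F 0) (∏ m (F ∘ suc)) (∏ n (λ i → F (suc m ℕ.+ i))) ⟨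
  F 0 ⊛ ∏ m (F ∘ suc) ⊛ ∏ n (λ i → F (suc m ℕ.+ i))          ≈⟨ ⊛-congʳ (∏ n (λ i → F (suc m ℕ.+ i))) (≡⇒≈ (sym (∏-suc m F))) ⟩
  ∏ (suc m) F ⊛ ∏ n (λ i → F (suc m ℕ.+ i))                  ∎

∏-mono-⊛ : ∀ n c F → ∏ n (λ i → mono c ⊛ F i) ≈ mono (n ℕ.* c) ⊛ ∏ n F
∏-mono-⊛ zero    c F = ≈-sym (one-⊛ one)
∏-mono-⊛ (suc n) c F = begin
  ∏ (suc n) (λ i → mono c ⊛ F i)                    ≈⟨ ∏-last n (λ i → mono c ⊛ F i) ⟩
  ∏ n (λ i → mono c ⊛ F i) ⊛ (mono c ⊛ F n)         ≈⟨ ⊛-congʳ (mono c ⊛ F n) (∏-mono-⊛ n c F) ⟩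
  mono (n ℕ.* c) ⊛ ∏ n F ⊛ (mono c ⊛ F n)
    ≈⟨ solve 4 (λ a b c d → a :* b :* (c :* d) := (c :* a) :* (b :* d)) ≈-refl (mono (n ℕ.* c)) (∏ n F) (mono c) (F n) ⟩
  mono c ⊛ mono (n ℕ.* c) ⊛ (∏ n F ⊛ F n)           ≈⟨ ⊛-cong (mono-+ c (n ℕ.* c)) (≈-sym (∏-last n F)) ⟩
  mono (suc n ℕ.* c) ⊛ ∏ (suc n) F                  ∎

-- Recentres a sum over pairs with total 2n at the middle pair: the first index n + j becomes the
-- summation index j.
conv-symmetric : ∀ n F Φ → (∀ r s → r ℕ.+ s ≡ n → F (s ℕ.+ (r ℕ.+ r)) s ≈ Φ (+ r)) →
  (∀ r s → suc r ℕ.+ s ≡ n → F s (s ℕ.+ (suc r ℕ.+ suc r)) ≈ Φ -[1+ r ]) → conv (n ℕ.+ n) F ≈ zsum n Φ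
conv-symmetric zero    F Φ p q = p 0 0 refl
conv-symmetric (suc n) F Φ p q rewrite ℕ.+-suc n n = begin
  F 0 (suc (suc (n ℕ.+ n))) ⊕ conv (suc (n ℕ.+ n)) (λ i j → F (suc i) j)
    ≈⟨ ⊕-cong (≈-trans (≡⇒≈ (cong (λ z → F 0 (suc z)) (sym (ℕ.+-suc n n)))) (q n 0 (cong suc (ℕ.+-identityʳ n))))
         (≈-trans (conv-last (n ℕ.+ n) (λ i j → F (suc i) j))
           (⊕-cong (conv-symmetric n (λ i j → F (suc i) (suc j)) Φ
                     (λ r s e → p r (suc s) (trans (ℕ.+-suc r s) (cong suc e)))
                     (λ r s e → q r (suc s) (trans (ℕ.+-suc (suc r) s) (cong suc e))))
                   (≈-trans (≡⇒≈ (cong (λ z → F (suc z) 0) (sym (ℕ.+-suc n n)))) (p (suc n) 0 (cong suc (ℕ.+-identityʳ n)))))) ⟩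
  Φ -[1+ n ] ⊕ (zsum n Φ ⊕ Φ (+ suc n))
    ≈⟨ solve 3 (λ a b c → a :+ (b :+ c) := b :+ (c :+ a)) ≈-refl (Φ -[1+ n ]) (zsum n Φ) (Φ (+ suc n)) ⟩
  zsum n Φ ⊕ (Φ (+ suc n) ⊕ Φ -[1+ n ]) ∎

module Jacobi (k : ℕ) .{{_ : NonZero k}} where

  S : PS → PS
  S = substPow k

  ι : ℕ → PS
  ι n = S (iq n)

  ι-step : ∀ n → 1-q^ (k ℕ.* suc n) ⊛ ι (suc n) ≈ ι n
  ι-step n = ≈-trans (⊛-congʳ (ι (suc n)) (≈-sym (substPow-1-q^ k (suc n))))
    (≈-trans (≈-sym (substPow-⊛ k (1-q^ (suc n)) (iq (suc n)))) (substPow-cong k (iq-step n)))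

  ι-0 : ι 0 ≈ 𝟙
  ι-0 = ≈-trans (substPow-cong k iq-0) (substPow-𝟙 k)

  S-qPoch-suc : ∀ n → S (qPoch (suc n)) ≈ S (qPoch n) ⊛ 1-q^ (k ℕ.* suc n)
  S-qPoch-suc n = ≈-trans (substPow-cong k (qPoch-suc n))
    (≈-trans (substPow-⊛ k (qPoch n) (1-q^ (suc n))) (⊛-congˡ (S (qPoch n)) (substPow-1-q^ k (suc n))))

  binomialTerm : ℕ → ℕ → ℕ → ℕ → PS
  binomialTerm y d b a = alt b ⊛ mono (k ℕ.* tp b ℕ.+ y ℕ.* a ℕ.+ d ℕ.* b) ⊛ (ι a ⊛ ι b)

  -- The q-binomial theorem with base q^k, kept homogeneous in q^y and q^d: the centred product of
  -- the triple product identity would otherwise need negative powers of q. The induction uses the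
  -- same splitting as `qVandermonde`.
  qBinomial : ∀ y d M → S (qPoch M) ⊛ conv M (binomialTerm y d) ≈ ∏ M (λ i → mono y ⊖ mono (d ℕ.+ k ℕ.* i))
  qBinomial y d zero = begin
    S one ⊛ (𝟙 ⊛ mono (k ℕ.* 0 ℕ.+ y ℕ.* 0 ℕ.+ d ℕ.* 0) ⊛ (ι 0 ⊛ ι 0))
      ≈⟨ ⊛-cong (≈-trans (substPow-one k) one≈𝟙) (⊛-cong (⊛-congˡ 𝟙 (≈-trans (mono-≡ exponent) one≈𝟙)) (⊛-cong ι-0 ι-0)) ⟩
    𝟙 ⊛ (𝟙 ⊛ 𝟙 ⊛ (𝟙 ⊛ 𝟙))
      ≈⟨ solve 0 (con (+ 1) :* (con (+ 1) :* con (+ 1) :* (con (+ 1) :* con (+ 1))) := con (+ 1)) ≈-refl ⟩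
    𝟙 ≈⟨ one≈𝟙 ⟨
    one ∎
    where
    exponent : k ℕ.* 0 ℕ.+ y ℕ.* 0 ℕ.+ d ℕ.* 0 ≡ 0
    exponent = cong₂ ℕ._+_ (cong₂ ℕ._+_ (ℕ.*-zeroʳ k) (ℕ.*-zeroʳ y)) (ℕ.*-zeroʳ d)
  qBinomial y d (suc M) = begin
    S (qPoch (suc M)) ⊛ conv (suc M) R
      ≈⟨ ⊛-congʳ (conv (suc M) R) (S-qPoch-suc M) ⟩
    S (qPoch M) ⊛ 1-q^ (k ℕ.* suc M) ⊛ conv (suc M) R
      ≈⟨ ⊛-≈-assoc (S (qPoch M)) (1-q^ (k ℕ.* suc M)) (conv (suc M) R) ⟩
    S (qPoch M) ⊛ (1-q^ (k ℕ.* suc M) ⊛ conv (suc M) R)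
      ≈⟨ ⊛-congˡ (S (qPoch M)) (conv-difference (k ℕ.*_) (ℕ.*-zeroʳ k) (ℕ.*-distribˡ-+ k) M R) ⟩
    S (qPoch M) ⊛ (conv M (λ b a → 1-q^ (k ℕ.* suc a) ⊛ R b (suc a))
      ⊕ conv M (λ b a → mono (k ℕ.* a) ⊛ (1-q^ (k ℕ.* suc b) ⊛ R (suc b) a)))
      ≈⟨ ⊛-congˡ (S (qPoch M)) (⊕-cong (≈-trans (conv-cong M (λ b a _ → left b a)) (≈-sym (conv-⊛ M (mono y) R)))
                                       (≈-trans (conv-cong M right) (≈-sym (conv-⊛ M (⊝ mono (d ℕ.+ k ℕ.* M)) R)))) ⟩
    S (qPoch M) ⊛ (mono y ⊛ conv M R ⊕ (⊝ mono (d ℕ.+ k ℕ.* M)) ⊛ conv M R)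
      ≈⟨ solve 4 (λ s c y x → s :* (y :* c :+ (:- x) :* c) := s :* c :* (y :- x)) ≈-refl
           (S (qPoch M)) (conv M R) (mono y) (mono (d ℕ.+ k ℕ.* M)) ⟩
    S (qPoch M) ⊛ conv M R ⊛ (mono y ⊖ mono (d ℕ.+ k ℕ.* M))
      ≈⟨ ⊛-congʳ (mono y ⊖ mono (d ℕ.+ k ℕ.* M)) (qBinomial y d M) ⟩
    ∏ M (λ i → mono y ⊖ mono (d ℕ.+ k ℕ.* i)) ⊛ (mono y ⊖ mono (d ℕ.+ k ℕ.* M))
      ≈⟨ ∏-last M (λ i → mono y ⊖ mono (d ℕ.+ k ℕ.* i)) ⟨
    ∏ (suc M) (λ i → mono y ⊖ mono (d ℕ.+ k ℕ.* i)) ∎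
    where
    R : ℕ → ℕ → PS
    R = binomialTerm y d
    e : ℕ → ℕ → ℕ
    e b a = k ℕ.* tp b ℕ.+ y ℕ.* a ℕ.+ d ℕ.* b
    left : ∀ b a → 1-q^ (k ℕ.* suc a) ⊛ R b (suc a) ≈ mono y ⊛ R b a
    left b a = ≈-trans
      (⊛-congˡ (1-q^ (k ℕ.* suc a)) (⊛-congʳ (ι (suc a) ⊛ ι b) (⊛-congˡ (alt b) (mono-split y (e b a) (exponent k (tp b) y a d b)))))
      (≈-trans (solve 6 (λ x s y m i j → x :* (s :* (y :* m) :* (i :* j)) := y :* (s :* m :* ((x :* i) :* j))) ≈-refl
          (1-q^ (k ℕ.* suc a)) (alt b) (mono y) (mono (e b a)) (ι (suc a)) (ι b))
        (⊛-congˡ (mono y) (⊛-congˡ (alt b ⊛ mono (e b a)) (⊛-congʳ (ι b) (ι-step a)))))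
      where
      exponent : ∀ k t y a d b → k ℕ.* t ℕ.+ y ℕ.* suc a ℕ.+ d ℕ.* b ≡ y ℕ.+ (k ℕ.* t ℕ.+ y ℕ.* a ℕ.+ d ℕ.* b)
      exponent = ℕ-solve-∀
    right : ∀ b a → b ℕ.+ a ≡ M → mono (k ℕ.* a) ⊛ (1-q^ (k ℕ.* suc b) ⊛ R (suc b) a) ≈ (⊝ mono (d ℕ.+ k ℕ.* M)) ⊛ R b a
    right b a refl = begin
      mono (k ℕ.* a) ⊛ (1-q^ (k ℕ.* suc b) ⊛ ((⊝ alt b) ⊛ mono (e (suc b) a) ⊛ (ι a ⊛ ι (suc b))))
        ≈⟨ solve 6 (λ m x s m′ i j → m :* (x :* ((:- s) :* m′ :* (i :* j))) := (m :* m′) :* ((:- s) :* (i :* (x :* j)))) ≈-refl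
             (mono (k ℕ.* a)) (1-q^ (k ℕ.* suc b)) (alt b) (mono (e (suc b) a)) (ι a) (ι (suc b)) ⟩
      mono (k ℕ.* a) ⊛ mono (e (suc b) a) ⊛ ((⊝ alt b) ⊛ (ι a ⊛ (1-q^ (k ℕ.* suc b) ⊛ ι (suc b))))
        ≈⟨ ⊛-cong (≈-trans (mono-+ (k ℕ.* a) (e (suc b) a)) (mono-split (d ℕ.+ k ℕ.* (b ℕ.+ a)) (e b a) (exponent k (tp b) y a d b)))
                  (⊛-congˡ (⊝ alt b) (⊛-congˡ (ι a) (ι-step b))) ⟩
      mono (d ℕ.+ k ℕ.* (b ℕ.+ a)) ⊛ mono (e b a) ⊛ ((⊝ alt b) ⊛ (ι a ⊛ ι b))
        ≈⟨ solve 4 (λ m m′ s i → m :* m′ :* ((:- s) :* i) := (:- m) :* (s :* m′ :* i)) ≈-refl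
             (mono (d ℕ.+ k ℕ.* (b ℕ.+ a))) (mono (e b a)) (alt b) (ι a ⊛ ι b) ⟩
      (⊝ mono (d ℕ.+ k ℕ.* (b ℕ.+ a))) ⊛ R b a ∎
      where
      exponent : ∀ k t y a d b → k ℕ.* a ℕ.+ (k ℕ.* (b ℕ.+ t) ℕ.+ y ℕ.* a ℕ.+ d ℕ.* suc b)
                               ≡ d ℕ.+ k ℕ.* (b ℕ.+ a) ℕ.+ (k ℕ.* t ℕ.+ y ℕ.* a ℕ.+ d ℕ.* b)
      exponent = ℕ-solve-∀

  progression : ℕ → ℕ → PS
  progression d N = ∏ N (λ i → 1-q^ (d ℕ.+ k ℕ.* i))

  S-E-ι : ∀ a → S E ⊛ ι a ~[ a ] 𝟙
  S-E-ι a i i≤a = trans (sym (substPow-⊛ k E (iq a) .at i)) (trans (substPow-~ k (E-iq a) i i≤a) (substPow-𝟙 k .at i))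

  module _ (d d′ : ℕ) (d+d′ : d ℕ.+ d′ ≡ k) where

    -- For i < N the exponent d + k i is the smaller one. Taking out - q^(d + k i) leaves 1 - q^(d′
    -- + k (N - 1 - i)), so the factors of the progression with d′ appear in reverse order.
    lowerHalf : ∀ N → ∏ N (λ i → mono (k ℕ.* N) ⊖ mono (d ℕ.+ k ℕ.* i))
                      ≈ alt N ⊛ mono (k ℕ.* tp N ℕ.+ d ℕ.* N) ⊛ progression d′ N
    lowerHalf zero = ≈-sym (≈-trans (⊛-congʳ one (≈-trans (⊛-identityˡ (mono (k ℕ.* 0 ℕ.+ d ℕ.* 0))) (mono-≡ (cong₂ ℕ._+_ (ℕ.*-zeroʳ k) (ℕ.*-zeroʳ d)))))
                                    (one-⊛ one))
    lowerHalf (suc N) = begin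
      ∏ (suc N) (λ i → mono (k ℕ.* suc N) ⊖ mono (d ℕ.+ k ℕ.* i))
        ≈⟨ ≡⇒≈ (∏-suc N (λ i → mono (k ℕ.* suc N) ⊖ mono (d ℕ.+ k ℕ.* i))) ⟩
      (mono (k ℕ.* suc N) ⊖ mono (d ℕ.+ k ℕ.* 0)) ⊛ ∏ N (λ i → mono (k ℕ.* suc N) ⊖ mono (d ℕ.+ k ℕ.* suc i))
        ≈⟨ ⊛-cong first (≈-trans (∏-cong N rest) (≈-trans (∏-mono-⊛ N k (λ i → mono (k ℕ.* N) ⊖ mono (d ℕ.+ k ℕ.* i)))
                                                          (⊛-congˡ (mono (N ℕ.* k)) (lowerHalf N)))) ⟩
      (⊝ mono d) ⊛ 1-q^ (d′ ℕ.+ k ℕ.* N) ⊛ (mono (N ℕ.* k) ⊛ (alt N ⊛ mono (k ℕ.* tp N ℕ.+ d ℕ.* N) ⊛ progression d′ N))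
        ≈⟨ solve 6 (λ m x n s c p → (:- m) :* x :* (n :* (s :* c :* p)) := (:- s) :* (m :* (n :* c)) :* (p :* x)) ≈-refl
             (mono d) (1-q^ (d′ ℕ.+ k ℕ.* N)) (mono (N ℕ.* k)) (alt N) (mono (k ℕ.* tp N ℕ.+ d ℕ.* N)) (progression d′ N) ⟩
      (⊝ alt N) ⊛ (mono d ⊛ (mono (N ℕ.* k) ⊛ mono (k ℕ.* tp N ℕ.+ d ℕ.* N))) ⊛ (progression d′ N ⊛ 1-q^ (d′ ℕ.+ k ℕ.* N))
        ≈⟨ ⊛-cong (⊛-congˡ (⊝ alt N) (≈-trans (⊛-congˡ (mono d) (mono-+ (N ℕ.* k) (k ℕ.* tp N ℕ.+ d ℕ.* N)))
                     (≈-trans (mono-+ d (N ℕ.* k ℕ.+ (k ℕ.* tp N ℕ.+ d ℕ.* N))) (mono-≡ (exponent d N k (tp N))))))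
                  (≈-sym (∏-last N (λ i → 1-q^ (d′ ℕ.+ k ℕ.* i)))) ⟩
      alt (suc N) ⊛ mono (k ℕ.* tp (suc N) ℕ.+ d ℕ.* suc N) ⊛ progression d′ (suc N) ∎
      where
      exponent : ∀ d N k t → d ℕ.+ (N ℕ.* k ℕ.+ (k ℕ.* t ℕ.+ d ℕ.* N)) ≡ k ℕ.* (N ℕ.+ t) ℕ.+ d ℕ.* suc N
      exponent = ℕ-solve-∀
      e₁ : k ℕ.* suc N ≡ d ℕ.+ (d′ ℕ.+ k ℕ.* N)
      e₁ = trans (ℕ.*-suc k N) (trans (cong (ℕ._+ k ℕ.* N) (sym d+d′)) (ℕ.+-assoc d d′ (k ℕ.* N)))
      first : mono (k ℕ.* suc N) ⊖ mono (d ℕ.+ k ℕ.* 0) ≈ (⊝ mono d) ⊛ 1-q^ (d′ ℕ.+ k ℕ.* N)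
      first = ≈-trans (⊖-cong (mono-split d (d′ ℕ.+ k ℕ.* N) e₁) (mono-≡ (trans (cong (d ℕ.+_) (ℕ.*-zeroʳ k)) (ℕ.+-identityʳ d))))
        (solve 2 (λ m x → m :* x :- m := (:- m) :* (con (+ 1) :- x)) ≈-refl (mono d) (mono (d′ ℕ.+ k ℕ.* N)))
      e₂ : ∀ d k i → d ℕ.+ k ℕ.* suc i ≡ k ℕ.+ (d ℕ.+ k ℕ.* i)
      e₂ = ℕ-solve-∀
      rest : ∀ i → mono (k ℕ.* suc N) ⊖ mono (d ℕ.+ k ℕ.* suc i) ≈ mono k ⊛ (mono (k ℕ.* N) ⊖ mono (d ℕ.+ k ℕ.* i))
      rest i = ≈-trans (⊖-cong (mono-split k (k ℕ.* N) (ℕ.*-suc k N)) (mono-split k (d ℕ.+ k ℕ.* i) (e₂ d k i)))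
        (solve 3 (λ m x y → m :* x :- m :* y := m :* (x :- y)) ≈-refl (mono k) (mono (k ℕ.* N)) (mono (d ℕ.+ k ℕ.* i)))

    upperHalf : ∀ N → ∏ N (λ i → mono (k ℕ.* N) ⊖ mono (d ℕ.+ k ℕ.* (N ℕ.+ i))) ≈ mono (N ℕ.* (k ℕ.* N)) ⊛ progression d N
    upperHalf N = ≈-trans (∏-cong N factor) (∏-mono-⊛ N (k ℕ.* N) (λ i → 1-q^ (d ℕ.+ k ℕ.* i)))
      where
      exponent : ∀ d k i N → d ℕ.+ k ℕ.* (N ℕ.+ i) ≡ k ℕ.* N ℕ.+ (d ℕ.+ k ℕ.* i)
      exponent = ℕ-solve-∀
      factor : ∀ i → mono (k ℕ.* N) ⊖ mono (d ℕ.+ k ℕ.* (N ℕ.+ i)) ≈ mono (k ℕ.* N) ⊛ 1-q^ (d ℕ.+ k ℕ.* i)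
      factor i = ≈-trans (⊖-cong (≈-refl {mono (k ℕ.* N)}) (mono-split (k ℕ.* N) (d ℕ.+ k ℕ.* i) (exponent d k i N)))
        (solve 2 (λ m x → m :- m :* x := m :* (con (+ 1) :- x)) ≈-refl (mono (k ℕ.* N)) (mono (d ℕ.+ k ℕ.* i)))

    J : ℕ → ℤ → PS
    J N j = ι (N ∸ ∣ j ∣) ⊛ ι (N ℕ.+ ∣ j ∣)

    -- `qBinomial` for 2N factors with y = k N, the midpoint of the exponents. The lower and upper
    -- halves of the product become the two progressions, and the common factor (-1)^N q^C cancels.
    finiteJacobi : ∀ N → S (qPoch (N ℕ.+ N)) ⊛ zsum N (λ j → τterm k d d′ j ⊛ J N j) ≈ progression d N ⊛ progression d′ N
    finiteJacobi N = mono-cancel C (unit-cancel (alt N) (alt N) (alt-square N) (begin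
      alt N ⊛ (mono C ⊛ (S (qPoch (N ℕ.+ N)) ⊛ Z))
        ≈⟨ solve 4 (λ s c q z → s :* (c :* (q :* z)) := q :* ((s :* c) :* z)) ≈-refl (alt N) (mono C) (S (qPoch (N ℕ.+ N))) Z ⟩
      S (qPoch (N ℕ.+ N)) ⊛ (alt N ⊛ mono C ⊛ Z)
        ≈⟨ ⊛-congˡ (S (qPoch (N ℕ.+ N))) (≈-trans (zsum-⊛ N (alt N ⊛ mono C) (λ j → τterm k d d′ j ⊛ J N j))
             (≈-sym (conv-symmetric N (binomialTerm (k ℕ.* N) d) Φ plus minus))) ⟩
      S (qPoch (N ℕ.+ N)) ⊛ conv (N ℕ.+ N) (binomialTerm (k ℕ.* N) d)
        ≈⟨ qBinomial (k ℕ.* N) d (N ℕ.+ N) ⟩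
      ∏ (N ℕ.+ N) (λ i → mono (k ℕ.* N) ⊖ mono (d ℕ.+ k ℕ.* i))
        ≈⟨ ∏-+ N N (λ i → mono (k ℕ.* N) ⊖ mono (d ℕ.+ k ℕ.* i)) ⟩
      ∏ N (λ i → mono (k ℕ.* N) ⊖ mono (d ℕ.+ k ℕ.* i)) ⊛ ∏ N (λ i → mono (k ℕ.* N) ⊖ mono (d ℕ.+ k ℕ.* (N ℕ.+ i)))
        ≈⟨ ⊛-cong (lowerHalf N) (upperHalf N) ⟩
      alt N ⊛ mono C₁ ⊛ progression d′ N ⊛ (mono C₂ ⊛ progression d N)
        ≈⟨ solve 5 (λ s c p c′ p′ → s :* c :* p :* (c′ :* p′) := s :* ((c :* c′) :* (p′ :* p))) ≈-refl
             (alt N) (mono C₁) (progression d′ N) (mono C₂) (progression d N) ⟩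
      alt N ⊛ (mono C₁ ⊛ mono C₂ ⊛ (progression d N ⊛ progression d′ N))
        ≈⟨ ⊛-congˡ (alt N) (⊛-congʳ (progression d N ⊛ progression d′ N) (mono-+ C₁ C₂)) ⟩
      alt N ⊛ (mono C ⊛ (progression d N ⊛ progression d′ N)) ∎))
      where
      C₁ C₂ C : ℕ
      C₁ = k ℕ.* tp N ℕ.+ d ℕ.* N
      C₂ = N ℕ.* (k ℕ.* N)
      C  = C₁ ℕ.+ C₂
      Z : PS
      Z = zsum N (λ j → τterm k d d′ j ⊛ J N j)
      Φ : ℤ → PS
      Φ j = alt N ⊛ mono C ⊛ (τterm k d d′ j ⊛ J N j)
      match : ∀ {s m i} s′ m′ i′ → s ≈ alt N ⊛ s′ → m ≈ mono C ⊛ m′ → i ≈ i′ → s ⊛ m ⊛ i ≈ alt N ⊛ mono C ⊛ (s′ ⊛ m′ ⊛ i′)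
      match s′ m′ i′ p q t = ≈-trans (⊛-cong (⊛-cong p q) t)
        (solve 5 (λ a b c d e → (a :* b) :* (c :* d) :* e := a :* c :* (b :* d :* e)) ≈-refl (alt N) s′ (mono C) m′ i′)
      plus : ∀ r s → r ℕ.+ s ≡ N → binomialTerm (k ℕ.* N) d (s ℕ.+ (r ℕ.+ r)) s ≈ Φ (+ r)
      plus r s refl = match (alt r) (mono (ex k d d′ (+ r))) (J N (+ r)) sign (mono-split C (ex k d d′ (+ r)) exponent)
        (⊛-cong (≡⇒≈ (cong ι (sym (ℕ.m+n∸m≡n r s)))) (≡⇒≈ (cong ι (index r s))))
        where
        index : ∀ r s → s ℕ.+ (r ℕ.+ r) ≡ r ℕ.+ s ℕ.+ r
        index = ℕ-solve-∀
        sign : alt (s ℕ.+ (r ℕ.+ r)) ≈ alt (r ℕ.+ s) ⊛ alt r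
        sign = ≈-trans (≡⇒≈ (cong alt (index r s))) (alt-+ (r ℕ.+ s) r)
        poly : ∀ k d r s t u → k ℕ.* (t ℕ.+ u ℕ.+ (r ℕ.+ s) ℕ.* r) ℕ.+ k ℕ.* (r ℕ.+ s) ℕ.* s ℕ.+ d ℕ.* (s ℕ.+ (r ℕ.+ r))
          ≡ k ℕ.* t ℕ.+ d ℕ.* (r ℕ.+ s) ℕ.+ (r ℕ.+ s) ℕ.* (k ℕ.* (r ℕ.+ s)) ℕ.+ (k ℕ.* u ℕ.+ d ℕ.* r)
        poly = ℕ-solve-∀
        exponent : k ℕ.* tp (s ℕ.+ (r ℕ.+ r)) ℕ.+ k ℕ.* (r ℕ.+ s) ℕ.* s ℕ.+ d ℕ.* (s ℕ.+ (r ℕ.+ r)) ≡ C ℕ.+ ex k d d′ (+ r)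
        exponent = trans (cong (λ z → k ℕ.* z ℕ.+ k ℕ.* (r ℕ.+ s) ℕ.* s ℕ.+ d ℕ.* (s ℕ.+ (r ℕ.+ r)))
                            (trans (cong tp (index r s)) (tp-+ (r ℕ.+ s) r)))
                         (poly k d r s (tp (r ℕ.+ s)) (tp r))
      minus : ∀ r s → suc r ℕ.+ s ≡ N → binomialTerm (k ℕ.* N) d s (s ℕ.+ (suc r ℕ.+ suc r)) ≈ Φ -[1+ r ]
      minus r′ s refl = match (alt r) (mono (ex k d d′ -[1+ r′ ])) (J N -[1+ r′ ]) sign (mono-split C (ex k d d′ -[1+ r′ ]) exponent)
        (≈-trans (⊛-≈-comm (ι (s ℕ.+ (r ℕ.+ r))) (ι s)) (⊛-cong (≡⇒≈ (cong ι (sym (ℕ.m+n∸m≡n r s)))) (≡⇒≈ (cong ι (index r s)))))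
        where
        r : ℕ
        r = suc r′
        index : ∀ r s → s ℕ.+ (r ℕ.+ r) ≡ r ℕ.+ s ℕ.+ r
        index = ℕ-solve-∀
        sign : alt s ≈ alt (r ℕ.+ s) ⊛ alt r
        sign = ≈-sym (≈-trans (⊛-congʳ (alt r) (alt-+ r s))
          (≈-trans (solve 2 (λ x y → x :* y :* x := (x :* x) :* y) ≈-refl (alt r) (alt s))
            (≈-trans (⊛-congʳ (alt s) (alt-square r)) (⊛-identityˡ (alt s)))))
        p₁ : ∀ k d r s t → k ℕ.* t ℕ.+ k ℕ.* (r ℕ.+ s) ℕ.* (s ℕ.+ (r ℕ.+ r)) ℕ.+ d ℕ.* s
             ≡ k ℕ.* (r ℕ.* r) ℕ.+ (k ℕ.* t ℕ.+ k ℕ.* (r ℕ.* s) ℕ.+ d ℕ.* s ℕ.+ (r ℕ.+ s) ℕ.* (k ℕ.* (r ℕ.+ s)))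
        p₁ = ℕ-solve-∀
        p₂ : ∀ k r u x → k ℕ.* (u ℕ.+ u ℕ.+ r) ℕ.+ x ≡ k ℕ.* r ℕ.+ (k ℕ.* u ℕ.+ k ℕ.* u ℕ.+ x)
        p₂ = ℕ-solve-∀
        p₃ : ∀ k d d′ r s t u →
             (d ℕ.+ d′) ℕ.* r ℕ.+ (k ℕ.* u ℕ.+ k ℕ.* u ℕ.+ (k ℕ.* t ℕ.+ k ℕ.* (r ℕ.* s) ℕ.+ d ℕ.* s ℕ.+ (r ℕ.+ s) ℕ.* (k ℕ.* (r ℕ.+ s))))
             ≡ k ℕ.* (u ℕ.+ t ℕ.+ r ℕ.* s) ℕ.+ d ℕ.* (r ℕ.+ s) ℕ.+ (r ℕ.+ s) ℕ.* (k ℕ.* (r ℕ.+ s)) ℕ.+ (k ℕ.* u ℕ.+ d′ ℕ.* r)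
        p₃ = ℕ-solve-∀
        rest : ℕ
        rest = k ℕ.* tp s ℕ.+ k ℕ.* (r ℕ.* s) ℕ.+ d ℕ.* s ℕ.+ (r ℕ.+ s) ℕ.* (k ℕ.* (r ℕ.+ s))
        exponent : k ℕ.* tp s ℕ.+ k ℕ.* (r ℕ.+ s) ℕ.* (s ℕ.+ (r ℕ.+ r)) ℕ.+ d ℕ.* s ≡ C ℕ.+ ex k d d′ -[1+ r′ ]
        exponent = trans (p₁ k d r s (tp s)) (trans (cong (λ z → k ℕ.* z ℕ.+ rest) (tp-square r)) (trans (p₂ k r (tp r) rest)
          (trans (cong (λ z → z ℕ.* r ℕ.+ (k ℕ.* tp r ℕ.+ k ℕ.* tp r ℕ.+ rest)) (sym d+d′)) (trans (p₃ k d d′ r s (tp s) (tp r))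
          (cong (λ z → k ℕ.* z ℕ.+ d ℕ.* (r ℕ.+ s) ℕ.+ (r ℕ.+ s) ℕ.* (k ℕ.* (r ℕ.+ s)) ℕ.+ (k ℕ.* tp r ℕ.+ d′ ℕ.* r)) (sym (tp-+ r s)))))))

  -- N → ∞ in `finiteJacobi`: (q^k; q^k)_(2N) tends to E(q^k) and the two reciprocals in `J` to
  -- 1/E(q^k)², so one factor E(q^k) moves to the product side.
  jacobi : ∀ d d′ → suc d ℕ.+ suc d′ ≡ k → ∀ N →
    τ k (suc d) (suc d′) ~[ N ] S E ⊛ (progression (suc d) N ⊛ progression (suc d′) N)
  jacobi d d′ d+d′ N i i≤N = trans (sym (zsum~limZ N (τterm k (suc d) (suc d′)) (Ord-τterm k d d′) i i≤N))
    (trans (sym (zsum-~ N N {λ j → S E ⊛ S E ⊛ (t j ⊛ K j)} {t} term~ i i≤N))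
    (trans (sym (zsum-⊛ N (S E ⊛ S E) (λ j → t j ⊛ K j) .at i))
    (trans (⊛-≈-assoc (S E) (S E) Z .at i)
    (trans (~-⊛ {S E} {S E} {S E ⊛ Z} {S (qPoch (N ℕ.+ N)) ⊛ Z} (λ _ _ → refl)
              (~-⊛ {S E} {S (qPoch (N ℕ.+ N))} {Z} {Z} (λ i i≤N → sym (qPoch~ i i≤N)) (λ _ _ → refl)) i i≤N)
           (⊛-congˡ (S E) (finiteJacobi (suc d) (suc d′) d+d′ N) .at i)))))
    where
    t K : ℤ → PS
    t = τterm k (suc d) (suc d′)
    K = J (suc d) (suc d′) d+d′ N
    Z : PS
    Z = zsum N (λ j → t j ⊛ K j)
    qPoch~ : S (qPoch (N ℕ.+ N)) ~[ N ] S E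
    qPoch~ = substPow-~ k (~-mono {qPoch (N ℕ.+ N)} {E} (ℕ.m≤m+n N N) (qPoch~E (N ℕ.+ N)))
    term~ : ∀ j → ∣ j ∣ ≤ N → S E ⊛ S E ⊛ (t j ⊛ K j) ~[ N ] t j
    term~ j j≤N i i≤N = trans
      (solve 4 (λ e t a b → e :* e :* (t :* (a :* b)) := t :* ((e :* a) :* (e :* b))) ≈-refl (S E) (t j) (ι (N ∸ ∣ j ∣)) (ι (N ℕ.+ ∣ j ∣)) .at i)
      -- The weaker of the two reciprocals is correct only up to N - |j|; the order |j| of `t j`
      -- restores the precision N.
      (trans (Ord-~ ∣ j ∣ (t j) (S E ⊛ ι (N ∸ ∣ j ∣) ⊛ (S E ⊛ ι (N ℕ.+ ∣ j ∣))) (𝟙 ⊛ 𝟙) (N ∸ ∣ j ∣) (Ord-τterm k d d′ j)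
               (~-⊛ {S E ⊛ ι (N ∸ ∣ j ∣)} {𝟙} {S E ⊛ ι (N ℕ.+ ∣ j ∣)} {𝟙} (S-E-ι (N ∸ ∣ j ∣))
                  (~-mono {S E ⊛ ι (N ℕ.+ ∣ j ∣)} {𝟙} (ℕ.≤-trans (ℕ.m∸n≤m N ∣ j ∣) (ℕ.m≤m+n N ∣ j ∣)) (S-E-ι (N ℕ.+ ∣ j ∣))))
               i (ℕ.≤-trans i≤N (ℕ.≤-reflexive (sym (ℕ.m+[n∸m]≡n j≤N)))))
             (solve 1 (λ t → t :* (con (+ 1) :* con (+ 1)) := t) ≈-refl (t j) .at i))

-- Products over residue classes: G H and κ

qPoch-mod-5 : ∀ N → let open Jacobi 5 in
  progression 2 N ⊛ progression 3 N ⊛ (progression 4 N ⊛ progression 1 N) ⊛ substPow 5 (qPoch N) ≈ qPoch (N ℕ.* 5)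
qPoch-mod-5 zero = ≈-trans (⊛-cong (⊛-cong (one-⊛ one) (one-⊛ one)) (substPow-one 5)) (≈-trans (⊛-congʳ one (one-⊛ one)) (one-⊛ one))
qPoch-mod-5 (suc N) = begin
  progression 2 (suc N) ⊛ progression 3 (suc N) ⊛ (progression 4 (suc N) ⊛ progression 1 (suc N)) ⊛ substPow 5 (qPoch (suc N))
    ≈⟨ ⊛-cong (⊛-cong (⊛-cong (last 2) (last 3)) (⊛-cong (last 4) (last 1))) lastS ⟩
  (progression 2 N ⊛ x₂) ⊛ (progression 3 N ⊛ x₃) ⊛ ((progression 4 N ⊛ x₄) ⊛ (progression 1 N ⊛ x₁)) ⊛ (substPow 5 (qPoch N) ⊛ x₅)
    ≈⟨ solve 10 (λ p₂ p₃ p₄ p₁ p₅ x₁ x₂ x₃ x₄ x₅ →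
         (p₂ :* x₂) :* (p₃ :* x₃) :* ((p₄ :* x₄) :* (p₁ :* x₁)) :* (p₅ :* x₅) := p₂ :* p₃ :* (p₄ :* p₁) :* p₅ :* x₁ :* x₂ :* x₃ :* x₄ :* x₅) ≈-refl
         (progression 2 N) (progression 3 N) (progression 4 N) (progression 1 N) (substPow 5 (qPoch N)) x₁ x₂ x₃ x₄ x₅ ⟩
  progression 2 N ⊛ progression 3 N ⊛ (progression 4 N ⊛ progression 1 N) ⊛ substPow 5 (qPoch N) ⊛ x₁ ⊛ x₂ ⊛ x₃ ⊛ x₄ ⊛ x₅
    ≈⟨ ⊛-congʳ x₅ (⊛-congʳ x₄ (⊛-congʳ x₃ (⊛-congʳ x₂ (⊛-congʳ x₁ (qPoch-mod-5 N))))) ⟩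
  qPoch M ⊛ x₁ ⊛ x₂ ⊛ x₃ ⊛ x₄ ⊛ x₅
    ≈⟨ ⊛-congʳ x₅ (⊛-congʳ x₄ (⊛-congʳ x₃ (⊛-congʳ x₂ (≈-sym (qPoch-suc M))))) ⟩
  qPoch (1 ℕ.+ M) ⊛ x₂ ⊛ x₃ ⊛ x₄ ⊛ x₅
    ≈⟨ ⊛-congʳ x₅ (⊛-congʳ x₄ (⊛-congʳ x₃ (≈-sym (qPoch-suc (1 ℕ.+ M))))) ⟩
  qPoch (2 ℕ.+ M) ⊛ x₃ ⊛ x₄ ⊛ x₅
    ≈⟨ ⊛-congʳ x₅ (⊛-congʳ x₄ (≈-sym (qPoch-suc (2 ℕ.+ M)))) ⟩
  qPoch (3 ℕ.+ M) ⊛ x₄ ⊛ x₅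
    ≈⟨ ⊛-congʳ x₅ (≈-sym (qPoch-suc (3 ℕ.+ M))) ⟩
  qPoch (4 ℕ.+ M) ⊛ x₅
    ≈⟨ qPoch-suc (4 ℕ.+ M) ⟨
  qPoch (5 ℕ.+ M) ∎
  where
  open Jacobi 5
  M : ℕ
  M = N ℕ.* 5
  x₁ x₂ x₃ x₄ x₅ : PS
  x₁ = 1-q^ (1 ℕ.+ M)
  x₂ = 1-q^ (2 ℕ.+ M)
  x₃ = 1-q^ (3 ℕ.+ M)
  x₄ = 1-q^ (4 ℕ.+ M)
  x₅ = 1-q^ (5 ℕ.+ M)
  last : ∀ d → progression d (suc N) ≈ progression d N ⊛ 1-q^ (d ℕ.+ M)
  last d = ≈-trans (∏-last N (λ i → 1-q^ (d ℕ.+ 5 ℕ.* i)))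
    (⊛-congˡ (progression d N) (⊖-cong (≈-refl {𝟙}) (mono-≡ (cong (d ℕ.+_) (ℕ.*-comm 5 N)))))
  lastS : substPow 5 (qPoch (suc N)) ≈ substPow 5 (qPoch N) ⊛ x₅
  lastS = ≈-trans (S-qPoch-suc N) (⊛-congˡ (substPow 5 (qPoch N)) (⊖-cong (≈-refl {𝟙}) (mono-≡ (ℕ.*-comm 5 (suc N)))))

-- G(q) H(q) = E(q^5) / E(q)
τ⊛τ : τ 5 2 3 ⊛ τ 5 4 1 ≈ E ⊛ substPow 5 E
τ⊛τ = ~⇒≈ λ N i i≤N → trans
  (~-⊛ {τ 5 2 3} {S E ⊛ P N} {τ 5 4 1} {S E ⊛ R N} (jacobi 1 2 refl N) (jacobi 3 0 refl N) i i≤N)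
  (trans (solve 3 (λ e p r → (e :* p) :* (e :* r) := (p :* r :* e) :* e) ≈-refl (S E) (P N) (R N) .at i)
  (~-⊛ {P N ⊛ R N ⊛ S E} {E} {S E} {S E} (E~ N) (λ _ _ → refl) i i≤N))
  where
  open Jacobi 5
  P R : ℕ → PS
  P N = progression 2 N ⊛ progression 3 N
  R N = progression 4 N ⊛ progression 1 N
  E~ : ∀ N → P N ⊛ R N ⊛ S E ~[ N ] E
  E~ N i i≤N = trans (~-⊛ {P N ⊛ R N} {P N ⊛ R N} {S E} {S (qPoch N)} (λ _ _ → refl)
                        (λ i i≤N → sym (substPow-~ 5 (qPoch~E N) i i≤N)) i i≤N)
    (trans (qPoch-mod-5 N .at i) (qPoch~E (N ℕ.* 5) i (ℕ.≤-trans i≤N (ℕ.m≤m*n N 5))))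

κfactor : ℕ → PS
κfactor i = one ⊕ mono (suc (2 ℕ.* i))

κfactor~ : ∀ i → κfactor i ~[ i ] one
κfactor~ i j j≤i = trans (cong (_+_ (one j)) (mono-vanish (suc (2 ℕ.* i)) j (s≤s (ℕ.≤-trans j≤i (ℕ.m≤m+n i (1 ℕ.* i)))))) (ℤ.+-identityʳ _)

-- `κ` reads coefficient N off a product of N + 1 factors, one more than `lim` takes; the extra
-- factor is 1 up to q^N.
κ~ : ∀ N → ∏ N κfactor ~[ N ] κ
κ~ N i i≤N = trans (∏~lim κfactor κfactor~ N i i≤N) (sym (∏-stable κfactor κfactor~ i 1 i ℕ.≤-refl))

negArg-mono-odd : ∀ i → negArg (mono (suc (2 ℕ.* i))) ≈ ⊝ mono (suc (2 ℕ.* i))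
negArg-mono-odd i .at n = trans (negArg-mono (suc (2 ℕ.* i)) n)
  (trans (cong (λ z → (- z) * mono (suc (2 ℕ.* i)) n) (sign i)) (ℤ.-1*i≡-i _))
  where
  sg : ℕ → ℤ
  sg zero    = + 1
  sg (suc n) = - sg n
  negArg-0 : ∀ n → negArg (λ _ → + 0) n ≡ + 0
  negArg-0 n with (n % 2) ℕ.≡ᵇ 0
  ... | true  = refl
  ... | false = refl
  negArg-mono : ∀ k n → negArg (mono k) n ≡ sg k * mono k n
  negArg-mono zero    zero    = refl
  negArg-mono zero    (suc n) = trans (negArg-suc one n) (cong -_ (negArg-0 n))
  negArg-mono (suc k) zero    = sym (ℤ.*-zeroʳ (- sg k))
  negArg-mono (suc k) (suc n) = trans (negArg-suc (mono (suc k)) n)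
    (trans (cong -_ (negArg-mono k n)) (ℤ.neg-distribˡ-* (sg k) (mono k n)))
  sign : ∀ i → sg (2 ℕ.* i) ≡ + 1
  sign zero    = refl
  sign (suc i) = trans (cong (λ z → - sg z) (ℕ.+-suc i (i ℕ.+ 0))) (trans (ℤ.neg-involutive (sg (i ℕ.+ (i ℕ.+ 0)))) (sign i))

negArg-one : negArg one ≈ one
negArg-one .at zero    = refl
negArg-one .at (suc n) with (suc n % 2) ℕ.≡ᵇ 0
... | true  = refl
... | false = refl

negArg-∏ : ∀ n F → negArg (∏ n F) ≈ ∏ n (negArg ∘ F)
negArg-∏ zero    F = negArg-one
negArg-∏ (suc n) F = ≈-trans (negArg-cong (∏-last n F)) (≈-trans (negArg-⊛ (∏ n F) (F n))
  (≈-trans (⊛-congʳ (negArg (F n)) (negArg-∏ n F)) (≈-sym (∏-last n (negArg ∘ F)))))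

qPoch-mod-2 : ∀ N → Jacobi.progression 2 1 N ⊛ substPow 2 (qPoch N) ≈ qPoch (N ℕ.* 2)
qPoch-mod-2 zero    = ≈-trans (⊛-congˡ one (substPow-one 2)) (one-⊛ one)
qPoch-mod-2 (suc N) = begin
  progression 1 (suc N) ⊛ substPow 2 (qPoch (suc N))
    ≈⟨ ⊛-cong (≈-trans (∏-last N (λ i → 1-q^ (1 ℕ.+ 2 ℕ.* i)))
                       (⊛-congˡ (progression 1 N) (⊖-cong (≈-refl {𝟙}) (mono-≡ (cong suc (ℕ.*-comm 2 N))))))
              (≈-trans (S-qPoch-suc N) (⊛-congˡ (substPow 2 (qPoch N)) (⊖-cong (≈-refl {𝟙}) (mono-≡ (ℕ.*-comm 2 (suc N)))))) ⟩
  progression 1 N ⊛ 1-q^ (1 ℕ.+ M) ⊛ (substPow 2 (qPoch N) ⊛ 1-q^ (2 ℕ.+ M))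
    ≈⟨ solve 4 (λ p x s y → p :* x :* (s :* y) := p :* s :* x :* y) ≈-refl
         (progression 1 N) (1-q^ (1 ℕ.+ M)) (substPow 2 (qPoch N)) (1-q^ (2 ℕ.+ M)) ⟩
  progression 1 N ⊛ substPow 2 (qPoch N) ⊛ 1-q^ (1 ℕ.+ M) ⊛ 1-q^ (2 ℕ.+ M)
    ≈⟨ ⊛-congʳ (1-q^ (2 ℕ.+ M)) (≈-trans (⊛-congʳ (1-q^ (1 ℕ.+ M)) (qPoch-mod-2 N)) (≈-sym (qPoch-suc M))) ⟩
  qPoch (1 ℕ.+ M) ⊛ 1-q^ (2 ℕ.+ M)
    ≈⟨ qPoch-suc (1 ℕ.+ M) ⟨
  qPoch (2 ℕ.+ M) ∎
  where
  open Jacobi 2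
  M : ℕ
  M = N ℕ.* 2

-- κ(-q) = (q; q²)_∞ consists of the factors of E with odd exponent, and E(q²) of those with even
-- exponent.
negArg-κ : negArg κ ⊛ substPow 2 E ≈ E
negArg-κ = ~⇒≈ λ N i i≤N → trans
  (~-⊛ {negArg κ} {Jacobi.progression 2 1 N} {substPow 2 E} {substPow 2 (qPoch N)}
     (λ i i≤N → trans (sym (negArg-~ (κ~ N) i i≤N)) (finite N .at i))
     (λ i i≤N → sym (substPow-~ 2 (qPoch~E N) i i≤N)) i i≤N)
  (trans (qPoch-mod-2 N .at i) (qPoch~E (N ℕ.* 2) i (ℕ.≤-trans i≤N (ℕ.m≤m*n N 2))))
  where
  finite : ∀ N → negArg (∏ N κfactor) ≈ Jacobi.progression 2 1 N
  finite N = ≈-trans (negArg-∏ N κfactor) (∏-cong N (λ i → ≈-trans (negArg-⊕ one (mono (suc (2 ℕ.* i))))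
    (⊕-cong (≈-trans negArg-one one≈𝟙) (negArg-mono-odd i))))

κ⊛E : κ ⊛ substPow 2 E ≈ negArg E
κ⊛E = ≈-trans (⊛-cong (≈-sym (negArg-involutive κ)) (≈-sym (negArg-substPow-2 E)))
  (≈-trans (≈-sym (negArg-⊛ (negArg κ) (substPow 2 E))) (negArg-cong negArg-κ))

-- Finite sums over ℤ²

ind : ∀ {P : Set} → Dec P → ℤ
ind (yes _) = + 1
ind (no  _) = + 0

ind-yes : ∀ {P : Set} (d : Dec P) → P → ind d ≡ + 1
ind-yes (yes _) p = refl
ind-yes (no ¬p) p = ⊥-elim (¬p p)

ind-no : ∀ {P : Set} (d : Dec P) → ¬ P → ind d ≡ + 0
ind-no (yes p) ¬p = ⊥-elim (¬p p)
ind-no (no _)  ¬p = refl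

ind-⇔ : ∀ {P Q : Set} (d : Dec P) (e : Dec Q) → (P → Q) → (Q → P) → ind d ≡ ind e
ind-⇔ (yes p) e f g = sym (ind-yes e (f p))
ind-⇔ (no ¬p) e f g = sym (ind-no e (¬p ∘ g))

∑-++ : ∀ {A : Set} (xs ys : List A) (φ : A → ℤ) → ∑ (xs ++ ys) φ ≡ ∑ xs φ + ∑ ys φ
∑-++ []       ys φ = sym (ℤ.+-identityˡ _)
∑-++ (x ∷ xs) ys φ = trans (cong (_+_ (φ x)) (∑-++ xs ys φ)) (sym (ℤ.+-assoc (φ x) (∑ xs φ) (∑ ys φ)))

∑-concatMap : ∀ {A B : Set} (k : A → List B) (xs : List A) (φ : B → ℤ) → ∑ (concatMap k xs) φ ≡ ∑ xs (λ x → ∑ (k x) φ)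
∑-concatMap k []       φ = refl
∑-concatMap k (x ∷ xs) φ = trans (∑-++ (k x) (concatMap k xs) φ) (cong (_+_ (∑ (k x) φ)) (∑-concatMap k xs φ))

∑-cartesianProduct : ∀ {A B : Set} (xs : List A) (ys : List B) (φ : A × B → ℤ) →
  ∑ (cartesianProduct xs ys) φ ≡ ∑ xs (λ x → ∑ ys (λ y → φ (x , y)))
∑-cartesianProduct []       ys φ = refl
∑-cartesianProduct (x ∷ xs) ys φ = trans (∑-++ (map (x ,_) ys) (cartesianProduct xs ys) φ)
  (cong₂ _+_ (∑-map ys (x ,_) φ) (∑-cartesianProduct xs ys φ))

∑-*ʳ : ∀ {A : Set} (xs : List A) (φ : A → ℤ) c → ∑ xs (λ x → φ x * c) ≡ ∑ xs φ * c
∑-*ʳ xs φ c = trans (∑-cong xs (λ x → ℤ.*-comm (φ x) c)) (trans (∑-*ˡ xs c φ) (ℤ.*-comm c (∑ xs φ)))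

∑-filter : ∀ {A : Set} {P : A → Set} (P? : ∀ x → Dec (P x)) (xs : List A) → + length (filter P? xs) ≡ ∑ xs (λ x → ind (P? x))
∑-filter P? []       = refl
∑-filter P? (x ∷ xs) with P? x
... | yes _ = cong (_+_ (+ 1)) (∑-filter P? xs)
... | no  _ = trans (∑-filter P? xs) (sym (ℤ.+-identityˡ _))

module _ {A B : Set} (_≟₁_ : DecidableEquality A) (_≟₂_ : DecidableEquality B)
         (xs : List A) (ys : List B) (f : A → ℤ) (g : B → ℤ) (φ : B → A) (ψ : A → B)
         (from : ∀ b → g b ≡ + 0 ⊎ (f (φ b) ≡ g b × ∑ xs (λ x → ind (x ≟₁ φ b)) ≡ + 1 × ψ (φ b) ≡ b))
         (to   : ∀ a → f a ≡ + 0 ⊎ (g (ψ a) ≡ f a × ∑ ys (λ y → ind (y ≟₂ ψ a)) ≡ + 1 × φ (ψ a) ≡ a)) where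

  private
    spread : ∀ b → g b ≡ ∑ xs (λ a → ind (a ≟₁ φ b) * g b)
    spread b = sym (trans (∑-*ʳ xs (λ a → ind (a ≟₁ φ b)) (g b)) (collapse (from b)))
      where
      collapse : g b ≡ + 0 ⊎ (f (φ b) ≡ g b × ∑ xs (λ x → ind (x ≟₁ φ b)) ≡ + 1 × ψ (φ b) ≡ b) →
                 ∑ xs (λ a → ind (a ≟₁ φ b)) * g b ≡ g b
      collapse (inj₁ g0)           = trans (cong (_*_ (∑ xs (λ a → ind (a ≟₁ φ b)))) g0) (trans (ℤ.*-zeroʳ (∑ xs (λ a → ind (a ≟₁ φ b)))) (sym g0))
      collapse (inj₂ (_ , m1 , _)) = trans (cong (_* g b) m1) (ℤ.*-identityˡ (g b))

    gather : ∀ a → ∑ ys (λ b → ind (a ≟₁ φ b) * g b) ≡ f a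
    gather a with to a
    ... | inj₁ f0 = trans (∑-cong ys vanish) (trans (∑-0 ys) (sym f0))
      where
      vanish : ∀ b → ind (a ≟₁ φ b) * g b ≡ + 0
      vanish b with a ≟₁ φ b
      ... | no  _ = ℤ.*-zeroˡ (g b)
      ... | yes refl with from b
      ...   | inj₁ g0          = trans (cong (_*_ (+ 1)) g0) refl
      ...   | inj₂ (fg , _)    = trans (cong (_*_ (+ 1)) (trans (sym fg) f0)) refl
    ... | inj₂ (gf , m1 , φψ) = trans (∑-cong ys match) (trans (∑-*ʳ ys (λ b → ind (b ≟₂ ψ a)) (f a)) (trans (cong (_* f a) m1) (ℤ.*-identityˡ (f a))))
      where
      match : ∀ b → ind (a ≟₁ φ b) * g b ≡ ind (b ≟₂ ψ a) * f a
      match b with a ≟₁ φ b | b ≟₂ ψ a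
      ... | yes _    | yes refl = cong (_*_ (+ 1)) gf
      ... | no  a≢   | yes refl = ⊥-elim (a≢ (sym φψ))
      ... | no  _    | no  _    = trans (ℤ.*-zeroˡ (g b)) (sym (ℤ.*-zeroˡ (f a)))
      ... | yes refl | no  b≢   with from b
      ...   | inj₁ g0           = trans (cong (_*_ (+ 1)) g0) (sym (ℤ.*-zeroˡ (f a)))
      ...   | inj₂ (_ , _ , ψφ) = ⊥-elim (b≢ (sym ψφ))

  -- Double counting of the pairs with a = φ b. The maps φ and ψ are inverse to each other between
  -- the points of nonzero weight, and the images of these points are listed exactly once.
  ∑-reindex : ∑ ys g ≡ ∑ xs f
  ∑-reindex = trans (∑-cong ys spread) (trans (∑-swap ys xs (λ b a → ind (a ≟₁ φ b) * g b)) (∑-cong xs gather))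

∑-upTo-ind : ∀ n k → k < n → ∑ (upTo n) (λ i → ind (i ℕ.≟ k)) ≡ + 1
∑-upTo-ind (suc n) zero    _         = trans (∑-upTo-suc n (λ i → ind (i ℕ.≟ 0)))
  (cong (_+_ (+ 1)) (trans (∑-cong (upTo n) (λ i → ind-no (suc i ℕ.≟ 0) λ ())) (∑-0 (upTo n))))
∑-upTo-ind (suc n) (suc k) (s≤s k<n) = trans (∑-upTo-suc n (λ i → ind (i ℕ.≟ suc k)))
  (trans (ℤ.+-identityˡ _) (trans (∑-cong (upTo n) (λ i → ind-⇔ (suc i ℕ.≟ suc k) (i ℕ.≟ k) ℕ.suc-injective (cong suc))) (∑-upTo-ind n k k<n)))

∑-intRange-ind : ∀ B z → ∣ z ∣ ≤ B → ∑ (intRange B) (λ x → ind (x ≟ z)) ≡ + 1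
∑-intRange-ind B z z≤B with index z z≤B
  where
  index : ∀ z → ∣ z ∣ ≤ B → ∃ λ k → k < suc (2 ℕ.* B) × + k ≡ z + + B
  index (+ m)    m≤B = m ℕ.+ B , s≤s (ℕ.+-mono-≤ m≤B (ℕ.m≤m+n B 0)) , refl
  index -[1+ m ] m<B = B ∸ suc m , s≤s (ℕ.≤-trans (ℕ.m∸n≤m B (suc m)) (ℕ.m≤m+n B _)) , sym (ℤ.⊖-≥ m<B)
... | k , k< , eq = trans (∑-map (upTo (suc (2 ℕ.* B))) (λ i → + i - + B) (λ x → ind (x ≟ z)))
  (trans (∑-cong (upTo (suc (2 ℕ.* B))) (λ i → ind-⇔ (+ i - + B ≟ z) (i ℕ.≟ k) (to i) (from i))) (∑-upTo-ind (suc (2 ℕ.* B)) k k<))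
  where
  cancel₁ : ∀ x b → x ≡ x - b + b
  cancel₁ = solve-∀
  cancel₂ : ∀ x b → x + b - b ≡ x
  cancel₂ = solve-∀
  to : ∀ i → + i - + B ≡ z → i ≡ k
  to i p = ℤ.+-injective (trans (cancel₁ (+ i) (+ B)) (trans (cong (_+ + B) p) (sym eq)))
  from : ∀ i → i ≡ k → + i - + B ≡ z
  from i refl = trans (cong (_- + B) eq) (cancel₂ z (+ B))

Point : Set
Point = ℤ × ℤ

_≟ₚ_ : DecidableEquality Point
_≟ₚ_ = ≡-dec _≟_ _≟_

rect : ℕ → ℕ → List Point
rect X Y = cartesianProduct (intRange X) (intRange Y)

InRect : ℕ → ℕ → Point → Set
InRect X Y (x , y) = ∣ x ∣ ≤ X × ∣ y ∣ ≤ Y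

∑-rect-ind : ∀ X Y p → InRect X Y p → ∑ (rect X Y) (λ x → ind (x ≟ₚ p)) ≡ + 1
∑-rect-ind X Y (a , b) (a≤ , b≤) = begin′
  ∑ (rect X Y) (λ x → ind (x ≟ₚ (a , b)))
    ≡⟨ ∑-cartesianProduct (intRange X) (intRange Y) (λ x → ind (x ≟ₚ (a , b))) ⟩
  ∑ (intRange X) (λ x → ∑ (intRange Y) (λ y → ind ((x , y) ≟ₚ (a , b))))
    ≡⟨ ∑-cong (intRange X) (λ x → trans (∑-cong (intRange Y) (λ y → split x y)) (∑-*ˡ (intRange Y) (ind (x ≟ a)) (λ y → ind (y ≟ b)))) ⟩
  ∑ (intRange X) (λ x → ind (x ≟ a) * ∑ (intRange Y) (λ y → ind (y ≟ b)))
    ≡⟨ ∑-*ʳ (intRange X) (λ x → ind (x ≟ a)) _ ⟩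
  ∑ (intRange X) (λ x → ind (x ≟ a)) * ∑ (intRange Y) (λ y → ind (y ≟ b))
    ≡⟨ cong₂ _*_ (∑-intRange-ind X a a≤) (∑-intRange-ind Y b b≤) ⟩
  + 1 ∎′
  where
  open ≡-Reasoning renaming (begin_ to begin′_; _∎ to _∎′)
  split : ∀ x y → ind ((x , y) ≟ₚ (a , b)) ≡ ind (x ≟ a) * ind (y ≟ b)
  split x y = go (x ≟ a) (y ≟ b)
    where
    go : (d : Dec (x ≡ a)) (e : Dec (y ≡ b)) → ind ((x , y) ≟ₚ (a , b)) ≡ ind d * ind e
    go (yes refl) (yes refl) = ind-yes ((a , b) ≟ₚ (a , b)) refl
    go (yes _)    (no  y≢)   = ind-no ((x , y) ≟ₚ (a , b)) (y≢ ∘ cong proj₂)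
    go (no  x≢)   (yes _)    = ind-no ((x , y) ≟ₚ (a , b)) (x≢ ∘ cong proj₁)
    go (no  x≢)   (no  _)    = ind-no ((x , y) ≟ₚ (a , b)) (x≢ ∘ cong proj₁)

Definite : (Point → ℤ) → Set
Definite Q = ∀ K p → Q p ≡ + K → InRect K K p

-- Only used for definite Q, where the box contains every p with Q(p) = K.
rep : (Point → ℤ) → ℕ → (Point → ℤ) → ℤ
rep Q K w = ∑ (rect K K) (λ p → w p * ind (Q p ≟ + K))

-- The change of variables behind all comparisons: φ embeds the points with R = n among those with Q
-- = κ₀ + M n, and its image contains the support of w. `def` and `bound` put all solutions inside
-- the respective boxes, so the boxes may differ.
rep-push : ∀ {Q R : Point → ℤ} {w s : Point → ℤ} {κ₀ M : ℕ} .{{_ : NonZero M}} X Y n (φ ψ : Point → Point) →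
  Definite Q → (∀ p → R p ≡ + n → InRect X Y p) →
  (∀ p → Q (φ p) ≡ + κ₀ + + M * R p) → (∀ p → w (φ p) ≡ s p) → (∀ p → ψ (φ p) ≡ p) →
  (∀ p → w p ≡ + 0 ⊎ φ (ψ p) ≡ p) →
  ∑ (rect X Y) (λ p → s p * ind (R p ≟ + n)) ≡ rep Q (κ₀ ℕ.+ M ℕ.* n) w
rep-push {Q} {R} {w} {s} {κ₀} {M} X Y n φ ψ def bound Qφ wφ ψφ φψ =
  ∑-reindex _≟ₚ_ _≟ₚ_ (rect K K) (rect X Y) (λ p → w p * ind (Q p ≟ + K)) (λ p → s p * ind (R p ≟ + n)) φ ψ from to
  where
  K : ℕ
  K = κ₀ ℕ.+ M ℕ.* n
  +K : + K ≡ + κ₀ + + M * + n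
  +K = trans (ℤ.pos-+ κ₀ (M ℕ.* n)) (cong (_+_ (+ κ₀)) (ℤ.pos-* M n))
  R⇒Q : ∀ p → R p ≡ + n → Q (φ p) ≡ + K
  R⇒Q p eq = trans (Qφ p) (trans (cong (λ z → + κ₀ + + M * z) eq) (sym +K))
  Q⇒R : ∀ p → Q (φ p) ≡ + K → R p ≡ + n
  Q⇒R p eq = ℤ.*-cancelˡ-≡ (+ M) (R p) (+ n) (+-cancelˡ (+ κ₀) (+ M * R p) (+ M * + n) (trans (sym (Qφ p)) (trans eq +K)))
  inds : ∀ p → ind (Q (φ p) ≟ + K) ≡ ind (R p ≟ + n)
  inds p = ind-⇔ (Q (φ p) ≟ + K) (R p ≟ + n) (Q⇒R p) (R⇒Q p)
  from : ∀ p → s p * ind (R p ≟ + n) ≡ + 0 ⊎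
    (w (φ p) * ind (Q (φ p) ≟ + K) ≡ s p * ind (R p ≟ + n) × ∑ (rect K K) (λ x → ind (x ≟ₚ φ p)) ≡ + 1 × ψ (φ p) ≡ p)
  from p = case (R p ≟ + n)
    where
    case : Dec (R p ≡ + n) → _
    case (no R≢)  = inj₁ (trans (cong (_*_ (s p)) (ind-no (R p ≟ + n) R≢)) (ℤ.*-zeroʳ (s p)))
    case (yes R≡) = inj₂ (cong₂ _*_ (wφ p) (inds p) , ∑-rect-ind K K (φ p) (def K (φ p) (R⇒Q p R≡)) , ψφ p)
  to : ∀ p → w p * ind (Q p ≟ + K) ≡ + 0 ⊎
    (s (ψ p) * ind (R (ψ p) ≟ + n) ≡ w p * ind (Q p ≟ + K) × ∑ (rect X Y) (λ y → ind (y ≟ₚ ψ p)) ≡ + 1 × φ (ψ p) ≡ p)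
  to p = case (Q p ≟ + K) (φψ p)
    where
    case : Dec (Q p ≡ + K) → w p ≡ + 0 ⊎ φ (ψ p) ≡ p → _
    case (no Q≢)  _          = inj₁ (trans (cong (_*_ (w p)) (ind-no (Q p ≟ + K) Q≢)) (ℤ.*-zeroʳ (w p)))
    case (yes _)  (inj₁ w0)  = inj₁ (trans (cong (_* ind (Q p ≟ + K)) w0) (ℤ.*-zeroˡ (ind (Q p ≟ + K))))
    case (yes Q≡) (inj₂ φψp) = inj₂ (cong₂ _*_ (trans (sym (wφ (ψ p))) (cong w φψp))
                                        (trans (sym (inds (ψ p))) (cong (λ z → ind (Q z ≟ + K)) φψp))
                                    , ∑-rect-ind X Y (ψ p) (bound (ψ p) (Q⇒R (ψ p) (trans (cong Q φψp) Q≡))) , φψp)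

rep-+ : ∀ Q K w w′ → rep Q K (λ p → w p + w′ p) ≡ rep Q K w + rep Q K w′
rep-+ Q K w w′ = trans (∑-cong (rect K K) (λ p → ℤ.*-distribʳ-+ (ind (Q p ≟ + K)) (w p) (w′ p))) (∑-+ (rect K K) (λ p → w p * ind (Q p ≟ + K)) (λ p → w′ p * ind (Q p ≟ + K)))

rep-* : ∀ Q K c w → rep Q K (λ p → c * w p) ≡ c * rep Q K w
rep-* Q K c w = trans (∑-cong (rect K K) (λ p → ℤ.*-assoc c (w p) (ind (Q p ≟ + K)))) (∑-*ˡ (rect K K) c (λ p → w p * ind (Q p ≟ + K)))

rep-0 : ∀ Q K w → (∀ p → Q p ≡ + K → w p ≡ + 0) → rep Q K w ≡ + 0
rep-0 Q K w w0 = trans (∑-cong (rect K K) vanish) (∑-0 (rect K K))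
  where
  vanish : ∀ p → w p * ind (Q p ≟ + K) ≡ + 0
  vanish p with Q p ≟ + K
  ... | yes eq = cong (_* + 1) (w0 p eq)
  ... | no  _  = ℤ.*-zeroʳ (w p)

record Matrix : Set where
  constructor mat
  field a b c d : ℤ

act : Matrix → Point → Point
act (mat a b c d) (x , y) = a * x + b * y , c * x + d * y

record Automorphism (Q : Point → ℤ) : Set where
  field
    matrix inverse : Matrix
    left  : ∀ p → act inverse (act matrix p) ≡ p
    right : ∀ p → act matrix (act inverse p) ≡ p
    form  : ∀ p → Q (act matrix p) ≡ Q p
open Automorphism public

rep-act : ∀ {Q} → Definite Q → (γ : Automorphism Q) → ∀ K w → rep Q K (w ∘ act (matrix γ)) ≡ rep Q K w
rep-act {Q} def γ K w = trans
  (rep-push {Q} {Q} {w} {w ∘ act (matrix γ)} {0} {1} K K K (act (matrix γ)) (act (inverse γ)) def (def K)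
    (λ p → trans (form γ p) (sym (trans (ℤ.+-identityˡ _) (ℤ.*-identityˡ (Q p))))) (λ _ → refl) (left γ) (inj₂ ∘ right γ))
  (cong (λ k → rep Q k w) (ℕ.*-identityˡ K))

rep-∑ : ∀ {Q} → Definite Q → ∀ (L : List (Automorphism Q)) K w →
  rep Q K (λ p → ∑ L (λ γ → w (act (matrix γ) p))) ≡ + length L * rep Q K w
rep-∑ {Q} def L K w = trans
  (∑-cong (rect K K) (λ p → sym (∑-*ʳ L (λ γ → w (act (matrix γ) p)) (ind (Q p ≟ + K)))))
  (trans (∑-swap (rect K K) L (λ p γ → w (act (matrix γ) p) * ind (Q p ≟ + K))) (∑-const L))
  where
  ∑-const : ∀ (L : List (Automorphism Q)) → ∑ L (λ γ → rep Q K (w ∘ act (matrix γ))) ≡ + length L * rep Q K w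
  ∑-const []      = sym (ℤ.*-zeroˡ (rep Q K w))
  ∑-const (γ ∷ L) = trans (cong₂ _+_ (rep-act def γ K w) (∑-const L)) (sym (ℤ.suc-* (+ length L) (rep Q K w)))

-- An automorphism permutes the points with Q = K, so `rep` of the sum of the transforms of w is
-- `length L` times `rep` of w. The two weights of an identity differ pointwise but have the same
-- average.
rep-average : ∀ {Q} → Definite Q → ∀ (L : List (Automorphism Q)) .{{_ : NonZero (length L)}} K w →
  (∀ p → Q p ≡ + K → ∑ L (λ γ → w (act (matrix γ) p)) ≡ + 0) → rep Q K w ≡ + 0
rep-average {Q} def L K w w0 = ℤ.*-cancelˡ-≡ (+ length L) (rep Q K w) (+ 0)
  (trans (trans (sym (rep-∑ def L K w)) (rep-0 Q K (λ p → ∑ L (λ γ → w (act (matrix γ) p))) w0)) (sym (ℤ.*-zeroʳ (+ length L))))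

-- Binary quadratic forms

record Form : Set where
  constructor qf
  field x² xy y² : ℤ

eval : Form → Point → ℤ
eval (qf a b c) (n , m) = a * n * n + b * n * m + c * m * m

pull : Form → Matrix → Form
pull (qf α β γ) (mat a b c d) = qf
  (α * a * a + β * a * c + γ * c * c)
  (+ 2 * α * a * b + β * (a * d + b * c) + + 2 * γ * c * d)
  (α * b * b + β * b * d + γ * d * d)

eval-pull : ∀ F m p → eval F (act m p) ≡ eval (pull F m) p
eval-pull (qf α β γ) (mat a b c d) (x , y) = poly α β γ a b c d x y
  where
  poly : ∀ α β γ a b c d x y →
    α * (a * x + b * y) * (a * x + b * y) + β * (a * x + b * y) * (c * x + d * y)
      + γ * (c * x + d * y) * (c * x + d * y)
    ≡ (α * a * a + β * a * c + γ * c * c) * x * x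
      + (+ 2 * α * a * b + β * (a * d + b * c) + + 2 * γ * c * d) * x * y
      + (α * b * b + β * b * d + γ * d * d) * y * y
  poly = solve-∀

scale : ℤ → Form → Form
scale k (qf α β γ) = qf (k * α) (k * β) (k * γ)

eval-scale : ∀ k F p → eval (scale k F) p ≡ k * eval F p
eval-scale k (qf α β γ) (x , y) = poly k α β γ x y
  where
  poly : ∀ k α β γ x y → k * α * x * x + k * β * x * y + k * γ * y * y
                         ≡ k * (α * x * x + β * x * y + γ * y * y)
  poly = solve-∀

infixl 7 _⊡_
_⊡_ : Matrix → Matrix → Matrix
mat a b c d ⊡ mat a′ b′ c′ d′ = mat (a * a′ + b * c′) (a * b′ + b * d′) (c * a′ + d * c′) (c * b′ + d * d′)

identity : Matrix
identity = mat (+ 1) (+ 0) (+ 0) (+ 1)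

act-⊡ : ∀ m n p → act m (act n p) ≡ act (m ⊡ n) p
act-⊡ (mat a b c d) (mat a′ b′ c′ d′) (x , y) = cong₂ _,_ (poly a b a′ b′ c′ d′ x y) (poly c d a′ b′ c′ d′ x y)
  where
  poly : ∀ a b a′ b′ c′ d′ x y → a * (a′ * x + b′ * y) + b * (c′ * x + d′ * y)
                                 ≡ (a * a′ + b * c′) * x + (a * b′ + b * d′) * y
  poly = solve-∀

act-identity : ∀ p → act identity p ≡ p
act-identity (x , y) = cong₂ _,_ (poly₁ x y) (poly₂ x y)
  where
  poly₁ : ∀ x y → + 1 * x + + 0 * y ≡ x
  poly₁ = solve-∀
  poly₂ : ∀ x y → + 0 * x + + 1 * y ≡ y
  poly₂ = solve-∀

act-inverse : ∀ m n → m ⊡ n ≡ identity → ∀ p → act m (act n p) ≡ p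
act-inverse m n eq p = trans (act-⊡ m n p) (trans (cong (λ z → act z p) eq) (act-identity p))

automorphism : ∀ {F} m n → n ⊡ m ≡ identity → m ⊡ n ≡ identity → pull F m ≡ F → Automorphism (eval F)
automorphism {F} m n l r inv = record
  { matrix = m ; inverse = n ; left = act-inverse n m l ; right = act-inverse m n r
  ; form = λ p → trans (eval-pull F m p) (cong (λ z → eval z p) inv) }

square-pos : ∀ x → x * x ≡ + (∣ x ∣ ℕ.* ∣ x ∣)
square-pos (+ n)    = sym (ℤ.pos-* n n)
square-pos -[1+ n ] = refl

square-bound : ∀ t K u v → u * u + + suc t * (v * v) ≡ + K → ∣ u ∣ ≤ K × ∣ v ∣ ≤ K
square-bound t K u v eq = ℕ.≤-trans (m≤m² ∣ u ∣) (ℕ.≤-trans (ℕ.m≤m+n _ _) (ℕ.≤-reflexive eqℕ))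
                        , ℕ.≤-trans (m≤m² ∣ v ∣) (ℕ.≤-trans (ℕ.m≤m+n _ (t ℕ.* (∣ v ∣ ℕ.* ∣ v ∣))) (ℕ.≤-trans (ℕ.m≤n+m _ (∣ u ∣ ℕ.* ∣ u ∣)) (ℕ.≤-reflexive eqℕ)))
  where
  m≤m² : ∀ m → m ≤ m ℕ.* m
  m≤m² zero    = z≤n
  m≤m² (suc m) = ℕ.m≤m*n (suc m) (suc m)
  eqℕ : ∣ u ∣ ℕ.* ∣ u ∣ ℕ.+ suc t ℕ.* (∣ v ∣ ℕ.* ∣ v ∣) ≡ K
  eqℕ = ℤ.+-injective (trans (ℤ.pos-+ (∣ u ∣ ℕ.* ∣ u ∣) _) (trans (cong₂ _+_ (sym (square-pos u))
          (trans (ℤ.pos-* (suc t) _) (cong (_*_ (+ suc t)) (sym (square-pos v))))) eq))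

-- x² + (t + 1) y²
diagonal : ℕ → Form
diagonal t = qf (+ 1) (+ 0) (+ suc t)

diagonal-eval : ∀ t x y → eval (diagonal t) (x , y) ≡ x * x + + suc t * (y * y)
diagonal-eval t x y = poly (+ suc t) x y
  where
  poly : ∀ t x y → + 1 * x * x + + 0 * x * y + t * y * y ≡ x * x + t * (y * y)
  poly = solve-∀

diagonal-definite : ∀ t → Definite (eval (diagonal t))
diagonal-definite t K (x , y) eq = square-bound t K x y (trans (sym (diagonal-eval t x y)) eq)

-- Residues

%ℕ-/ℕ-unique : ∀ m .{{_ : NonZero m}} x r k → r < m → x ≡ + r + k * + m → x %ℕ m ≡ r × x /ℕ m ≡ k
%ℕ-/ℕ-unique m x r k r<m eq = sym r≡r′ , sym k≡k′
  where
  r′ = x %ℕ m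
  k′ = x /ℕ m
  eq′ : x ≡ + r′ + k′ * + m
  eq′ = ℤ.a≡a%ℕn+[a/ℕn]*n x m
  rearrange : ∀ r k r′ k′ m → r + k * m ≡ r′ + k′ * m → (k - k′) * m ≡ r′ - r
  rearrange r k r′ k′ m p = trans (poly₁ r k k′ m) (trans (cong (λ z → z - (r + k′ * m)) p) (poly₂ r r′ k′ m))
    where
    poly₁ : ∀ r k k′ m → (k - k′) * m ≡ r + k * m - (r + k′ * m)
    poly₁ = solve-∀
    poly₂ : ∀ r r′ k′ m → r′ + k′ * m - (r + k′ * m) ≡ r′ - r
    poly₂ = solve-∀
  diff : (k - k′) * + m ≡ + r′ - + r
  diff = rearrange (+ r) k (+ r′) k′ (+ m) (trans (sym eq) eq′)
  -- (k - k′) m is a difference of two residues, hence smaller than m in absolute value.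
  small : ∣ k - k′ ∣ ℕ.* m < m
  small = ℕ.≤-<-trans (ℕ.≤-reflexive (trans (sym (ℤ.abs-* (k - k′) (+ m))) (cong ∣_∣ (trans diff (ℤ.m-n≡m⊖n r′ r)))))
            (ℕ.≤-<-trans (ℤ.∣m⊝n∣≤m⊔n r′ r) (ℕ.⊔-pres-<m (ℤ.n%ℕd<d x m) r<m))
  zero? : ∀ j → j ℕ.* m < m → j ≡ 0
  zero? zero    _ = refl
  zero? (suc j) p = ⊥-elim (ℕ.<⇒≱ p (ℕ.m≤m+n m (j ℕ.* m)))
  k≡k′ : k ≡ k′
  k≡k′ = ℤ.i-j≡0⇒i≡j k k′ (ℤ.∣i∣≡0⇒i≡0 (zero? _ small))
  r≡r′ : r ≡ r′
  r≡r′ = ℤ.+-injective (sym (ℤ.i-j≡0⇒i≡j (+ r′) (+ r) (trans (sym diff) (trans (cong (λ z → z * + m) (ℤ.i≡j⇒i-j≡0 k≡k′)) (ℤ.*-zeroˡ (+ m))))))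

%ℕ-multiple : ∀ m .{{_ : NonZero m}} k → (k * + m) %ℕ m ≡ 0 × (k * + m) /ℕ m ≡ k
%ℕ-multiple m k = %ℕ-/ℕ-unique m (k * + m) 0 k (ℕ.>-nonZero⁻¹ m) (sym (ℤ.+-identityˡ _))

%ℕ-shift : ∀ m .{{_ : NonZero m}} x k → (x + k * + m) %ℕ m ≡ x %ℕ m × (x + k * + m) /ℕ m ≡ x /ℕ m + k
%ℕ-shift m x k = %ℕ-/ℕ-unique m _ (x %ℕ m) (x /ℕ m + k) (ℤ.n%ℕd<d x m)
  (trans (cong (_+ k * + m) (ℤ.a≡a%ℕn+[a/ℕn]*n x m)) (poly (+ (x %ℕ m)) (x /ℕ m) k (+ m)))
  where
  poly : ∀ r q k m → r + q * m + k * m ≡ r + (q + k) * m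
  poly = solve-∀

divisible : ∀ m .{{_ : NonZero m}} x → (x %ℕ m ≡ᵇ 0) ≡ true → x ≡ (x /ℕ m) * + m
divisible m x p = trans (ℤ.a≡a%ℕn+[a/ℕn]*n x m) (trans (cong (λ z → + z + (x /ℕ m) * + m) (0? (x %ℕ m) p)) (ℤ.+-identityˡ _))
  where
  0? : ∀ n → (n ≡ᵇ 0) ≡ true → n ≡ 0
  0? zero _ = refl

sg : ℕ → ℤ
sg zero    = + 1
sg (suc n) = - sg n

sgn : ℤ → ℤ
sgn j = sg ∣ j ∣

sgn-suc : ∀ j → sgn (+ 1 + j) ≡ - sgn j
sgn-suc (+ n)          = refl
sgn-suc -[1+ zero ]    = refl
sgn-suc -[1+ suc n ]   = sym (ℤ.neg-involutive (sg (suc n)))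

sgn-suc-suc : ∀ j → sgn (+ 1 + (+ 1 + j)) ≡ sgn j
sgn-suc-suc j = trans (sgn-suc (+ 1 + j)) (trans (cong -_ (sgn-suc j)) (ℤ.neg-involutive (sgn j)))

sgn-even : ∀ j k → sgn (j + k * + 2) ≡ sgn j
sgn-even j (+ zero)  = cong sgn (ℤ.+-identityʳ j)
sgn-even j (+ suc n) = trans (cong sgn (poly j (+ n))) (trans (sgn-suc-suc (j + + n * + 2)) (sgn-even j (+ n)))
  where
  poly : ∀ j n → j + (+ 1 + n) * + 2 ≡ + 1 + (+ 1 + (j + n * + 2))
  poly = solve-∀
sgn-even j -[1+ n ]  = trans (sym (sgn-suc-suc (j + -[1+ n ] * + 2))) (trans (cong sgn (poly j (+ n))) (smaller n))
  where
  poly : ∀ j n → + 1 + (+ 1 + (j + (- (+ 1 + n)) * + 2)) ≡ j + (- n) * + 2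
  poly = solve-∀
  smaller : ∀ n → sgn (j + (- + n) * + 2) ≡ sgn j
  smaller zero    = cong sgn (ℤ.+-identityʳ j)
  smaller (suc n) = sgn-even j -[1+ n ]

-- Periodic weights

record Periodic (P : ℕ) (w : Point → ℤ) : Set where
  constructor mkPeriodic
  field shift : ∀ x y k l → w (x + + P * k , y + + P * l) ≡ w (x , y)
open Periodic public

periodic-act : ∀ {P w} m → Periodic P w → Periodic P (w ∘ act m)
periodic-act {P} {w} (mat a b c d) pw .shift x y k l =
  trans (cong₂ (λ u v → w (u , v)) (poly a b x y k l (+ P)) (poly c d x y k l (+ P)))
        (pw .shift (a * x + b * y) (c * x + d * y) (a * k + b * l) (c * k + d * l))
  where
  poly : ∀ a b x y k l P → a * (x + P * k) + b * (y + P * l) ≡ a * x + b * y + P * (a * k + b * l)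
  poly = solve-∀

periodic-∑ : ∀ {P} {A : Set} (xs : List A) (w : A → Point → ℤ) → (∀ a → Periodic P (w a)) → Periodic P (λ p → ∑ xs (λ a → w a p))
periodic-∑ xs w pw .shift x y k l = ∑-cong xs (λ a → pw a .shift x y k l)

-- What becomes of the sign (-1)^j when x = m j + r is the new variable. The alternation makes 2 m,
-- not m, its period.
progressionSign : (m : ℕ) .{{_ : NonZero m}} → ℤ → ℤ → ℤ
progressionSign m r x = if (x - r) %ℕ m ≡ᵇ 0 then sgn ((x - r) /ℕ m) else + 0

progressionSign-periodic : ∀ m .{{_ : NonZero m}} t r x k → progressionSign m r (x + + (t ℕ.* 2 ℕ.* m) * k) ≡ progressionSign m r x
progressionSign-periodic m t r x k = trans
  (cong (λ z → if z %ℕ m ≡ᵇ 0 then sgn (z /ℕ m) else + 0)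
     (trans (cong (λ z → x + z * k - r) (trans (ℤ.pos-* (t ℕ.* 2) m) (cong (_* + m) (ℤ.pos-* t 2)))) (poly x r k (+ t) (+ m))))
  (trans (cong₂ (λ a b → if a ≡ᵇ 0 then sgn b else + 0) (proj₁ moved) (proj₂ moved))
         (cong (λ z → if (x - r) %ℕ m ≡ᵇ 0 then z else + 0) (sgn-even ((x - r) /ℕ m) (+ t * k))))
  where
  poly : ∀ x r k t m → x + t * + 2 * m * k - r ≡ x - r + t * k * + 2 * m
  poly = solve-∀
  moved = %ℕ-shift m (x - r) (+ t * k * + 2)

progressionSign-on : ∀ m .{{_ : NonZero m}} r j → progressionSign m r (+ m * j + r) ≡ sgn j
progressionSign-on m r j = trans (cong (λ z → if z %ℕ m ≡ᵇ 0 then sgn (z /ℕ m) else + 0) (poly (+ m) j r))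
  (cong₂ (λ a b → if a ≡ᵇ 0 then sgn b else + 0) (proj₁ (%ℕ-multiple m j)) (proj₂ (%ℕ-multiple m j)))
  where
  poly : ∀ m j r → m * j + r - r ≡ j * m
  poly = solve-∀

progressionSign-inverse : ∀ m .{{_ : NonZero m}} r j → (+ m * j + r - r) /ℕ m ≡ j
progressionSign-inverse m r j = trans (cong (_/ℕ m) (poly (+ m) j r)) (proj₂ (%ℕ-multiple m j))
  where
  poly : ∀ m j r → m * j + r - r ≡ j * m
  poly = solve-∀

progressionSign-support : ∀ m .{{_ : NonZero m}} r x → progressionSign m r x ≡ + 0 ⊎ + m * ((x - r) /ℕ m) + r ≡ x
progressionSign-support m r x with (x - r) %ℕ m ≡ᵇ 0 in eq
... | false = inj₁ refl
... | true  = inj₂ (trans (poly₁ (+ m) ((x - r) /ℕ m) r) (trans (cong (_+ r) (sym (divisible m (x - r) eq))) (poly₂ x r)))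
  where
  poly₁ : ∀ m q r → m * q + r ≡ q * m + r
  poly₁ = solve-∀
  poly₂ : ∀ x r → x - r + r ≡ x
  poly₂ = solve-∀

-- Indicator of the lattice g ∣ y, x ≡ c y mod h. The index g is 1 for a form in q and 2 for a form
-- in q².
lattice : (h g : ℕ) .{{_ : NonZero h}} .{{_ : NonZero g}} → ℤ → Point → ℤ
lattice h g c (x , y) = if (y %ℕ g ≡ᵇ 0) ∧ ((x - c * y) %ℕ h ≡ᵇ 0) then + 1 else + 0

lattice-periodic : ∀ h g .{{_ : NonZero h}} .{{_ : NonZero g}} s t c {P} → P ≡ s ℕ.* h → P ≡ t ℕ.* g → Periodic P (lattice h g c)
lattice-periodic h g s t c {P} P≡sh P≡tg .shift x y k l = cong₂ (λ a b → if (a ≡ᵇ 0) ∧ (b ≡ᵇ 0) then + 1 else + 0) eq₁ eq₂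
  where
  poly₁ : ∀ y t l g → y + t * g * l ≡ y + t * l * g
  poly₁ = solve-∀
  poly₂ : ∀ x y k l c s h → x + s * h * k - c * (y + s * h * l) ≡ x - c * y + (s * k - c * s * l) * h
  poly₂ = solve-∀
  eq₁ : (y + + P * l) %ℕ g ≡ y %ℕ g
  eq₁ = trans (cong (_%ℕ g) (trans (cong (λ z → y + z * l) (trans (cong +_ P≡tg) (ℤ.pos-* t g))) (poly₁ y (+ t) l (+ g)))) (proj₁ (%ℕ-shift g y (+ t * l)))
  eq₂ : (x + + P * k - c * (y + + P * l)) %ℕ h ≡ (x - c * y) %ℕ h
  eq₂ = trans (cong (_%ℕ h) (trans (cong (λ z → x + z * k - c * (y + z * l)) (trans (cong +_ P≡sh) (ℤ.pos-* s h))) (poly₂ x y k l c (+ s) (+ h))))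
              (proj₁ (%ℕ-shift h (x - c * y) (+ s * k - c * + s * l)))

latticeMatrix : (h g : ℕ) → ℤ → Matrix
latticeMatrix h g c = mat (+ h) (c * + g) (+ 0) (+ g)

latticeCoordinates : (h g : ℕ) .{{_ : NonZero h}} .{{_ : NonZero g}} → ℤ → Point → Point
latticeCoordinates h g c (x , y) = (x - c * y) /ℕ h , y /ℕ g

module _ (h g : ℕ) .{{_ : NonZero h}} .{{_ : NonZero g}} (c : ℤ) where

  private
    remove : ∀ h c g k l → h * k + c * g * l - c * (+ 0 * k + g * l) ≡ k * h
    remove = solve-∀
    second : ∀ g k l → + 0 * k + g * l ≡ l * g
    second = solve-∀

  lattice-on : ∀ p → lattice h g c (act (latticeMatrix h g c) p) ≡ + 1
  lattice-on (k , l) = cong₂ (λ a b → if (a ≡ᵇ 0) ∧ (b ≡ᵇ 0) then + 1 else + 0)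
    (trans (cong (_%ℕ g) (second (+ g) k l)) (proj₁ (%ℕ-multiple g l)))
    (trans (cong (_%ℕ h) (remove (+ h) c (+ g) k l)) (proj₁ (%ℕ-multiple h k)))

  lattice-inverse : ∀ p → latticeCoordinates h g c (act (latticeMatrix h g c) p) ≡ p
  lattice-inverse (k , l) = cong₂ _,_
    (trans (cong (_/ℕ h) (remove (+ h) c (+ g) k l)) (proj₂ (%ℕ-multiple h k)))
    (trans (cong (_/ℕ g) (second (+ g) k l)) (proj₂ (%ℕ-multiple g l)))

  lattice-support : ∀ p → lattice h g c p ≡ + 0 ⊎ act (latticeMatrix h g c) (latticeCoordinates h g c p) ≡ p
  lattice-support (x , y) with y %ℕ g ≡ᵇ 0 in eq₁ | (x - c * y) %ℕ h ≡ᵇ 0 in eq₂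
  ... | false | _     = inj₁ refl
  ... | true  | false = inj₁ refl
  ... | true  | true  = inj₂ (cong₂ _,_
        (trans (poly (+ h) c (+ g) ((x - c * y) /ℕ h) (y /ℕ g))
          (trans (cong₂ (λ u v → u + c * v) (sym (divisible h (x - c * y) eq₂)) (sym (divisible g y eq₁))) (cancel x y c)))
        (trans (second (+ g) ((x - c * y) /ℕ h) (y /ℕ g)) (sym (divisible g y eq₁))))
    where
    poly : ∀ h c g k l → h * k + c * g * l ≡ k * h + c * (l * g)
    poly = solve-∀
    cancel : ∀ x y c → x - c * y + c * y ≡ x
    cancel = solve-∀

allBelow : ℕ → (ℕ → Bool) → Bool
allBelow zero    φ = true
allBelow (suc n) φ = φ n ∧ allBelow n φ

allBelow-sound : ∀ n φ → allBelow n φ ≡ true → ∀ i → i < n → φ i ≡ true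
allBelow-sound (suc n) φ p i (s≤s i≤n) with φ n in eq | ℕ.m≤n⇒m<n∨m≡n i≤n
... | true | inj₁ i<n  = allBelow-sound n φ p i i<n
... | true | inj₂ refl = eq

isZero : ℤ → Bool
isZero (+ zero) = true
isZero _        = false

isZero-sound : ∀ z → isZero z ≡ true → z ≡ + 0
isZero-sound (+ zero) _ = refl

-- Tests only the classes modulo P on which Q ≡ κ₀ mod M; no other class contains a point with Q =
-- κ₀ + M n.
residueCheck : (P M : ℕ) .{{_ : NonZero M}} → ℕ → (Q W : Point → ℤ) → Bool
residueCheck P M κ₀ Q W = allBelow P λ a → allBelow P λ b →
  if (Q (+ a , + b) - + κ₀) %ℕ M ≡ᵇ 0 then isZero (W (+ a , + b)) else true

module _ {F : Form} (def : Definite (eval F)) (P M κ₀ : ℕ) .{{_ : NonZero P}} .{{_ : NonZero M}}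
         (Q-periodic : ∀ x y k l → ∃ λ t → eval F (x + + P * k , y + + P * l) ≡ eval F (x , y) + t * + M)
         where

  private
    Q = eval F

  residueCheck-sound : ∀ W → Periodic P W → residueCheck P M κ₀ Q W ≡ true → ∀ n p → Q p ≡ + (κ₀ ℕ.+ M ℕ.* n) → W p ≡ + 0
  residueCheck-sound W pW ok n (x , y) Q≡ = trans (cong₂ (λ u v → W (u , v)) x≡ y≡) (trans (pW .shift (+ a) (+ b) k l) (isZero-sound _ zero!))
    where
    a = x %ℕ P
    b = y %ℕ P
    k = x /ℕ P
    l = y /ℕ P
    expand : ∀ x → x ≡ + (x %ℕ P) + + P * (x /ℕ P)
    expand x = trans (ℤ.a≡a%ℕn+[a/ℕn]*n x P) (cong (_+_ (+ (x %ℕ P))) (ℤ.*-comm (x /ℕ P) (+ P)))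
    x≡ : x ≡ + a + + P * k
    x≡ = expand x
    y≡ : y ≡ + b + + P * l
    y≡ = expand y
    t : ℤ
    t = proj₁ (Q-periodic (+ a) (+ b) k l)
    Qab : + κ₀ + + M * + n ≡ Q (+ a , + b) + t * + M
    Qab = trans (sym (trans (ℤ.pos-+ κ₀ (M ℕ.* n)) (cong (_+_ (+ κ₀)) (ℤ.pos-* M n)))) (trans (sym Q≡)
            (trans (cong₂ (λ u v → Q (u , v)) x≡ y≡) (proj₂ (Q-periodic (+ a) (+ b) k l))))
    rearrange : ∀ κ M n q t → κ + M * n ≡ q + t * M → q - κ ≡ (n - t) * M
    rearrange κ M n q t p = trans (poly₁ κ M q t) (trans (cong (λ z → z - κ - t * M) (sym p)) (poly₂ κ M n t))
      where
      poly₁ : ∀ κ M q t → q - κ ≡ q + t * M - κ - t * M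
      poly₁ = solve-∀
      poly₂ : ∀ κ M n t → κ + M * n - κ - t * M ≡ (n - t) * M
      poly₂ = solve-∀
    guard : (Q (+ a , + b) - + κ₀) %ℕ M ≡ 0
    guard = trans (cong (_%ℕ M) (rearrange (+ κ₀) (+ M) (+ n) (Q (+ a , + b)) t Qab)) (proj₁ (%ℕ-multiple M (+ n - t)))
    zero! : isZero (W (+ a , + b)) ≡ true
    zero! = trans (cong (λ z → if z ≡ᵇ 0 then isZero (W (+ a , + b)) else true) (sym guard))
      (allBelow-sound P _ (allBelow-sound P _ ok a (ℤ.n%ℕd<d x P)) b (ℤ.n%ℕd<d y P))

  -- One evaluation of `residueCheck` on the averaged weight settles all n. At each application the
  -- check is discharged by `refl`.
  rep-vanish : ∀ (L : List (Automorphism Q)) .{{_ : NonZero (length L)}} w → Periodic P w →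
    residueCheck P M κ₀ Q (λ p → ∑ L (λ γ → w (act (matrix γ) p))) ≡ true → ∀ n → rep Q (κ₀ ℕ.+ M ℕ.* n) w ≡ + 0
  rep-vanish L w pw ok n = rep-average def L (κ₀ ℕ.+ M ℕ.* n) w
    (residueCheck-sound (λ p → ∑ L (λ γ → w (act (matrix γ) p))) (periodic-∑ L (λ γ → w ∘ act (matrix γ)) (λ γ → periodic-act {w = w} (matrix γ) pw)) ok n)

-- Theta series as sums over lattices in the plane of x² + 71 y²

theta-sum : ∀ a b c N → ⟪ a , b , c ⟫ N ≡ ∑ (rect (4 ℕ.* c ℕ.* N) (4 ℕ.* a ℕ.* N)) (λ p → ind (eval (qf (+ a) (+ b) (+ c)) p ≟ + N))
theta-sum a b c N = trans (∑-filter (λ v → v ≟ + N) (concatMap (λ n → map (λ m → R (n , m)) ms) ns))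
  (trans (∑-concatMap (λ n → map (λ m → R (n , m)) ms) ns (λ v → ind (v ≟ + N)))
  (trans (∑-cong ns (λ n → ∑-map ms (λ m → R (n , m)) (λ v → ind (v ≟ + N))))
         (sym (∑-cartesianProduct ns ms (λ p → ind (R p ≟ + N))))))
  where
  R : Point → ℤ
  R = eval (qf (+ a) (+ b) (+ c))
  ns ms : List ℤ
  ns = intRange (4 ℕ.* c ℕ.* N)
  ms = intRange (4 ℕ.* a ℕ.* N)

-- From 4 a R = (2 a x + b y)² + 71 y², and the same with the roles of x and y exchanged, the box of
-- the definition of `theta` contains every solution.
theta-bound : ∀ a b c → + 4 * + a * + c ≡ + 71 + + b * + b → ∀ N p → eval (qf (+ a) (+ b) (+ c)) p ≡ + N →
  InRect (4 ℕ.* c ℕ.* N) (4 ℕ.* a ℕ.* N) p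
theta-bound a b c disc N (x , y) eq = proj₂ (square-bound 70 _ (+ 2 * + c * y + + b * x) x (trans (poly₂ (+ a) (+ b) (+ c) x y disc) (times c)))
                                     , proj₂ (square-bound 70 _ (+ 2 * + a * x + + b * y) y (trans (poly₁ (+ a) (+ b) (+ c) x y disc) (times a)))
  where
  times : ∀ k → + 4 * + k * eval (qf (+ a) (+ b) (+ c)) (x , y) ≡ + (4 ℕ.* k ℕ.* N)
  times k = trans (cong (λ z → + 4 * + k * z) eq) (sym (trans (ℤ.pos-* (4 ℕ.* k) N) (cong (_* + N) (ℤ.pos-* 4 k))))
  expand₁ : ∀ a b c x y → let u = + 2 * a * x + b * y in
    u * u + + 71 * (y * y) ≡ + 4 * a * (a * x * x + b * x * y) + (+ 71 + b * b) * (y * y)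
  expand₁ = solve-∀
  collect₁ : ∀ a b c x y → + 4 * a * (a * x * x + b * x * y) + + 4 * a * c * (y * y)
    ≡ + 4 * a * (a * x * x + b * x * y + c * y * y)
  collect₁ = solve-∀
  poly₁ : ∀ a b c x y → + 4 * a * c ≡ + 71 + b * b → let u = + 2 * a * x + b * y in
    u * u + + 71 * (y * y) ≡ + 4 * a * (a * x * x + b * x * y + c * y * y)
  poly₁ a b c x y d = trans (expand₁ a b c x y)
    (trans (cong (λ z → + 4 * a * (a * x * x + b * x * y) + z * (y * y)) (sym d)) (collect₁ a b c x y))
  swap : ∀ a b c x y → + 4 * c * (c * y * y + b * y * x + a * x * x)
    ≡ + 4 * c * (a * x * x + b * x * y + c * y * y)
  swap = solve-∀
  4ca : ∀ a c → + 4 * c * a ≡ + 4 * a * c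
  4ca = solve-∀
  poly₂ : ∀ a b c x y → + 4 * a * c ≡ + 71 + b * b → let u = + 2 * c * y + b * x in
    u * u + + 71 * (x * x) ≡ + 4 * c * (a * x * x + b * x * y + c * y * y)
  poly₂ a b c x y d = trans (poly₁ c b a y x (trans (4ca a c) d)) (swap a b c x y)

Q₇₁ : Point → ℤ
Q₇₁ = eval (diagonal 70)

-- `pulled` says that x² + 71 y² becomes M g times the form along Λ U. The factor g is the one by
-- which q ↦ q^g multiplies exponents, so exponent n corresponds to x² + 71 y² = M n; V and the
-- lattice coordinates invert U and Λ.
theta-rep : ∀ a b c → + 4 * + a * + c ≡ + 71 + + b * + b →
  ∀ h g .{{_ : NonZero h}} .{{_ : NonZero g}} c₀ U V → V ⊡ U ≡ identity → U ⊡ V ≡ identity →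
  ∀ M .{{_ : NonZero M}} → pull (diagonal 70) (latticeMatrix h g c₀ ⊡ U) ≡ scale (+ M * + g) (qf (+ a) (+ b) (+ c)) →
  ∀ n → substPow g ⟪ a , b , c ⟫ n ≡ rep Q₇₁ (M ℕ.* n) (lattice h g c₀)
theta-rep a b c disc h g c₀ U V VU UV M pulled n = trans source
  (rep-push {Q₇₁} {R′} {lattice h g c₀} {λ _ → + 1} {0} {M} X Y n (act (Λ ⊡ U)) (act V ∘ latticeCoordinates h g c₀)
    (diagonal-definite 70) bound form′
    (λ p → trans (cong (lattice h g c₀) (sym (act-⊡ Λ U p))) (lattice-on h g c₀ (act U p)))
    (λ p → trans (cong (act V ∘ latticeCoordinates h g c₀) (sym (act-⊡ Λ U p)))
                 (trans (cong (act V) (lattice-inverse h g c₀ (act U p))) (act-inverse V U VU p)))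
    support)
  where
  R R′ : Point → ℤ
  R = eval (qf (+ a) (+ b) (+ c))
  R′ p = + g * R p
  Λ : Matrix
  Λ = latticeMatrix h g c₀
  N X Y : ℕ
  N = n / g
  X = 4 ℕ.* c ℕ.* N
  Y = 4 ℕ.* a ℕ.* N
  exact : ∀ p → R′ p ≡ + n → n % g ≡ 0 × R p ≡ + N
  exact p eq = trans (cong (_%ℕ g) eq′) (proj₁ (%ℕ-multiple g (R p)))
             , sym (trans (cong (_/ℕ g) eq′) (proj₂ (%ℕ-multiple g (R p))))
    where
    eq′ : + n ≡ R p * + g
    eq′ = trans (sym eq) (ℤ.*-comm (+ g) (R p))
  bound : ∀ p → R′ p ≡ + n → InRect X Y p
  bound p eq = theta-bound a b c disc N p (proj₂ (exact p eq))
  source : substPow g ⟪ a , b , c ⟫ n ≡ ∑ (rect X Y) (λ p → + 1 * ind (R′ p ≟ + n))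
  source with (n % g) ≡ᵇ 0 in eq
  ... | true  = trans (theta-sum a b c N) (∑-cong (rect X Y) (λ p → trans (ind-⇔ (R p ≟ + N) (R′ p ≟ + n) (up p) (λ e → proj₂ (exact p e)))
                  (sym (ℤ.*-identityˡ (ind (R′ p ≟ + n))))))
    where
    up : ∀ p → R p ≡ + N → R′ p ≡ + n
    up p e = trans (cong (_*_ (+ g)) e) (trans (ℤ.*-comm (+ g) (+ N)) (sym (divisible g (+ n) eq)))
  ... | false = sym (trans (∑-cong (rect X Y) (λ p → cong (_*_ (+ 1)) (ind-no (R′ p ≟ + n) (never p)))) (∑-0 (rect X Y)))
    where
    never : ∀ p → ¬ (R′ p ≡ + n)
    never p e with () ← trans (sym eq) (cong (_≡ᵇ 0) (proj₁ (exact p e)))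
  form′ : ∀ p → Q₇₁ (act (Λ ⊡ U) p) ≡ + 0 + + M * R′ p
  form′ p = trans (eval-pull (diagonal 70) (Λ ⊡ U) p) (trans (cong (λ z → eval z p) pulled)
    (trans (eval-scale (+ M * + g) (qf (+ a) (+ b) (+ c)) p) (trans (ℤ.*-assoc (+ M) (+ g) (R p)) (sym (ℤ.+-identityˡ _)))))
  support : ∀ p → lattice h g c₀ p ≡ + 0 ⊎ act (Λ ⊡ U) (act V (latticeCoordinates h g c₀ p)) ≡ p
  support p with lattice-support h g c₀ p
  ... | inj₁ z  = inj₁ z
  ... | inj₂ eq = inj₂ (trans (sym (act-⊡ Λ U (act V q))) (trans (cong (act Λ) (act-inverse U V UV q)) eq))
    where q = latticeCoordinates h g c₀ p

-- Products of two one-dimensional theta series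

⨁ : ∀ {A : Set} → List A → (A → PS) → PS
⨁ xs F n = ∑ xs (λ x → F x n)

⨁-cong : ∀ {A : Set} (xs : List A) {F G : A → PS} → (∀ x → F x ≈ G x) → ⨁ xs F ≈ ⨁ xs G
⨁-cong xs p .at n = ∑-cong xs (λ x → p x .at n)

⨁-⊛ : ∀ {A : Set} (xs : List A) F g → ⨁ xs F ⊛ g ≈ ⨁ xs (λ x → F x ⊛ g)
⨁-⊛ []       F g = mk λ n → trans (⊛-cong~ {g = g} n (λ i _ → sym (𝟘-at i)) (λ _ _ → refl)) (trans (⊛-zeroˡ g .at n) (𝟘-at n))
⨁-⊛ (x ∷ xs) F g = ≈-trans (⊛-⊕-distribʳ g (F x) (⨁ xs F)) (⊕-congˡ (F x ⊛ g) (⨁-⊛ xs F g))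

⊛-⨁ : ∀ {A : Set} (xs : List A) F g → g ⊛ ⨁ xs F ≈ ⨁ xs (λ x → g ⊛ F x)
⊛-⨁ xs F g = ≈-trans (⊛-≈-comm g (⨁ xs F)) (≈-trans (⨁-⊛ xs F g) (⨁-cong xs (λ x → ⊛-≈-comm (F x) g)))

substPow-⨁ : ∀ {A : Set} k .{{_ : NonZero k}} (xs : List A) F → substPow k (⨁ xs F) ≈ ⨁ xs (λ x → substPow k (F x))
substPow-⨁ k xs F .at n with (n % k) ≡ᵇ 0
... | true  = refl
... | false = sym (∑-0 xs)

∑-intRange-suc : ∀ n (φ : ℤ → ℤ) → ∑ (intRange (suc n)) φ ≡ ∑ (intRange n) φ + (φ (+ suc n) + φ -[1+ n ])
∑-intRange-suc n φ = trans (∑-map (upTo (suc (2 ℕ.* suc n))) shifted φ)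
  (trans (cong (λ l → ∑ (upTo (suc l)) (φ ∘ shifted)) (double n))
  (trans (∑-upTo-suc (suc (suc (2 ℕ.* n))) (φ ∘ shifted))
  (trans (cong (_+_ (φ -[1+ n ])) (trans (∑-upTo-last (suc (2 ℕ.* n)) (φ ∘ shifted ∘ suc))
            (cong₂ _+_ (trans (∑-cong (upTo (suc (2 ℕ.* n))) (λ i → cong φ (middle i))) (sym (∑-map (upTo (suc (2 ℕ.* n))) (λ i → + i - + n) φ)))
                         (cong φ top))))
         (regroup (φ -[1+ n ]) (∑ (intRange n) φ) (φ (+ suc n))))))
  where
  shifted : ℕ → ℤ
  shifted i = + i - + suc n
  double : ∀ n → 2 ℕ.* suc n ≡ suc (suc (2 ℕ.* n))
  double = ℕ-solve-∀
  middle : ∀ i → + suc i - + suc n ≡ + i - + n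
  middle i = poly (+ i) (+ n)
    where
    poly : ∀ i n → (+ 1 + i) - (+ 1 + n) ≡ i - n
    poly = solve-∀
  top : + suc (suc (2 ℕ.* n)) - + suc n ≡ + suc n
  top = trans (cong (λ z → + suc (suc z) - + suc n) (cong (n ℕ.+_) (ℕ.+-identityʳ n))) (poly (+ n))
    where
    poly : ∀ n → (+ 1 + (+ 1 + (n + n))) - (+ 1 + n) ≡ + 1 + n
    poly = solve-∀
  regroup : ∀ a b c → a + (b + c) ≡ b + (c + a)
  regroup = solve-∀

zsum-⨁ : ∀ N Φ → zsum N Φ ≈ ⨁ (intRange N) Φ
zsum-⨁ zero    Φ .at n = sym (ℤ.+-identityʳ _)
zsum-⨁ (suc N) Φ .at n = trans (cong (_+ (Φ (+ suc N) n + Φ -[1+ N ] n)) (zsum-⨁ N Φ .at n)) (sym (∑-intRange-suc N (λ j → Φ j n)))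

alt≈const : ∀ n → alt n ≈ const (sg n)
alt≈const zero    = ≈-refl
alt≈const (suc n) .at zero    = cong -_ (alt≈const n .at 0)
alt≈const (suc n) .at (suc i) = cong -_ (alt≈const n .at (suc i))

τterm≈ : ∀ k b b′ j → τterm k b b′ j ≈ sgn j · mono (ex k b b′ j)
τterm≈ k b b′ j = ≈-trans (⊛-congʳ (mono (ex k b b′ j)) (alt≈const ∣ j ∣)) (const-⊛ (sgn j) (mono (ex k b b′ j)))

mono-ind : ∀ m n → mono m n ≡ ind (+ m ≟ + n)
mono-ind m n = go (m ≡ᵇ n) refl
  where
  go : ∀ b → (m ≡ᵇ n) ≡ b → mono m n ≡ ind (+ m ≟ + n)
  go true  eq = trans (cong (λ b → if b then + 1 else + 0) eq) (sym (ind-yes (+ m ≟ + n) (cong +_ (ℕ.≡ᵇ⇒≡ m n (subst T (sym eq) _)))))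
  go false eq = trans (cong (λ b → if b then + 1 else + 0) eq) (sym (ind-no (+ m ≟ + n) (λ p → subst T eq (ℕ.≡⇒≡ᵇ m n (ℤ.+-injective p)))))

-- Exponents are at least |j|, so both theta series may be cut at |j| ≤ n when coefficient n is
-- read.
τ-product : ∀ k b b′ k′ c c′ s t .{{_ : NonZero t}} n →
  (mono s ⊛ (τ k (suc b) (suc b′) ⊛ substPow t (τ k′ (suc c) (suc c′)))) n
    ≡ ∑ (rect n n) (λ p → sgn (proj₁ p) * sgn (proj₂ p)
        * ind (+ s + (+ ex k (suc b) (suc b′) (proj₁ p) + + t * + ex k′ (suc c) (suc c′) (proj₂ p)) ≟ + n))
τ-product k b b′ k′ c c′ s t n = begin′
  (mono s ⊛ (τ k (suc b) (suc b′) ⊛ substPow t (τ k′ (suc c) (suc c′)))) n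
    ≡⟨ ~-⊛ {mono s} {mono s} {τ k (suc b) (suc b′) ⊛ substPow t (τ k′ (suc c) (suc c′))} {⨁ I Φ ⊛ substPow t (⨁ I Ψ)} (λ _ _ → refl)
         (~-⊛ {τ k (suc b) (suc b′)} {⨁ I Φ} {substPow t (τ k′ (suc c) (suc c′))} {substPow t (⨁ I Ψ)}
            (finite k b b′) (substPow-~ t (finite k′ c c′))) n ℕ.≤-refl ⟩
  (mono s ⊛ (⨁ I Φ ⊛ substPow t (⨁ I Ψ))) n
    ≡⟨ expand .at n ⟩
  ∑ I (λ i → ∑ I (λ j → (mono s ⊛ (Φ i ⊛ substPow t (Ψ j))) n))
    ≡⟨ ∑-cong I (λ i → ∑-cong I (λ j → trans (term i j .at n) (cong (_*_ (sgn i * sgn j)) (trans (mono-ind _ n) (cong (λ z → ind (z ≟ + n)) (cast i j)))))) ⟩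
  ∑ I (λ i → ∑ I (λ j → sgn i * sgn j * ind (+ s + (+ e i + + t * + e′ j) ≟ + n)))
    ≡⟨ sym (∑-cartesianProduct I I (λ p → sgn (proj₁ p) * sgn (proj₂ p) * ind (+ s + (+ e (proj₁ p) + + t * + e′ (proj₂ p)) ≟ + n))) ⟩
  ∑ (rect n n) (λ p → sgn (proj₁ p) * sgn (proj₂ p) * ind (+ s + (+ e (proj₁ p) + + t * + e′ (proj₂ p)) ≟ + n)) ∎′
  where
  open ≡-Reasoning renaming (begin_ to begin′_; _∎ to _∎′)
  I : List ℤ
  I = intRange n
  Φ Ψ : ℤ → PS
  Φ = τterm k (suc b) (suc b′)
  Ψ = τterm k′ (suc c) (suc c′)
  e e′ : ℤ → ℕ
  e  = ex k (suc b) (suc b′)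
  e′ = ex k′ (suc c) (suc c′)
  finite : ∀ k b b′ → τ k (suc b) (suc b′) ~[ n ] ⨁ I (τterm k (suc b) (suc b′))
  finite k b b′ i i≤n = trans (sym (zsum~limZ n (τterm k (suc b) (suc b′)) (Ord-τterm k b b′) i i≤n)) (zsum-⨁ n (τterm k (suc b) (suc b′)) .at i)
  expand : mono s ⊛ (⨁ I Φ ⊛ substPow t (⨁ I Ψ)) ≈ ⨁ I (λ i → ⨁ I (λ j → mono s ⊛ (Φ i ⊛ substPow t (Ψ j))))
  expand = ≈-trans (⊛-congˡ (mono s) (≈-trans (⊛-congˡ (⨁ I Φ) (substPow-⨁ t I Ψ)) (⨁-⊛ I Φ (⨁ I (λ j → substPow t (Ψ j))))))
    (≈-trans (⊛-⨁ I (λ i → Φ i ⊛ ⨁ I (λ j → substPow t (Ψ j))) (mono s))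
      (⨁-cong I (λ i → ≈-trans (⊛-congˡ (mono s) (⊛-⨁ I (λ j → substPow t (Ψ j)) (Φ i))) (⊛-⨁ I (λ j → Φ i ⊛ substPow t (Ψ j)) (mono s)))))
  term : ∀ i j → mono s ⊛ (Φ i ⊛ substPow t (Ψ j)) ≈ (sgn i * sgn j) · mono (s ℕ.+ (e i ℕ.+ t ℕ.* e′ j))
  term i j = begin
    mono s ⊛ (Φ i ⊛ substPow t (Ψ j))
      ≈⟨ ⊛-congˡ (mono s) (⊛-cong (≈-trans (τterm≈ k (suc b) (suc b′) i) (≈-sym (const-⊛ (sgn i) (mono (e i)))))
           (≈-trans (substPow-cong t (τterm≈ k′ (suc c) (suc c′) j)) (≈-trans (substPow-· t (sgn j) (mono (e′ j)))
             (≈-trans (mk λ n → cong (_*_ (sgn j)) (substPow-mono t (e′ j) .at n)) (≈-sym (const-⊛ (sgn j) (mono (t ℕ.* e′ j)))))))) ⟩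
    mono s ⊛ (const (sgn i) ⊛ mono (e i) ⊛ (const (sgn j) ⊛ mono (t ℕ.* e′ j)))
      ≈⟨ solve 5 (λ m a x b y → m :* (a :* x :* (b :* y)) := a :* (b :* (m :* (x :* y)))) ≈-refl
           (mono s) (const (sgn i)) (mono (e i)) (const (sgn j)) (mono (t ℕ.* e′ j)) ⟩
    const (sgn i) ⊛ (const (sgn j) ⊛ (mono s ⊛ (mono (e i) ⊛ mono (t ℕ.* e′ j))))
      ≈⟨ ⊛-congˡ (const (sgn i)) (⊛-congˡ (const (sgn j)) (≈-trans (⊛-congˡ (mono s) (mono-+ (e i) (t ℕ.* e′ j))) (mono-+ s (e i ℕ.+ t ℕ.* e′ j)))) ⟩
    const (sgn i) ⊛ (const (sgn j) ⊛ mono (s ℕ.+ (e i ℕ.+ t ℕ.* e′ j)))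
      ≈⟨ ≈-trans (const-⊛ (sgn i) (const (sgn j) ⊛ mono (s ℕ.+ (e i ℕ.+ t ℕ.* e′ j))))
           (mk λ n → trans (cong (_*_ (sgn i)) (const-⊛-at (sgn j) (mono (s ℕ.+ (e i ℕ.+ t ℕ.* e′ j))) n))
                           (sym (ℤ.*-assoc (sgn i) (sgn j) (mono (s ℕ.+ (e i ℕ.+ t ℕ.* e′ j)) n)))) ⟩
    (sgn i * sgn j) · mono (s ℕ.+ (e i ℕ.+ t ℕ.* e′ j)) ∎
  cast : ∀ i j → + (s ℕ.+ (e i ℕ.+ t ℕ.* e′ j)) ≡ + s + (+ e i + + t * + e′ j)
  cast i j = trans (ℤ.pos-+ s _) (cong (_+_ (+ s)) (trans (ℤ.pos-+ (e i) _) (cong (_+_ (+ e i)) (ℤ.pos-* t (e′ j)))))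

tp-pos : ∀ n → + 2 * + tp n ≡ + n * (+ n - + 1)
tp-pos n = trans (poly₁ (+ tp n) (+ n)) (trans (cong (_- + n) (sym (trans (sym (ℤ.pos-* n n)) (trans (cong +_ (tp-square n))
  (trans (ℤ.pos-+ (tp n ℕ.+ tp n) n) (cong (_+ + n) (ℤ.pos-+ (tp n) (tp n)))))))) (poly₂ (+ n)))
  where
  poly₁ : ∀ t n → + 2 * t ≡ t + t + n - n
  poly₁ = solve-∀
  poly₂ : ∀ n → n * n - n ≡ n * (n - + 1)
  poly₂ = solve-∀

ex-double : ∀ k b b′ → b ℕ.+ b′ ≡ k → ∀ j → + 2 * + ex k b b′ j ≡ + k * (j * (j - + 1)) + + 2 * + b * j
ex-double k b b′ b+b′ (+ n) = trans (cong (_*_ (+ 2)) (trans (ℤ.pos-+ (k ℕ.* tp n) (b ℕ.* n)) (cong₂ _+_ (ℤ.pos-* k (tp n)) (ℤ.pos-* b n))))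
  (trans (poly (+ k) (+ b) (+ tp n) (+ n)) (cong (λ z → + k * z + + 2 * + b * + n) (tp-pos n)))
  where
  poly : ∀ k b t n → + 2 * (k * t + b * n) ≡ k * (+ 2 * t) + + 2 * b * n
  poly = solve-∀
ex-double k b b′ refl -[1+ n ] = trans (cong (_*_ (+ 2)) (trans (ℤ.pos-+ (k ℕ.* tp N) (b′ ℕ.* N)) (cong₂ _+_ (ℤ.pos-* k (tp N)) (ℤ.pos-* b′ N))))
  (trans (poly₁ (+ k) (+ b′) (+ tp N) (+ N)) (trans (cong (λ z → + k * z + + 2 * + b′ * + N) (tp-pos N)) (poly₂ (+ b) (+ b′) (+ N))))
  where
  N = suc n
  poly₁ : ∀ k b t n → + 2 * (k * t + b * n) ≡ k * (+ 2 * t) + + 2 * b * n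
  poly₁ = solve-∀
  poly₂ : ∀ b b′ N → (b + b′) * (N * (N - + 1)) + + 2 * b′ * N
                    ≡ (b + b′) * ((- N) * ((- N) - + 1)) + + 2 * b * (- N)
  poly₂ = solve-∀

-- The data completing the square: 2 M′ ex(j) + r² = (m j + r)².
record Square (k b b′ M′ m : ℕ) (r : ℤ) : Set where
  constructor square
  field
    sum  : b ℕ.+ b′ ≡ k
    quad : + m * + m ≡ + M′ * + k
    lin  : + 2 * + m * r ≡ + M′ * (+ 2 * + b - + k)

complete : ∀ {k b b′ M′ m r} → Square k b b′ M′ m r →
  ∀ j → (+ m * j + r) * (+ m * j + r) ≡ r * r + + M′ * (+ 2 * + ex k b b′ j)
complete {k} {b} {b′} {M′} {m} {r} (square s q l) j = trans (poly₁ (+ m) j r)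
  (trans (cong₂ (λ x y → x * (j * j) + y * j + r * r) q l)
  (trans (poly₂ (+ M′) (+ k) (+ b) j r) (cong (λ z → r * r + + M′ * z) (sym (ex-double k b b′ s j)))))
  where
  poly₁ : ∀ m j r → (m * j + r) * (m * j + r) ≡ m * m * (j * j) + + 2 * m * r * j + r * r
  poly₁ = solve-∀
  poly₂ : ∀ M k b j r → M * k * (j * j) + M * (+ 2 * b - k) * j + r * r
                        ≡ r * r + M * (k * (j * (j - + 1)) + + 2 * b * j)
  poly₂ = solve-∀

signs : (m m′ : ℕ) .{{_ : NonZero m}} .{{_ : NonZero m′}} → ℤ → ℤ → Point → ℤ
signs m m′ r r′ (x , y) = progressionSign m r x * progressionSign m′ r′ y

signs-periodic : ∀ m m′ .{{_ : NonZero m}} .{{_ : NonZero m′}} r r′ s t {P} → P ≡ s ℕ.* 2 ℕ.* m → P ≡ t ℕ.* 2 ℕ.* m′ → Periodic P (signs m m′ r r′)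
signs-periodic m m′ r r′ s t {P} P≡ P≡′ .shift x y k l = cong₂ _*_
  (trans (cong (λ z → progressionSign m r (x + + z * k)) P≡) (progressionSign-periodic m s r x k))
  (trans (cong (λ z → progressionSign m′ r′ (y + + z * l)) P≡′) (progressionSign-periodic m′ t r′ y l))

-- With x = m i + r and y = m′ j + r′ the two completed squares add up to x² + (u + 1) y² = κ₀ + M
-- (s + e + t e′). `ratio` matches the scales of the two squares, and `const≡` balances r and r′
-- against the shift q^s.
product-rep : ∀ {k b b′ k′ c c′ M₁ M₂ m m′ r r′} .{{_ : NonZero m}} .{{_ : NonZero m′}} →
  Square k (suc b) (suc b′) M₁ m r → Square k′ (suc c) (suc c′) M₂ m′ r′ →
  ∀ M κ₀ s t u .{{_ : NonZero M}} .{{_ : NonZero t}} → + M ≡ + 2 * + M₁ → + suc u * (+ M₂ * + 2) ≡ + M * + t →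
  r * r + + suc u * (r′ * r′) ≡ + κ₀ + + M * + s →
  ∀ n → (mono s ⊛ (τ k (suc b) (suc b′) ⊛ substPow t (τ k′ (suc c) (suc c′)))) n ≡ rep (eval (diagonal u)) (κ₀ ℕ.+ M ℕ.* n) (signs m m′ r r′)
product-rep {k} {b} {b′} {k′} {c} {c′} {M₁} {M₂} {m} {m′} {r} {r′} sq sq′ M κ₀ s t@(suc t-1) u M≡ ratio const≡ n =
  trans (τ-product k b b′ k′ c c′ s t n)
  (rep-push {eval (diagonal u)} {R} {signs m m′ r r′} {λ p → sgn (proj₁ p) * sgn (proj₂ p)} {κ₀} {M} n n n φ ψ
    (diagonal-definite u) bound form′
    (λ { (i , j) → cong₂ _*_ (progressionSign-on m r i) (progressionSign-on m′ r′ j) })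
    (λ { (i , j) → cong₂ _,_ (progressionSign-inverse m r i) (progressionSign-inverse m′ r′ j) })
    support)
  where
  e e′ : ℤ → ℕ
  e  = ex k (suc b) (suc b′)
  e′ = ex k′ (suc c) (suc c′)
  R : Point → ℤ
  R (i , j) = + s + (+ e i + + t * + e′ j)
  φ ψ : Point → Point
  φ (i , j) = + m * i + r , + m′ * j + r′
  ψ (x , y) = (x - r) /ℕ m , (y - r′) /ℕ m′
  bound : ∀ p → R p ≡ + n → InRect n n p
  bound (i , j) eq = ℕ.≤-trans (∣j∣≤ex k b b′ i) (ℕ.≤-trans (ℕ.m≤m+n (e i) (t ℕ.* e′ j)) total)
                   , ℕ.≤-trans (∣j∣≤ex k′ c c′ j) (ℕ.≤-trans (ℕ.m≤m+n (e′ j) (t-1 ℕ.* e′ j)) (ℕ.≤-trans (ℕ.m≤n+m (t ℕ.* e′ j) (e i)) total))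
    where
    total : e i ℕ.+ t ℕ.* e′ j ≤ n
    total = ℕ.≤-trans (ℕ.m≤n+m _ s) (ℕ.≤-reflexive (ℤ.+-injective (trans (trans (ℤ.pos-+ s _) (cong (_+_ (+ s)) (trans (ℤ.pos-+ (e i) _) (cong (_+_ (+ e i)) (ℤ.pos-* t (e′ j)))))) eq)))
  form′ : ∀ p → eval (diagonal u) (φ p) ≡ + κ₀ + + M * R p
  form′ (i , j) = trans (diagonal-eval u (+ m * i + r) (+ m′ * j + r′))
    (trans (cong₂ (λ x y → x + + suc u * y) (complete sq i) (complete sq′ j))
    (trans (poly₁ (r * r) (r′ * r′) (+ M₁) (+ M₂) (+ suc u) (+ e i) (+ e′ j))
    (trans (cong₂ (λ x y → x + y) const≡ (cong₂ (λ x y → x * + e i + y * + e′ j) (sym M≡) ratio))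
           (poly₂ (+ κ₀) (+ M) (+ s) (+ t) (+ e i) (+ e′ j)))))
    where
    poly₁ : ∀ ρ ρ′ M₁ M₂ u e e′ → ρ + M₁ * (+ 2 * e) + u * (ρ′ + M₂ * (+ 2 * e′))
      ≡ ρ + u * ρ′ + (+ 2 * M₁ * e + u * (M₂ * + 2) * e′)
    poly₁ = solve-∀
    poly₂ : ∀ κ M s t e e′ → κ + M * s + (M * e + M * t * e′) ≡ κ + M * (s + (e + t * e′))
    poly₂ = solve-∀
  support : ∀ p → signs m m′ r r′ p ≡ + 0 ⊎ φ (ψ p) ≡ p
  support (x , y) with progressionSign-support m r x | progressionSign-support m′ r′ y
  ... | inj₁ z | _      = inj₁ (trans (cong (_* progressionSign m′ r′ y) z) (ℤ.*-zeroˡ (progressionSign m′ r′ y)))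
  ... | inj₂ _ | inj₁ z = inj₁ (trans (cong (_*_ (progressionSign m r x)) z) (ℤ.*-zeroʳ (progressionSign m r x)))
  ... | inj₂ p | inj₂ q = inj₂ (cong₂ _,_ p q)

signChanges : List (Automorphism Q₇₁)
signChanges =
    automorphism {diagonal 70} (mat (+ 1) (+ 0) (+ 0) (+ 1)) (mat (+ 1) (+ 0) (+ 0) (+ 1)) refl refl refl
  ∷ automorphism {diagonal 70} (mat (- + 1) (+ 0) (+ 0) (+ 1)) (mat (- + 1) (+ 0) (+ 0) (+ 1)) refl refl refl
  ∷ automorphism {diagonal 70} (mat (+ 1) (+ 0) (+ 0) (- + 1)) (mat (+ 1) (+ 0) (+ 0) (- + 1)) refl refl refl
  ∷ automorphism {diagonal 70} (mat (- + 1) (+ 0) (+ 0) (- + 1)) (mat (- + 1) (+ 0) (+ 0) (- + 1)) refl refl refl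
  ∷ []

-- The cross terms of the expanded squares carry the factor 2, so classes modulo 2P determine the
-- form modulo 4P. This is why the checks run modulo M / 2 only.
Q₇₁-periodic : ∀ P x y k l → ∃ λ t →
  Q₇₁ (x + + (2 ℕ.* P) * k , y + + (2 ℕ.* P) * l) ≡ Q₇₁ (x , y) + t * + (4 ℕ.* P)
Q₇₁-periodic P x y k l = x * k + + P * k * k + + 71 * (y * l + + P * l * l)
  , trans (cong (λ z → Q₇₁ (x + z * k , y + z * l)) (ℤ.pos-* 2 P))
    (trans (poly (+ P) x y k l) (cong (λ z → Q₇₁ (x , y) + (x * k + + P * k * k + + 71 * (y * l + + P * l * l)) * z) (sym (ℤ.pos-* 4 P))))
  where
  poly : ∀ P x y k l →
    + 1 * (x + + 2 * P * k) * (x + + 2 * P * k) + + 0 * (x + + 2 * P * k) * (y + + 2 * P * l)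
      + + 71 * (y + + 2 * P * l) * (y + + 2 * P * l)
    ≡ + 1 * x * x + + 0 * x * y + + 71 * y * y
      + (x * k + P * k * k + + 71 * (y * l + P * l * l)) * (+ 4 * P)
  poly = solve-∀

Weights : Set
Weights = List (ℤ × (Point → ℤ))

combination : Weights → Point → ℤ
combination ws p = ∑ ws (λ cw → proj₁ cw * proj₂ cw p)

combination-periodic : ∀ {P} ws → All (λ cw → Periodic P (proj₂ cw)) ws → Periodic P (combination ws)
combination-periodic []       []        .shift x y k l = refl
combination-periodic (w ∷ ws) (pw ∷ ps) .shift x y k l =
  cong₂ (λ u v → proj₁ w * u + v) (pw .shift x y k l) (combination-periodic ws ps .shift x y k l)

rep-combination : ∀ Q K ws → rep Q K (combination ws) ≡ ∑ ws (λ cw → proj₁ cw * rep Q K (proj₂ cw))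
rep-combination Q K []       = rep-0 Q K (λ _ → + 0) (λ _ _ → refl)
rep-combination Q K (w ∷ ws) = trans (rep-+ Q K (λ p → proj₁ w * proj₂ w p) (combination ws))
  (cong₂ _+_ (rep-* Q K (proj₁ w) (proj₂ w)) (rep-combination Q K ws))

substPow-1 : ∀ f → substPow 1 f ≈ f
substPow-1 f .at n = cong₂ (λ a b → if a ≡ᵇ 0 then f b else + 0) (ℕ.n%1≡0 n) (ℕ.n/1≡n n)

-- The Eisenstein form: v² + 3 x² = 4 (x² + x k + k²) for v = x + 2 k

Fω : Form
Fω = qf (+ 4) (+ 4) (+ 4)

Fω-definite : Definite (eval Fω)
Fω-definite K (x , k) eq = proj₂ (square-bound 2 K (x + + 2 * k) x (trans (poly₁ x k) eq))
                         , proj₂ (square-bound 2 K (k + + 2 * x) k (trans (poly₂ x k) eq))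
  where
  poly₁ : ∀ x k → (x + + 2 * k) * (x + + 2 * k) + + 3 * (x * x) ≡ + 4 * x * x + + 4 * x * k + + 4 * k * k
  poly₁ = solve-∀
  poly₂ : ∀ x k → (k + + 2 * x) * (k + + 2 * x) + + 3 * (k * k) ≡ + 4 * x * x + + 4 * x * k + + 4 * k * k
  poly₂ = solve-∀

Fω-periodic : ∀ x y k l → ∃ λ t → eval Fω (x + + 60 * k , y + + 60 * l) ≡ eval Fω (x , y) + t * + 120
Fω-periodic x y k l =
  + 2 * (+ 2 * x * k + x * l + y * k + + 2 * y * l) + + 120 * (k * k + k * l + l * l) , poly x y k l
  where
  poly : ∀ x y k l → + 4 * (x + + 60 * k) * (x + + 60 * k) + + 4 * (x + + 60 * k) * (y + + 60 * l)
      + + 4 * (y + + 60 * l) * (y + + 60 * l)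
    ≡ + 4 * x * x + + 4 * x * y + + 4 * y * y
      + (+ 2 * (+ 2 * x * k + x * l + y * k + + 2 * y * l) + + 120 * (k * k + k * l + l * l)) * + 120
  poly = solve-∀

-- The six units of ℤ[ω], and each of them composed with a reflection: all twelve automorphisms of
-- x² + x k + k².
units : List (Automorphism (eval Fω))
units =
    automorphism {Fω} (mat (+ 1) (+ 0) (+ 0) (+ 1)) (mat (+ 1) (+ 0) (+ 0) (+ 1)) refl refl refl
  ∷ automorphism {Fω} (mat (+ 0) (+ 1) (+ 1) (+ 0)) (mat (+ 0) (+ 1) (+ 1) (+ 0)) refl refl refl
  ∷ automorphism {Fω} (mat (+ 1) (+ 1) (- + 1) (+ 0)) (mat (+ 0) (- + 1) (+ 1) (+ 1)) refl refl refl
  ∷ automorphism {Fω} (mat (- + 1) (+ 0) (+ 1) (+ 1)) (mat (- + 1) (+ 0) (+ 1) (+ 1)) refl refl refl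
  ∷ automorphism {Fω} (mat (+ 0) (+ 1) (- + 1) (- + 1)) (mat (- + 1) (- + 1) (+ 1) (+ 0)) refl refl refl
  ∷ automorphism {Fω} (mat (- + 1) (- + 1) (+ 0) (+ 1)) (mat (- + 1) (- + 1) (+ 0) (+ 1)) refl refl refl
  ∷ automorphism {Fω} (mat (- + 1) (+ 0) (+ 0) (- + 1)) (mat (- + 1) (+ 0) (+ 0) (- + 1)) refl refl refl
  ∷ automorphism {Fω} (mat (+ 0) (- + 1) (- + 1) (+ 0)) (mat (+ 0) (- + 1) (- + 1) (+ 0)) refl refl refl
  ∷ automorphism {Fω} (mat (- + 1) (- + 1) (+ 1) (+ 0)) (mat (+ 0) (+ 1) (- + 1) (- + 1)) refl refl refl
  ∷ automorphism {Fω} (mat (+ 1) (+ 0) (- + 1) (- + 1)) (mat (+ 1) (+ 0) (- + 1) (- + 1)) refl refl refl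
  ∷ automorphism {Fω} (mat (+ 0) (- + 1) (+ 1) (+ 1)) (mat (+ 1) (+ 1) (- + 1) (+ 0)) refl refl refl
  ∷ automorphism {Fω} (mat (+ 1) (+ 1) (+ 0) (- + 1)) (mat (+ 1) (+ 1) (+ 0) (- + 1)) refl refl refl
  ∷ []

toEisenstein : Matrix
toEisenstein = mat (+ 1) (+ 2) (+ 1) (+ 0)

-- v² + 3 x² has only sign changes as automorphisms; the symmetry of order three appears in the
-- coordinates x, k with v = x + 2 k. These reach just the points with v ≡ x mod 2, and since 30 and
-- 10 are even, an even r - r′ puts the whole support there.
eisenstein : ∀ r r′ d → r - r′ ≡ + 2 * d → ∀ K →
  rep (eval (diagonal 2)) K (signs 30 10 r r′) ≡ rep (eval Fω) K (signs 30 10 r r′ ∘ act toEisenstein)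
eisenstein r r′ d r-r′ K = sym (trans
  (rep-push {eval (diagonal 2)} {eval Fω} {signs 30 10 r r′} {signs 30 10 r r′ ∘ act toEisenstein} {0} {1} K K K (act toEisenstein) ψ
    (diagonal-definite 2) (Fω-definite K) (λ { (x , k) → poly x k }) (λ _ → refl) (λ { (x , k) → inverseψ x k }) support)
  (cong (λ k → rep (eval (diagonal 2)) k (signs 30 10 r r′)) (ℕ.*-identityˡ K)))
  where
  ψ : Point → Point
  ψ (v , x) = x , (v - x) /ℕ 2
  poly : ∀ x k → let v = + 1 * x + + 2 * k ; x′ = + 1 * x + + 0 * k in
    + 1 * v * v + + 0 * v * x′ + + 3 * x′ * x′ ≡ + 0 + + 1 * (+ 4 * x * x + + 4 * x * k + + 4 * k * k)
  poly = solve-∀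
  first : ∀ x k → + 1 * x + + 0 * k ≡ x
  first = solve-∀
  difference : ∀ x k → + 1 * x + + 2 * k - (+ 1 * x + + 0 * k) ≡ k * + 2
  difference = solve-∀
  inverseψ : ∀ x k → ψ (act toEisenstein (x , k)) ≡ (x , k)
  inverseψ x k = cong₂ _,_ (first x k) (trans (cong (_/ℕ 2) (difference x k)) (proj₂ (%ℕ-multiple 2 k)))
  lift : ∀ v x q → v - x ≡ q * + 2 → act toEisenstein (x , q) ≡ (v , x)
  lift v x q eq = cong₂ _,_ (trans (expand v x q) (trans (cong (_+_ x) (sym eq)) (cancel v x))) (first x q)
    where
    expand : ∀ v x q → + 1 * x + + 2 * q ≡ x + q * + 2
    expand = solve-∀
    cancel : ∀ v x → x + (v - x) ≡ v
    cancel = solve-∀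
  support : ∀ p → signs 30 10 r r′ p ≡ + 0 ⊎ act toEisenstein (ψ p) ≡ p
  support (v , x) with progressionSign-support 30 r v | progressionSign-support 10 r′ x
  ... | inj₁ z | _      = inj₁ (trans (cong (_* progressionSign 10 r′ x) z) (ℤ.*-zeroˡ (progressionSign 10 r′ x)))
  ... | inj₂ _ | inj₁ z = inj₁ (trans (cong (_*_ (progressionSign 30 r v)) z) (ℤ.*-zeroʳ (progressionSign 30 r v)))
  ... | inj₂ p | inj₂ q = inj₂ (lift v x ((v - x) /ℕ 2) (trans even (cong (_* + 2) (sym (trans (cong (_/ℕ 2) even) (proj₂ (%ℕ-multiple 2 e)))))))
    where
    i = (v - r) /ℕ 30
    j = (x - r′) /ℕ 10
    e : ℤ
    e = + 15 * i - + 5 * j + d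
    poly₁ : ∀ i j r r′ → + 30 * i + r - (+ 10 * j + r′) ≡ + 30 * i - + 10 * j + (r - r′)
    poly₁ = solve-∀
    poly₂ : ∀ i j d → + 30 * i - + 10 * j + + 2 * d ≡ (+ 15 * i - + 5 * j + d) * + 2
    poly₂ = solve-∀
    even : v - x ≡ e * + 2
    even = trans (cong₂ _-_ (sym p) (sym q)) (trans (poly₁ i j r r′) (trans (cong (_+_ (+ 30 * i - + 10 * j)) r-r′) (poly₂ i j d)))

-- The scale 2 M′ is 24, 40 or 120, and r = m (2 b - k) / (2 k).
sqE : Square 3 1 2 12 6 (- + 1)
sqE = square refl refl refl

sqA : Square 5 2 3 20 10 (- + 1)
sqA = square refl refl refl

sqB : Square 5 4 1 20 10 (+ 3)
sqB = square refl refl refl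

sqC₁ : Square 15 8 7 60 30 (+ 1)
sqC₁ = square refl refl refl

sqC₂ : Square 15 13 2 60 30 (+ 11)
sqC₂ = square refl refl refl

sqD₁ : Square 15 11 4 60 30 (+ 7)
sqD₁ = square refl refl refl

sqD₂ : Square 15 14 1 60 30 (+ 13)
sqD₂ = square refl refl refl

sq₅ : Square 15 5 10 60 30 (- + 5)
sq₅ = square refl refl refl

-- These turn out to be E G, E H, E G², E H² and E(q⁵), the last of which equals E G H.
τA τB τC τD τ₅ : PS
τA = τ 5 2 3
τB = τ 5 4 1
τC = τ 15 8 7 ⊕ mono 1 ⊛ τ 15 13 2
τD = τ 15 11 4 ⊖ mono 1 ⊛ τ 15 14 1
τ₅ = τ 15 5 10

quintupleWeights : (r₁ r₂ r r₀ : ℤ) → ℤ → Weights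
quintupleWeights r₁ r₂ r r₀ ε =
    (+ 1 , signs 30 10 r₁ r ∘ act toEisenstein)
  ∷ (ε , signs 30 10 r₂ r ∘ act toEisenstein)
  ∷ (- + 1 , signs 30 10 (- + 5) r₀ ∘ act toEisenstein)
  ∷ []

quintupleWeights-periodic : ∀ r₁ r₂ r r₀ ε → Periodic 60 (combination (quintupleWeights r₁ r₂ r r₀ ε))
quintupleWeights-periodic r₁ r₂ r r₀ ε = combination-periodic (quintupleWeights r₁ r₂ r r₀ ε)
  ( periodic-act {w = signs 30 10 r₁ r} toEisenstein (signs-periodic 30 10 r₁ r 1 3 refl refl)
  ∷ periodic-act {w = signs 30 10 r₂ r} toEisenstein (signs-periodic 30 10 r₂ r 1 3 refl refl)
  ∷ periodic-act {w = signs 30 10 (- + 5) r₀} toEisenstein (signs-periodic 30 10 (- + 5) r₀ 1 3 refl refl)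
  ∷ [])

-- Two cases of the quintuple product identity, obtained by averaging over the units of ℤ[ω].
τC⊛τB : τC ⊛ τB ≈ τ₅ ⊛ τA
τC⊛τB .at n = trans (split .at n) (trans (isolate x y z total) (collect .at n))
  where
  -- 28 = 1² + 3 · 3² = 5² + 3 · 1², and 11² + 3 · 3² = 28 + 120 accounts for the factor q in front
  -- of the second term of `τC`. The coefficient 3 is the ratio of the scales 120 and 40.
  K : ℕ
  K = 28 ℕ.+ 120 ℕ.* n
  ws : Weights
  ws = quintupleWeights (+ 1) (+ 11) (+ 3) (- + 1) (+ 1)
  x y z : ℤ
  x = (mono 0 ⊛ (τ 15 8 7 ⊛ substPow 1 τB)) n
  y = (mono 1 ⊛ (τ 15 13 2 ⊛ substPow 1 τB)) n
  z = (mono 0 ⊛ (τ₅ ⊛ substPow 1 τA)) n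
  total : + 1 * x + (+ 1 * y + ((- + 1) * z + + 0)) ≡ + 0
  total = trans (cong₂ (λ a b → + 1 * a + b) (trans (product-rep sqC₁ sqB 120 28 0 1 2 refl refl refl n) (eisenstein (+ 1) (+ 3) (- + 1) refl K))
                (cong₂ (λ a b → + 1 * a + ((- + 1) * b + + 0)) (trans (product-rep sqC₂ sqB 120 28 1 1 2 refl refl refl n) (eisenstein (+ 11) (+ 3) (+ 4) refl K))
                       (trans (product-rep sq₅ sqA 120 28 0 1 2 refl refl refl n) (eisenstein (- + 5) (- + 1) (- + 2) refl K))))
    (trans (sym (rep-combination (eval Fω) K ws))
           (rep-vanish {Fω} Fω-definite 60 120 28 Fω-periodic units (combination ws) (quintupleWeights-periodic (+ 1) (+ 11) (+ 3) (- + 1) (+ 1)) refl n))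
  isolate : ∀ x y z → + 1 * x + (+ 1 * y + ((- + 1) * z + + 0)) ≡ + 0 → x + y ≡ z
  isolate x y z p = trans (poly₁ x y z) (trans (cong (_+ z) p) (ℤ.+-identityˡ z))
    where
    poly₁ : ∀ x y z → x + y ≡ + 1 * x + (+ 1 * y + ((- + 1) * z + + 0)) + z
    poly₁ = solve-∀
  split : τC ⊛ τB ≈ mono 0 ⊛ (τ 15 8 7 ⊛ substPow 1 τB) ⊕ mono 1 ⊛ (τ 15 13 2 ⊛ substPow 1 τB)
  split = ≈-trans (⊛-congˡ τC (≈-sym (substPow-1 τB)))
    (≈-trans (solve 4 (λ a m b c → (a :+ m :* b) :* c := con (+ 1) :* (a :* c) :+ m :* (b :* c)) ≈-refl (τ 15 8 7) (mono 1) (τ 15 13 2) (substPow 1 τB))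
      (⊕-congʳ (mono 1 ⊛ (τ 15 13 2 ⊛ substPow 1 τB)) (⊛-congʳ (τ 15 8 7 ⊛ substPow 1 τB) (≈-sym one≈𝟙))))
  collect : mono 0 ⊛ (τ₅ ⊛ substPow 1 τA) ≈ τ₅ ⊛ τA
  collect = ≈-trans (one-⊛ (τ₅ ⊛ substPow 1 τA)) (⊛-congˡ τ₅ (substPow-1 τA))

τD⊛τA : τD ⊛ τA ≈ τ₅ ⊛ τB
τD⊛τA .at n = trans (split .at n) (trans (isolate x y z total) (collect .at n))
  where
  -- 52 = 7² + 3 · 1² = 5² + 3 · 3², and 13² + 3 · 1² = 52 + 120 matches the factor q in `τD`.
  K : ℕ
  K = 52 ℕ.+ 120 ℕ.* n
  ws : Weights
  ws = quintupleWeights (+ 7) (+ 13) (- + 1) (+ 3) (- + 1)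
  x y z : ℤ
  x = (mono 0 ⊛ (τ 15 11 4 ⊛ substPow 1 τA)) n
  y = (mono 1 ⊛ (τ 15 14 1 ⊛ substPow 1 τA)) n
  z = (mono 0 ⊛ (τ₅ ⊛ substPow 1 τB)) n
  total : + 1 * x + ((- + 1) * y + ((- + 1) * z + + 0)) ≡ + 0
  total = trans (cong₂ (λ a b → + 1 * a + b) (trans (product-rep sqD₁ sqA 120 52 0 1 2 refl refl refl n) (eisenstein (+ 7) (- + 1) (+ 4) refl K))
                (cong₂ (λ a b → (- + 1) * a + ((- + 1) * b + + 0)) (trans (product-rep sqD₂ sqA 120 52 1 1 2 refl refl refl n) (eisenstein (+ 13) (- + 1) (+ 7) refl K))
                       (trans (product-rep sq₅ sqB 120 52 0 1 2 refl refl refl n) (eisenstein (- + 5) (+ 3) (- + 4) refl K))))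
    (trans (sym (rep-combination (eval Fω) K ws))
           (rep-vanish {Fω} Fω-definite 60 120 52 Fω-periodic units (combination ws) (quintupleWeights-periodic (+ 7) (+ 13) (- + 1) (+ 3) (- + 1)) refl n))
  isolate : ∀ x y z → + 1 * x + ((- + 1) * y + ((- + 1) * z + + 0)) ≡ + 0 → x - y ≡ z
  isolate x y z p = trans (poly₁ x y z) (trans (cong (_+ z) p) (ℤ.+-identityˡ z))
    where
    poly₁ : ∀ x y z → x - y ≡ + 1 * x + ((- + 1) * y + ((- + 1) * z + + 0)) + z
    poly₁ = solve-∀
  split : τD ⊛ τA ≈ mono 0 ⊛ (τ 15 11 4 ⊛ substPow 1 τA) ⊖ mono 1 ⊛ (τ 15 14 1 ⊛ substPow 1 τA)
  split = ≈-trans (⊛-congˡ τD (≈-sym (substPow-1 τA)))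
    (≈-trans (solve 4 (λ a m b c → (a :- m :* b) :* c := con (+ 1) :* (a :* c) :- m :* (b :* c)) ≈-refl (τ 15 11 4) (mono 1) (τ 15 14 1) (substPow 1 τA))
      (⊖-cong (⊛-congʳ (τ 15 11 4 ⊛ substPow 1 τA) (≈-sym one≈𝟙)) (≈-refl {mono 1 ⊛ (τ 15 14 1 ⊛ substPow 1 τA)})))
  collect : mono 0 ⊛ (τ₅ ⊛ substPow 1 τB) ≈ τ₅ ⊛ τB
  collect = ≈-trans (one-⊛ (τ₅ ⊛ substPow 1 τB)) (⊛-congˡ τ₅ (substPow-1 τB))

-- Ties a coefficient to the weight whose `rep` it is, so that an identity between coefficients is
-- given by a list of `Weights` with matching values.
record Value (Q : Point → ℤ) (K : ℕ) (w : Point → ℤ) : Set where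
  constructor value
  field
    number : ℤ
    equals : number ≡ rep Q K w
open Value

total : ∀ {Q K} (ws : Weights) → All (λ cw → Value Q K (proj₂ cw)) ws → ℤ
total []       []       = + 0
total (w ∷ ws) (v ∷ vs) = proj₁ w * number v + total ws vs

total≡rep : ∀ {Q K} ws (vs : All (λ cw → Value Q K (proj₂ cw)) ws) → total ws vs ≡ rep Q K (combination ws)
total≡rep {Q} {K} ws vs = trans (go ws vs) (sym (rep-combination Q K ws))
  where
  go : ∀ ws (vs : All (λ cw → Value Q K (proj₂ cw)) ws) → total ws vs ≡ ∑ ws (λ cw → proj₁ cw * rep Q K (proj₂ cw))
  go []       []       = refl
  go (w ∷ ws) (v ∷ vs) = cong₂ (λ a b → proj₁ w * a + b) (equals v) (go ws vs)

-- E G², E G H and E H² as theta series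

substPow-5-E : substPow 5 E ≈ τ₅
substPow-5-E = ≈-trans (substPow-cong 5 E≈τ) (~⇒≈ λ N i i≤N → trans
  (substPow-~ 5 (λ i i≤N → trans (sym (zsum~limZ N (τterm 3 1 2) (Ord-τterm 3 0 1) i i≤N)) (zsum-⨁ N (τterm 3 1 2) .at i)) i i≤N)
  (trans (≈-trans (substPow-⨁ 5 (intRange N) (τterm 3 1 2)) (⨁-cong (intRange N) term) .at i)
  (trans (sym (zsum-⨁ N (τterm 15 5 10) .at i)) (zsum~limZ N (τterm 15 5 10) (Ord-τterm 15 4 9) i i≤N))))
  where
  exponent : ∀ j → 5 ℕ.* ex 3 1 2 j ≡ ex 15 5 10 j
  exponent (+ n)    = poly (tp n) n
    where
    poly : ∀ t n → 5 ℕ.* (3 ℕ.* t ℕ.+ 1 ℕ.* n) ≡ 15 ℕ.* t ℕ.+ 5 ℕ.* n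
    poly = ℕ-solve-∀
  exponent -[1+ n ] = poly (tp (suc n)) (suc n)
    where
    poly : ∀ t n → 5 ℕ.* (3 ℕ.* t ℕ.+ 2 ℕ.* n) ≡ 15 ℕ.* t ℕ.+ 10 ℕ.* n
    poly = ℕ-solve-∀
  term : ∀ j → substPow 5 (τterm 3 1 2 j) ≈ τterm 15 5 10 j
  term j = ≈-trans (substPow-cong 5 (τterm≈ 3 1 2 j)) (≈-trans (substPow-· 5 (sgn j) (mono (ex 3 1 2 j)))
    (≈-trans (mk λ n → cong (_*_ (sgn j)) (≈-trans (substPow-mono 5 (ex 3 1 2 j)) (mono-≡ (exponent j)) .at n)) (≈-sym (τterm≈ 15 5 10 j))))

E⊛τ₅ : E ⊛ τ₅ ≈ τA ⊛ τB
E⊛τ₅ = ≈-trans (⊛-congˡ E (≈-sym substPow-5-E)) (≈-sym τ⊛τ)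

-- Multiplied by E `τB`, both sides become E `τ₅` `τA`: the left one because `τA` `τB` = E `τ₅`, the
-- right one by the quintuple product identity `τC⊛τB`.
E⊛G⊛G : E ⊛ G ⊛ G ≈ τC
E⊛G⊛G = inv-cancel (E ⊛ τB) refl (begin
  E ⊛ τB ⊛ (E ⊛ G ⊛ G)      ≈⟨ solve 3 (λ e b g → e :* b :* (e :* g :* g) := b :* ((e :* g) :* (e :* g))) ≈-refl E τB G ⟩
  τB ⊛ (E ⊛ G ⊛ (E ⊛ G))    ≈⟨ ⊛-congˡ τB (⊛-cong E⊛G≈τ E⊛G≈τ) ⟩
  τB ⊛ (τA ⊛ τA)            ≈⟨ solve 2 (λ a b → b :* (a :* a) := (a :* b) :* a) ≈-refl τA τB ⟩
  τA ⊛ τB ⊛ τA              ≈⟨ ⊛-congʳ τA (≈-sym E⊛τ₅) ⟩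
  E ⊛ τ₅ ⊛ τA               ≈⟨ ⊛-≈-assoc E τ₅ τA ⟩
  E ⊛ (τ₅ ⊛ τA)             ≈⟨ ⊛-congˡ E (≈-sym τC⊛τB) ⟩
  E ⊛ (τC ⊛ τB)             ≈⟨ solve 3 (λ e b c → e :* (c :* b) := e :* b :* c) ≈-refl E τB τC ⟩
  E ⊛ τB ⊛ τC               ∎)

E⊛H⊛H : E ⊛ H ⊛ H ≈ τD
E⊛H⊛H = inv-cancel (E ⊛ τA) refl (begin
  E ⊛ τA ⊛ (E ⊛ H ⊛ H)      ≈⟨ solve 3 (λ e a h → e :* a :* (e :* h :* h) := a :* ((e :* h) :* (e :* h))) ≈-refl E τA H ⟩
  τA ⊛ (E ⊛ H ⊛ (E ⊛ H))    ≈⟨ ⊛-congˡ τA (⊛-cong E⊛H≈τ E⊛H≈τ) ⟩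
  τA ⊛ (τB ⊛ τB)            ≈⟨ ⊛-≈-assoc τA τB τB ⟨
  τA ⊛ τB ⊛ τB              ≈⟨ ⊛-congʳ τB (≈-sym E⊛τ₅) ⟩
  E ⊛ τ₅ ⊛ τB               ≈⟨ ⊛-≈-assoc E τ₅ τB ⟩
  E ⊛ (τ₅ ⊛ τB)             ≈⟨ ⊛-congˡ E (≈-sym τD⊛τA) ⟩
  E ⊛ (τD ⊛ τA)             ≈⟨ solve 3 (λ e a d → e :* (d :* a) := e :* a :* d) ≈-refl E τA τD ⟩
  E ⊛ τA ⊛ τD               ∎)

E⊛G⊛H : E ⊛ G ⊛ H ≈ τ₅
E⊛G⊛H = inv-cancel E refl (begin
  E ⊛ (E ⊛ G ⊛ H)      ≈⟨ solve 3 (λ e g h → e :* (e :* g :* h) := (e :* g) :* (e :* h)) ≈-refl E G H ⟩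
  E ⊛ G ⊛ (E ⊛ H)      ≈⟨ ⊛-cong E⊛G≈τ E⊛H≈τ ⟩
  τA ⊛ τB              ≈⟨ E⊛τ₅ ⟨
  E ⊛ τ₅               ∎)

-- Numbered by the class group of discriminant -71, cyclic of order 7: θᵢ belongs to the i-th power
-- of the class of (2,1,9), up to inversion, which does not change a theta series.
θ₀ θ₁ θ₂ θ₃ : PS
θ₀ = ⟪ 1 , 1 , 18 ⟫
θ₁ = ⟪ 2 , 1 , 9 ⟫
θ₂ = ⟪ 4 , 3 , 5 ⟫
θ₃ = ⟪ 3 , 1 , 6 ⟫

-- A form of discriminant -71 reduces to one with leading coefficient M / 4 by a substitution (n , m) ↦ (k , l);
-- completing the square then embeds it into x² + 71 y² = M N as the lattice x ≡ c y mod M / 2.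

thetaValue : ∀ a b c → + 4 * + a * + c ≡ + 71 + + b * + b →
  ∀ h .{{_ : NonZero h}} c₀ U V → V ⊡ U ≡ identity → U ⊡ V ≡ identity →
  ∀ M .{{_ : NonZero M}} → pull (diagonal 70) (latticeMatrix h 1 c₀ ⊡ U) ≡ scale (+ M * + 1) (qf (+ a) (+ b) (+ c)) →
  ∀ n → Value Q₇₁ (M ℕ.* n) (lattice h 1 c₀)
thetaValue a b c disc h c₀ U V VU UV M pulled n =
  value (⟪ a , b , c ⟫ n) (trans (sym (substPow-1 ⟪ a , b , c ⟫ .at n)) (theta-rep a b c disc h 1 c₀ U V VU UV M pulled n))

-- In this and the following cases with g = 1, c solves c² ≡ -71 mod M. The lattice then carries M
-- times the form (M/4, c, (c² + 71)/M), and the choice of the root c selects the class.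
θ₃-24 : ∀ n → Value Q₇₁ (24 ℕ.* n) (lattice 12 1 (+ 1))
θ₃-24 = thetaValue 3 1 6 refl 12 (+ 1) (mat (+ 0) (+ 1) (+ 1) (+ 0)) (mat (+ 0) (+ 1) (+ 1) (+ 0)) refl refl 24 refl

θ₂-24 : ∀ n → Value Q₇₁ (24 ℕ.* n) (lattice 12 1 (+ 5))
θ₂-24 = thetaValue 4 3 5 refl 12 (+ 5) (mat (+ 0) (- + 1) (+ 1) (+ 1)) (mat (+ 1) (+ 1) (- + 1) (+ 0)) refl refl 24 refl

θ₁-40 : ∀ n → Value Q₇₁ (40 ℕ.* n) (lattice 20 1 (+ 3))
θ₁-40 = thetaValue 2 1 9 refl 20 (+ 3) (mat (+ 0) (- + 1) (+ 1) (+ 1)) (mat (+ 1) (+ 1) (- + 1) (+ 0)) refl refl 40 refl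

θ₃-40 : ∀ n → Value Q₇₁ (40 ℕ.* n) (lattice 20 1 (+ 7))
θ₃-40 = thetaValue 3 1 6 refl 20 (+ 7) (mat (+ 0) (+ 1) (+ 1) (- + 1)) (mat (+ 1) (+ 1) (+ 1) (+ 0)) refl refl 40 refl

θ₀-120 : ∀ n → Value Q₇₁ (120 ℕ.* n) (lattice 60 1 (+ 7))
θ₀-120 = thetaValue 1 1 18 refl 60 (+ 7) (mat (+ 0) (+ 1) (+ 1) (- + 3)) (mat (+ 3) (+ 1) (+ 1) (+ 0)) refl refl 120 refl

θ₁-120 : ∀ n → Value Q₇₁ (120 ℕ.* n) (lattice 60 1 (+ 13))
θ₁-120 = thetaValue 2 1 9 refl 60 (+ 13) (mat (+ 0) (+ 1) (+ 1) (- + 3)) (mat (+ 3) (+ 1) (+ 1) (+ 0)) refl refl 120 refl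

θ₃-120 : ∀ n → Value Q₇₁ (120 ℕ.* n) (lattice 60 1 (+ 17))
θ₃-120 = thetaValue 3 1 6 refl 60 (+ 17) (mat (+ 0) (- + 1) (+ 1) (+ 3)) (mat (+ 3) (+ 1) (- + 1) (+ 0)) refl refl 120 refl

θ₂-120 : ∀ n → Value Q₇₁ (120 ℕ.* n) (lattice 60 1 (+ 23))
θ₂-120 = thetaValue 4 3 5 refl 60 (+ 23) (mat (+ 1) (+ 0) (- + 2) (+ 1)) (mat (+ 1) (+ 0) (+ 2) (+ 1)) refl refl 120 refl

θ₁-48 : ∀ n → Value Q₇₁ (48 ℕ.* n) (lattice 24 1 (+ 5))
θ₁-48 = thetaValue 2 1 9 refl 24 (+ 5) (mat (+ 0) (+ 1) (+ 1) (- + 1)) (mat (+ 1) (+ 1) (+ 1) (+ 0)) refl refl 48 refl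

θ₂-48 : ∀ n → Value Q₇₁ (48 ℕ.* n) (lattice 24 1 (+ 11))
θ₂-48 = thetaValue 4 3 5 refl 24 (+ 11) (mat (+ 0) (+ 1) (+ 1) (- + 1)) (mat (+ 1) (+ 1) (+ 1) (+ 0)) refl refl 48 refl

-- The part f(n / 2) of the Hecke operator, as the coefficient of a series in q²; this is the
-- lattice with 2 ∣ y.
θ₃-48-half : ∀ n → Value Q₇₁ (48 ℕ.* n) (lattice 24 2 (+ 1))
θ₃-48-half n = value (substPow 2 θ₃ n) (theta-rep 3 1 6 refl 24 2 (+ 1)
  (mat (+ 0) (+ 1) (+ 1) (+ 0)) (mat (+ 0) (+ 1) (+ 1) (+ 0)) refl refl 48 refl n)

θ₂-48-half : ∀ n → Value Q₇₁ (48 ℕ.* n) (lattice 24 2 (+ 5))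
θ₂-48-half n = value (substPow 2 θ₂ n) (theta-rep 4 3 5 refl 24 2 (+ 5)
  (mat (+ 0) (- + 1) (+ 1) (+ 1)) (mat (+ 1) (+ 1) (- + 1) (+ 0)) refl refl 48 refl n)

24*2* : ∀ n → 24 ℕ.* (n ℕ.* 2) ≡ 48 ℕ.* n
24*2* = ℕ-solve-∀

-- The part f(2 n) of the Hecke operator: as 24 (2 n) = 48 n, it is counted on the same points as
-- the other terms of `hecke`.
θ₃-48-double : ∀ n → Value Q₇₁ (48 ℕ.* n) (lattice 12 1 (+ 1))
θ₃-48-double n = value (θ₃ (n ℕ.* 2)) (trans (θ₃-24 (n ℕ.* 2) .equals) (cong (λ K → rep Q₇₁ K (lattice 12 1 (+ 1))) (24*2* n)))

θ₂-48-double : ∀ n → Value Q₇₁ (48 ℕ.* n) (lattice 12 1 (+ 5))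
θ₂-48-double n = value (θ₂ (n ℕ.* 2)) (trans (θ₂-24 (n ℕ.* 2) .equals) (cong (λ K → rep Q₇₁ K (lattice 12 1 (+ 5))) (24*2* n)))

-- The Hecke operator T₂ applied to θ₃ - θ₂
hecke : ∀ n → θ₃ (n ℕ.* 2) - θ₂ (n ℕ.* 2) ≡ θ₂ n - θ₁ n - (substPow 2 θ₃ n - substPow 2 θ₂ n)
hecke n = isolate (θ₃ (n ℕ.* 2)) (θ₂ (n ℕ.* 2)) (substPow 2 θ₃ n) (substPow 2 θ₂ n) (θ₁ n) (θ₂ n)
  (trans (total≡rep ws vs) (rep-vanish {diagonal 70} (diagonal-definite 70) 24 48 0 (Q₇₁-periodic 12) signChanges (combination ws) (combination-periodic ws ps) refl n))
  where
  -- T₂ f has the coefficients f(2 n) + f(n / 2), because 2 splits. Its prime factors lie in the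
  -- class of (2,1,9) and the inverse class, so T₂ θᵢ = θᵢ₋₁ + θᵢ₊₁ with θ₄ = θ₃, and T₂ (θ₃ - θ₂) =
  -- θ₂ - θ₁.
  ws : Weights
  ws = (+ 1 , lattice 12 1 (+ 1)) ∷ (- + 1 , lattice 12 1 (+ 5)) ∷ (+ 1 , lattice 24 2 (+ 1)) ∷ (- + 1 , lattice 24 2 (+ 5))
     ∷ (+ 1 , lattice 24 1 (+ 5)) ∷ (- + 1 , lattice 24 1 (+ 11)) ∷ []
  vs : All (λ cw → Value Q₇₁ (48 ℕ.* n) (proj₂ cw)) ws
  vs = θ₃-48-double n ∷ θ₂-48-double n ∷ θ₃-48-half n ∷ θ₂-48-half n ∷ θ₁-48 n ∷ θ₂-48 n ∷ []
  ps : All (λ cw → Periodic 24 (proj₂ cw)) ws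
  ps = lattice-periodic 12 1 2 24 (+ 1) refl refl ∷ lattice-periodic 12 1 2 24 (+ 5) refl refl
     ∷ lattice-periodic 24 2 1 12 (+ 1) refl refl ∷ lattice-periodic 24 2 1 12 (+ 5) refl refl
     ∷ lattice-periodic 24 1 1 24 (+ 5) refl refl ∷ lattice-periodic 24 1 1 24 (+ 11) refl refl ∷ []
  isolate : ∀ a b c d e f → + 1 * a + ((- + 1) * b + (+ 1 * c + ((- + 1) * d + (+ 1 * e + ((- + 1) * f + + 0))))) ≡ + 0 →
    a - b ≡ f - e - (c - d)
  isolate a b c d e f p = trans (poly a b c d e f) (trans (cong (_+ (f - e - (c - d))) p) (ℤ.+-identityˡ _))
    where
    poly : ∀ a b c d e f → a - b ≡ + 1 * a + ((- + 1) * b + (+ 1 * c + ((- + 1) * d + (+ 1 * e + ((- + 1) * f + + 0)))))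
      + (f - e - (c - d))
    poly = solve-∀

-- E(q) E(Q) times 1, U and U² in terms of quadratic forms

infixl 7 _⊠_
_⊠_ : PS → PS → PS
f ⊠ g = f ⊛ substPow 71 g

⊠-cong : ∀ {f f′ g g′} → f ≈ f′ → g ≈ g′ → f ⊠ g ≈ f′ ⊠ g′
⊠-cong p q = ⊛-cong p (substPow-cong 71 q)

-- The shift 3 = (1 + 71) / 24 removes the offset: exponent n corresponds to x² + 71 y² = 24 n
-- exactly, as it does for the two forms.
identity₁ : (+ 2) · (mono 3 ⊛ (E ⊠ E)) ≈ θ₃ ⊖ θ₂
identity₁ .at n = trans (cong (_*_ (+ 2)) (⊛-congˡ (mono 3) (⊠-cong E≈τ E≈τ) .at n))
  (isolate (number P) (θ₃ n) (θ₂ n) (trans (total≡rep ws vs)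
    (rep-vanish {diagonal 70} (diagonal-definite 70) 12 24 0 (Q₇₁-periodic 6) signChanges (combination ws) (combination-periodic ws ps) refl n)))
  where
  ws : Weights
  ws = (+ 2 , signs 6 6 (- + 1) (- + 1)) ∷ (- + 1 , lattice 12 1 (+ 1)) ∷ (+ 1 , lattice 12 1 (+ 5)) ∷ []
  P : Value Q₇₁ (24 ℕ.* n) (signs 6 6 (- + 1) (- + 1))
  P = value ((mono 3 ⊛ (τ 3 1 2 ⊠ τ 3 1 2)) n) (product-rep sqE sqE 24 0 3 71 70 refl refl refl n)
  vs : All (λ cw → Value Q₇₁ (24 ℕ.* n) (proj₂ cw)) ws
  vs = P ∷ θ₃-24 n ∷ θ₂-24 n ∷ []
  ps : All (λ cw → Periodic 12 (proj₂ cw)) ws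
  ps = signs-periodic 6 6 (- + 1) (- + 1) 1 1 refl refl ∷ lattice-periodic 12 1 1 12 (+ 1) refl refl ∷ lattice-periodic 12 1 1 12 (+ 5) refl refl ∷ []
  isolate : ∀ a b c → + 2 * a + ((- + 1) * b + (+ 1 * c + + 0)) ≡ + 0 → + 2 * a ≡ b - c
  isolate a b c p = trans (poly a b c) (trans (cong (_+ (b - c)) p) (ℤ.+-identityˡ _))
    where
    poly : ∀ a b c → + 2 * a ≡ + 2 * a + ((- + 1) * b + (+ 1 * c + + 0)) + (b - c)
    poly = solve-∀

-- The shifts are (9 + 71) / 40 = 2 and (1 + 71 · 9) / 40 = 16. Their difference 14 is the power of
-- q inside U.
τ-identity₃ : (+ 2) · (mono 2 ⊛ (τB ⊠ τA) ⊖ mono 16 ⊛ (τA ⊠ τB)) ≈ θ₁ ⊖ θ₃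
τ-identity₃ .at n = isolate (number P) (number R) (θ₁ n) (θ₃ n) (trans (total≡rep ws vs)
    (rep-vanish {diagonal 70} (diagonal-definite 70) 20 40 0 (Q₇₁-periodic 10) signChanges (combination ws) (combination-periodic ws ps) refl n))
  where
  ws : Weights
  ws = (+ 2 , signs 10 10 (+ 3) (- + 1)) ∷ (- + 2 , signs 10 10 (- + 1) (+ 3)) ∷ (- + 1 , lattice 20 1 (+ 3)) ∷ (+ 1 , lattice 20 1 (+ 7)) ∷ []
  P : Value Q₇₁ (40 ℕ.* n) (signs 10 10 (+ 3) (- + 1))
  P = value ((mono 2 ⊛ (τB ⊠ τA)) n) (product-rep sqB sqA 40 0 2 71 70 refl refl refl n)
  R : Value Q₇₁ (40 ℕ.* n) (signs 10 10 (- + 1) (+ 3))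
  R = value ((mono 16 ⊛ (τA ⊠ τB)) n) (product-rep sqA sqB 40 0 16 71 70 refl refl refl n)
  vs : All (λ cw → Value Q₇₁ (40 ℕ.* n) (proj₂ cw)) ws
  vs = P ∷ R ∷ θ₁-40 n ∷ θ₃-40 n ∷ []
  ps : All (λ cw → Periodic 20 (proj₂ cw)) ws
  ps = signs-periodic 10 10 (+ 3) (- + 1) 1 1 refl refl ∷ signs-periodic 10 10 (- + 1) (+ 3) 1 1 refl refl
     ∷ lattice-periodic 20 1 1 20 (+ 3) refl refl ∷ lattice-periodic 20 1 1 20 (+ 7) refl refl ∷ []
  isolate : ∀ a b c d → + 2 * a + ((- + 2) * b + ((- + 1) * c + (+ 1 * d + + 0))) ≡ + 0 → + 2 * (a - b) ≡ c - d
  isolate a b c d p = trans (poly a b c d) (trans (cong (_+ (c - d)) p) (ℤ.+-identityˡ _))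
    where
    poly : ∀ a b c d → + 2 * (a - b) ≡ + 2 * a + ((- + 2) * b + ((- + 1) * c + (+ 1 * d + + 0))) + (c - d)
    poly = solve-∀

-- `τC` and `τD` have two terms each, so E(q) E(Q) U² expands into 4 + 1 + 4 products. Each shift is
-- (r² + 71 r′²) / 120 for the residues r, r′ of its two factors.
τ-identity₂ : (+ 2) · (mono 1 ⊛ (τ 15 11 4 ⊠ τ 15 8 7) ⊕ mono 72 ⊛ (τ 15 11 4 ⊠ τ 15 13 2)
    ⊖ mono 2 ⊛ (τ 15 14 1 ⊠ τ 15 8 7) ⊖ mono 73 ⊛ (τ 15 14 1 ⊠ τ 15 13 2)
    ⊖ (+ 2) · (mono 15 ⊛ (τ₅ ⊠ τ₅))
    ⊕ (mono 29 ⊛ (τ 15 8 7 ⊠ τ 15 11 4) ⊖ mono 100 ⊛ (τ 15 8 7 ⊠ τ 15 14 1)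
       ⊕ mono 30 ⊛ (τ 15 13 2 ⊠ τ 15 11 4) ⊖ mono 101 ⊛ (τ 15 13 2 ⊠ τ 15 14 1)))
  ≈ θ₃ ⊖ θ₂ ⊖ θ₁ ⊕ θ₀
τ-identity₂ .at n = isolate
  ((mono 1 ⊛ (τ 15 11 4 ⊠ τ 15 8 7)) n) ((mono 72 ⊛ (τ 15 11 4 ⊠ τ 15 13 2)) n) ((mono 2 ⊛ (τ 15 14 1 ⊠ τ 15 8 7)) n)
  ((mono 73 ⊛ (τ 15 14 1 ⊠ τ 15 13 2)) n) ((mono 15 ⊛ (τ₅ ⊠ τ₅)) n) ((mono 29 ⊛ (τ 15 8 7 ⊠ τ 15 11 4)) n)
  ((mono 100 ⊛ (τ 15 8 7 ⊠ τ 15 14 1)) n) ((mono 30 ⊛ (τ 15 13 2 ⊠ τ 15 11 4)) n) ((mono 101 ⊛ (τ 15 13 2 ⊠ τ 15 14 1)) n)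
  (θ₃ n) (θ₂ n) (θ₁ n) (θ₀ n)
  (trans (total≡rep ws vs)
    (rep-vanish {diagonal 70} (diagonal-definite 70) 60 120 0 (Q₇₁-periodic 30) signChanges (combination ws) (combination-periodic ws ps) refl n))
  where
  ws : Weights
  ws = (+ 2 , signs 30 30 (+ 7) (+ 1)) ∷ (+ 2 , signs 30 30 (+ 7) (+ 11)) ∷ (- + 2 , signs 30 30 (+ 13) (+ 1))
     ∷ (- + 2 , signs 30 30 (+ 13) (+ 11)) ∷ (- + 4 , signs 30 30 (- + 5) (- + 5)) ∷ (+ 2 , signs 30 30 (+ 1) (+ 7))
     ∷ (- + 2 , signs 30 30 (+ 1) (+ 13)) ∷ (+ 2 , signs 30 30 (+ 11) (+ 7)) ∷ (- + 2 , signs 30 30 (+ 11) (+ 13))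
     ∷ (- + 1 , lattice 60 1 (+ 17)) ∷ (+ 1 , lattice 60 1 (+ 23)) ∷ (+ 1 , lattice 60 1 (+ 13)) ∷ (- + 1 , lattice 60 1 (+ 7)) ∷ []
  term : ∀ {k b b′ k′ c c′ r r′} s → Square k (suc b) (suc b′) 60 30 r → Square k′ (suc c) (suc c′) 60 30 r′ →
    r * r + + 71 * (r′ * r′) ≡ + 0 + + 120 * + s → Value Q₇₁ (120 ℕ.* n) (signs 30 30 r r′)
  term {k} {b} {b′} {k′} {c} {c′} s sq sq′ eq =
    value ((mono s ⊛ (τ k (suc b) (suc b′) ⊠ τ k′ (suc c) (suc c′))) n) (product-rep sq sq′ 120 0 s 71 70 refl refl eq n)
  vs : All (λ cw → Value Q₇₁ (120 ℕ.* n) (proj₂ cw)) ws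
  vs =
        term 1 sqD₁ sqC₁ refl
      ∷ term 72 sqD₁ sqC₂ refl
      ∷ term 2 sqD₂ sqC₁ refl
      ∷ term 73 sqD₂ sqC₂ refl
      ∷ term 15 sq₅ sq₅ refl
      ∷ term 29 sqC₁ sqD₁ refl
      ∷ term 100 sqC₁ sqD₂ refl
      ∷ term 30 sqC₂ sqD₁ refl
      ∷ term 101 sqC₂ sqD₂ refl
      ∷ θ₃-120 n ∷ θ₂-120 n ∷ θ₁-120 n ∷ θ₀-120 n ∷ []
  ps : All (λ cw → Periodic 60 (proj₂ cw)) ws
  ps =
        signs-periodic 30 30 (+ 7) (+ 1) 1 1 refl refl
      ∷ signs-periodic 30 30 (+ 7) (+ 11) 1 1 refl refl
      ∷ signs-periodic 30 30 (+ 13) (+ 1) 1 1 refl refl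
      ∷ signs-periodic 30 30 (+ 13) (+ 11) 1 1 refl refl
      ∷ signs-periodic 30 30 (- + 5) (- + 5) 1 1 refl refl
      ∷ signs-periodic 30 30 (+ 1) (+ 7) 1 1 refl refl
      ∷ signs-periodic 30 30 (+ 1) (+ 13) 1 1 refl refl
      ∷ signs-periodic 30 30 (+ 11) (+ 7) 1 1 refl refl
      ∷ signs-periodic 30 30 (+ 11) (+ 13) 1 1 refl refl
      ∷ lattice-periodic 60 1 1 60 (+ 17) refl refl
      ∷ lattice-periodic 60 1 1 60 (+ 23) refl refl
      ∷ lattice-periodic 60 1 1 60 (+ 13) refl refl
      ∷ lattice-periodic 60 1 1 60 (+ 7) refl refl
      ∷ []
  isolate : ∀ a b c d e f g h i j k l m →
    + 2 * a + (+ 2 * b + ((- + 2) * c + ((- + 2) * d + ((- + 4) * e + (+ 2 * f + ((- + 2) * g + (+ 2 * h + ((- + 2) * i + ((- + 1) * j + (+ 1 * k + (+ 1 * l + ((- + 1) * m + + 0)))))))))))) ≡ + 0 →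
    + 2 * (a + b - c - d - + 2 * e + (f - g + h - i)) ≡ j - k - l + m
  isolate a b c d e f g h i j k l m p = trans (poly a b c d e f g h i j k l m) (trans (cong (_+ (j - k - l + m)) p) (ℤ.+-identityˡ _))
    where
    poly : ∀ a b c d e f g h i j k l m →
      + 2 * (a + b - c - d - + 2 * e + (f - g + h - i))
      ≡ + 2 * a + (+ 2 * b + ((- + 2) * c + ((- + 2) * d + ((- + 4) * e + (+ 2 * f + ((- + 2) * g + (+ 2 * h + ((- + 2) * i + ((- + 1) * j + (+ 1 * k + (+ 1 * l + ((- + 1) * m + + 0)))))))))))) + (j - k - l + m)
    poly = solve-∀

-- 5 divides 71 - 1 and not 71 + 1, so the second case of `U` is selected by computation, with 14 =
-- 70 / 5.
U≈ : U 1 71 ≈ H ⊠ G ⊖ mono 14 ⊛ (G ⊠ H)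
U≈ = ⊖-cong (⊛-congʳ (substPow 71 G) (substPow-1 H))
  (≈-trans (⊛-≈-assoc (mono 14) (substPow 1 G) (substPow 71 H)) (⊛-congˡ (mono 14) (⊛-congʳ (substPow 71 H) (substPow-1 G))))

·-cong : ∀ c {f g} → f ≈ g → c · f ≈ c · g
·-cong c p .at n = cong (_*_ c) (p .at n)

identity₃ : (+ 2) · (mono 2 ⊛ E ⊛ substPow 71 E ⊛ U 1 71) ≈ θ₁ ⊖ θ₃
identity₃ = ≈-trans (·-cong (+ 2) (begin
  mono 2 ⊛ E ⊛ substPow 71 E ⊛ U 1 71
    ≈⟨ ⊛-congˡ (mono 2 ⊛ E ⊛ substPow 71 E) U≈ ⟩
  mono 2 ⊛ E ⊛ substPow 71 E ⊛ (H ⊠ G ⊖ mono 14 ⊛ (G ⊠ H))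
    ≈⟨ solve 8 (λ m e e′ h g′ m′ g h′ → m :* e :* e′ :* (h :* g′ :- m′ :* (g :* h′))
         := m :* ((e :* h) :* (e′ :* g′)) :- (m :* m′) :* ((e :* g) :* (e′ :* h′))) ≈-refl
         (mono 2) E (substPow 71 E) H (substPow 71 G) (mono 14) G (substPow 71 H) ⟩
  mono 2 ⊛ (E ⊛ H ⊛ (substPow 71 E ⊛ substPow 71 G)) ⊖ mono 2 ⊛ mono 14 ⊛ (E ⊛ G ⊛ (substPow 71 E ⊛ substPow 71 H))
    ≈⟨ ⊖-cong (⊛-congˡ (mono 2) (⊛-cong E⊛H≈τ (≈-trans (≈-sym (substPow-⊛ 71 E G)) (substPow-cong 71 E⊛G≈τ))))
              (⊛-cong (mono-+ 2 14) (⊛-cong E⊛G≈τ (≈-trans (≈-sym (substPow-⊛ 71 E H)) (substPow-cong 71 E⊛H≈τ)))) ⟩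
  mono 2 ⊛ (τB ⊠ τA) ⊖ mono 16 ⊛ (τA ⊠ τB) ∎)) τ-identity₃

-- Expanding the square distributes one E and a quadratic monomial in G, H to each of the variables
-- q and Q: H² with G², G H with G H, and G² with H².
identity₂ : (+ 2) · (mono 1 ⊛ E ⊛ substPow 71 E ⊛ U 1 71 ⊛ U 1 71) ≈ θ₃ ⊖ θ₂ ⊖ θ₁ ⊕ θ₀
identity₂ = ≈-trans (·-cong (+ 2) (begin
  mono 1 ⊛ E ⊛ S E ⊛ U 1 71 ⊛ U 1 71
    ≈⟨ ⊛-cong (⊛-congˡ (mono 1 ⊛ E ⊛ S E) U≈) U≈ ⟩
  mono 1 ⊛ E ⊛ S E ⊛ (H ⊠ G ⊖ mono 14 ⊛ (G ⊠ H)) ⊛ (H ⊠ G ⊖ mono 14 ⊛ (G ⊠ H))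
    ≈⟨ solve 8 (λ m e e′ h g′ m′ g h′ → m :* e :* e′ :* (h :* g′ :- m′ :* (g :* h′)) :* (h :* g′ :- m′ :* (g :* h′))
         := m :* ((e :* h :* h) :* (e′ :* g′ :* g′)) :- con (+ 2) :* ((m :* m′) :* ((e :* g :* h) :* (e′ :* g′ :* h′)))
            :+ (m :* m′) :* m′ :* ((e :* g :* g) :* (e′ :* h′ :* h′))) ≈-refl
         (mono 1) E (S E) H (S G) (mono 14) G (S H) ⟩
  mono 1 ⊛ (E ⊛ H ⊛ H ⊛ (S E ⊛ S G ⊛ S G)) ⊖ const (+ 2) ⊛ (mono 1 ⊛ mono 14 ⊛ (E ⊛ G ⊛ H ⊛ (S E ⊛ S G ⊛ S H)))
    ⊕ mono 1 ⊛ mono 14 ⊛ mono 14 ⊛ (E ⊛ G ⊛ G ⊛ (S E ⊛ S H ⊛ S H))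
    ≈⟨ ⊕-cong (⊖-cong (⊛-congˡ (mono 1) (⊛-cong E⊛H⊛H (S₃ G G E⊛G⊛G)))
                      (⊛-congˡ (const (+ 2)) (⊛-cong (mono-+ 1 14) (⊛-cong E⊛G⊛H (S₃ G H E⊛G⊛H)))))
              (⊛-cong (≈-trans (⊛-congʳ (mono 14) (mono-+ 1 14)) (mono-+ 15 14)) (⊛-cong E⊛G⊛G (S₃ H H E⊛H⊛H))) ⟩
  mono 1 ⊛ (τD ⊠ τC) ⊖ const (+ 2) ⊛ (mono 15 ⊛ (τ₅ ⊠ τ₅)) ⊕ mono 29 ⊛ (τC ⊠ τD)
    ≈⟨ ⊕-cong (⊖-cong (⊛-congˡ (mono 1) (⊛-congˡ τD SC)) (const-⊛ (+ 2) (mono 15 ⊛ (τ₅ ⊠ τ₅)))) (⊛-congˡ (mono 29) (⊛-congˡ τC SD)) ⟩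
  mono 1 ⊛ ((D₁ ⊖ mono 1 ⊛ D₂) ⊛ (S C₁ ⊕ mono 71 ⊛ S C₂)) ⊖ (+ 2) · (mono 15 ⊛ (τ₅ ⊠ τ₅))
    ⊕ mono 29 ⊛ ((C₁ ⊕ mono 1 ⊛ C₂) ⊛ (S D₁ ⊖ mono 71 ⊛ S D₂))
    ≈⟨ ⊕-cong (⊖-cong expand₁ (≈-refl {(+ 2) · (mono 15 ⊛ (τ₅ ⊠ τ₅))})) expand₂ ⟩
  mono 1 ⊛ (D₁ ⊠ C₁) ⊕ mono 72 ⊛ (D₁ ⊠ C₂) ⊖ mono 2 ⊛ (D₂ ⊠ C₁) ⊖ mono 73 ⊛ (D₂ ⊠ C₂)
    ⊖ (+ 2) · (mono 15 ⊛ (τ₅ ⊠ τ₅))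
    ⊕ (mono 29 ⊛ (C₁ ⊠ D₁) ⊖ mono 100 ⊛ (C₁ ⊠ D₂) ⊕ mono 30 ⊛ (C₂ ⊠ D₁) ⊖ mono 101 ⊛ (C₂ ⊠ D₂)) ∎)) τ-identity₂
  where
  S : PS → PS
  S = substPow 71
  C₁ C₂ D₁ D₂ : PS
  C₁ = τ 15 8 7
  C₂ = τ 15 13 2
  D₁ = τ 15 11 4
  D₂ = τ 15 14 1
  S₃ : ∀ f g {h} → E ⊛ f ⊛ g ≈ h → S E ⊛ S f ⊛ S g ≈ S h
  S₃ f g p = ≈-trans (⊛-congʳ (S g) (≈-sym (substPow-⊛ 71 E f))) (≈-trans (≈-sym (substPow-⊛ 71 (E ⊛ f) g)) (substPow-cong 71 p))
  Sq : ∀ f → S (mono 1 ⊛ f) ≈ mono 71 ⊛ S f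
  Sq f = ≈-trans (substPow-⊛ 71 (mono 1) f) (⊛-congʳ (S f) (substPow-mono 71 1))
  SC : S τC ≈ S C₁ ⊕ mono 71 ⊛ S C₂
  SC = ≈-trans (substPow-⊕ 71 C₁ (mono 1 ⊛ C₂)) (⊕-congˡ (S C₁) (Sq C₂))
  SD : S τD ≈ S D₁ ⊖ mono 71 ⊛ S D₂
  SD = ≈-trans (substPow-⊖ 71 D₁ (mono 1 ⊛ D₂)) (⊖-cong (≈-refl {S D₁}) (Sq D₂))
  expand₁ : mono 1 ⊛ ((D₁ ⊖ mono 1 ⊛ D₂) ⊛ (S C₁ ⊕ mono 71 ⊛ S C₂))
            ≈ mono 1 ⊛ (D₁ ⊠ C₁) ⊕ mono 72 ⊛ (D₁ ⊠ C₂) ⊖ mono 2 ⊛ (D₂ ⊠ C₁) ⊖ mono 73 ⊛ (D₂ ⊠ C₂)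
  expand₁ = ≈-trans
    (solve 6 (λ m m′ a b c d → m :* ((a :- m :* b) :* (c :+ m′ :* d))
       := m :* (a :* c) :+ (m :* m′) :* (a :* d) :- (m :* m) :* (b :* c) :- (m :* m) :* m′ :* (b :* d)) ≈-refl
       (mono 1) (mono 71) D₁ D₂ (S C₁) (S C₂))
    (⊖-cong (⊖-cong (⊕-congˡ (mono 1 ⊛ (D₁ ⊠ C₁)) (⊛-congʳ (D₁ ⊠ C₂) (mono-+ 1 71))) (⊛-congʳ (D₂ ⊠ C₁) (mono-+ 1 1)))
            (⊛-congʳ (D₂ ⊠ C₂) (≈-trans (⊛-congʳ (mono 71) (mono-+ 1 1)) (mono-+ 2 71))))
  expand₂ : mono 29 ⊛ ((C₁ ⊕ mono 1 ⊛ C₂) ⊛ (S D₁ ⊖ mono 71 ⊛ S D₂))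
            ≈ mono 29 ⊛ (C₁ ⊠ D₁) ⊖ mono 100 ⊛ (C₁ ⊠ D₂) ⊕ mono 30 ⊛ (C₂ ⊠ D₁) ⊖ mono 101 ⊛ (C₂ ⊠ D₂)
  expand₂ = ≈-trans
    (solve 7 (λ n m m′ a b c d → n :* ((a :+ m :* b) :* (c :- m′ :* d))
       := n :* (a :* c) :- (n :* m′) :* (a :* d) :+ (n :* m) :* (b :* c) :- (n :* m) :* m′ :* (b :* d)) ≈-refl
       (mono 29) (mono 1) (mono 71) C₁ C₂ (S D₁) (S D₂))
    (⊖-cong (⊕-cong (⊖-cong (≈-refl {mono 29 ⊛ (C₁ ⊠ D₁)}) (⊛-congʳ (C₁ ⊠ D₂) (mono-+ 29 71))) (⊛-congʳ (C₂ ⊠ D₁) (mono-+ 29 1)))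
            (⊛-congʳ (C₂ ⊠ D₂) (≈-trans (⊛-congʳ (mono 71) (mono-+ 29 1)) (mono-+ 30 71))))

-- The identity for U(q²)

substPow-multiple : ∀ k .{{_ : NonZero k}} f m → substPow k f (m ℕ.* k) ≡ f m
substPow-multiple k f m = cong₂ (λ a b → if a ≡ᵇ 0 then f b else + 0) (ℕ.m*n%n≡0 m k) (ℕ.m*n/n≡m m k)

substPow-nonmultiple : ∀ k .{{_ : NonZero k}} f n → (∀ m → ¬ n ≡ m ℕ.* k) → substPow k f n ≡ + 0
substPow-nonmultiple k f n no-multiple with n % k in eq
... | suc _ = refl
... | zero  = ⊥-elim (no-multiple (n / k) (trans (ℕ.m≡m%n+[m/n]*n n k) (cong (ℕ._+ n / k ℕ.* k) eq)))

data Multiple (k n : ℕ) : Set where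
  multiple    : ∀ m → n ≡ m ℕ.* k → Multiple k n
  nonmultiple : (∀ m → ¬ n ≡ m ℕ.* k) → Multiple k n

multiple? : ∀ k .{{_ : NonZero k}} n → Multiple k n
multiple? k n with n % k ℕ.≟ 0
... | yes eq = multiple (n / k) (trans (ℕ.m≡m%n+[m/n]*n n k) (cong (ℕ._+ n / k ℕ.* k) eq))
... | no  ne = nonmultiple λ { m refl → ne (ℕ.m*n%n≡0 m k) }

substPow-substPow : ∀ a b c .{{_ : NonZero a}} .{{_ : NonZero b}} .{{_ : NonZero c}} → b ℕ.* a ≡ c →
  ∀ f → substPow a (substPow b f) ≈ substPow c f
substPow-substPow a b c ba≡c f .at n with multiple? a n
... | nonmultiple none = trans (substPow-nonmultiple a (substPow b f) n none)
      (sym (substPow-nonmultiple c f n (λ m eq → none (m ℕ.* b) (trans eq (trans (cong (m ℕ.*_) (sym ba≡c)) (sym (ℕ.*-assoc m b a)))))))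
... | multiple m refl with multiple? b m
...   | multiple l refl  = trans (substPow-multiple a (substPow b f) (l ℕ.* b)) (trans (substPow-multiple b f l)
          (sym (trans (cong (substPow c f) (trans (ℕ.*-assoc l b a) (cong (l ℕ.*_) ba≡c))) (substPow-multiple c f l))))
...   | nonmultiple none = trans (substPow-multiple a (substPow b f) m) (trans (substPow-nonmultiple b f m none)
          (sym (substPow-nonmultiple c f (m ℕ.* a) (λ l eq → none l (ℕ.*-cancelʳ-≡ m (l ℕ.* b) a
            (trans eq (trans (cong (l ℕ.*_) (sym ba≡c)) (sym (ℕ.*-assoc l b a)))))))))

substPow-comm : ∀ a b .{{_ : NonZero a}} .{{_ : NonZero b}} f → substPow a (substPow b f) ≈ substPow b (substPow a f)
substPow-comm a b f = ≈-trans (substPow-substPow a b (b ℕ.* a) {{_}} {{_}} {{ℕ.m*n≢0 b a}} refl f)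
  (≈-sym (substPow-substPow b a (b ℕ.* a) {{_}} {{_}} {{ℕ.m*n≢0 b a}} (ℕ.*-comm a b) f))

negArg-sg : ∀ f n → negArg f n ≡ sg n * f n
negArg-sg f zero    = sym (ℤ.*-identityˡ (f 0))
negArg-sg f (suc n) = trans (negArg-suc f n) (trans (cong -_ (negArg-sg (f ∘ suc) n)) (ℤ.neg-distribˡ-* (sg n) (f (suc n))))

sg-odd : ∀ k m → sg (m ℕ.* suc (k ℕ.* 2)) ≡ sg m
sg-odd k m = trans (cong sgn (trans (cong +_ (expand m k)) (cast m (m ℕ.* k)))) (sgn-even (+ m) (+ (m ℕ.* k)))
  where
  expand : ∀ m k → m ℕ.* suc (k ℕ.* 2) ≡ m ℕ.+ m ℕ.* k ℕ.* 2
  expand = ℕ-solve-∀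
  cast : ∀ m j → + (m ℕ.+ j ℕ.* 2) ≡ + m + + j * + 2
  cast m j = trans (ℤ.pos-+ m (j ℕ.* 2)) (cong (_+_ (+ m)) (ℤ.pos-* j 2))

-- (-q)^o = -(q^o) for odd o. It is applied with o = 71, hence with the argument 35.
negArg-substPow-odd : ∀ k f → negArg (substPow (suc (k ℕ.* 2)) f) ≈ substPow (suc (k ℕ.* 2)) (negArg f)
negArg-substPow-odd k f .at n = trans (negArg-sg (substPow o f) n) (go (multiple? o n))
  where
  o : ℕ
  o = suc (k ℕ.* 2)
  go : Multiple o n → sg n * substPow o f n ≡ substPow o (negArg f) n
  go (multiple m refl)  = trans (cong₂ _*_ (sg-odd k m) (substPow-multiple o f m))
    (trans (sym (negArg-sg f m)) (sym (substPow-multiple o (negArg f) m)))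
  go (nonmultiple none) = trans (cong (_*_ (sg n)) (substPow-nonmultiple o f n none))
    (trans (ℤ.*-zeroʳ (sg n)) (sym (substPow-nonmultiple o (negArg f) n none)))

-- `P ⊕ negArg P` is twice the even part of P. As 2 P = θ₃ - θ₂, its coefficient at 2m is that of θ₃
-- - θ₂ at 2m, which `hecke` rewrites through coefficients at m and m / 2.
halve : ∀ P → (+ 2) · P ≈ θ₃ ⊖ θ₂ →
  substPow 2 (θ₁ ⊖ θ₃) ≈ ⊝ substPow 2 (θ₃ ⊖ θ₂) ⊖ (P ⊕ negArg P) ⊖ substPow 2 (substPow 2 (θ₃ ⊖ θ₂))
halve P 2P .at n with (n % 2) ≡ᵇ 0 in eq
... | false = sym (poly (P n))
  where
  poly : ∀ p → - (+ 0) - (p + - p) - + 0 ≡ + 0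
  poly = solve-∀
... | true = sym (trans (cong₂ (λ a b → - (θ₃ m - θ₂ m) - a - b) even (substPow-⊖ 2 θ₃ θ₂ .at m))
                   (poly (θ₁ m) (θ₂ m) (θ₃ m) (substPow 2 θ₃ m - substPow 2 θ₂ m)))
  where
  m : ℕ
  m = n / 2
  n≡ : n ≡ m ℕ.* 2
  n≡ = ℤ.+-injective (trans (divisible 2 (+ n) eq) (sym (ℤ.pos-* m 2)))
  double : ∀ p → p + p ≡ + 2 * p
  double = solve-∀
  even : P n + P n ≡ θ₂ m - θ₁ m - (substPow 2 θ₃ m - substPow 2 θ₂ m)
  even = trans (double (P n)) (trans (2P .at n) (trans (cong (λ k → θ₃ k - θ₂ k) n≡) (hecke m)))
  poly : ∀ a b c d → - (c - b) - (b - a - d) - d ≡ a - c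
  poly = solve-∀

negArg-mono-3 : ∀ f → negArg (mono 3 ⊛ f) ≈ ⊝ (mono 3 ⊛ negArg f)
negArg-mono-3 f = ≈-trans (negArg-⊛ (mono 3) f) (≈-trans (⊛-congʳ (negArg f) (negArg-mono-odd 1))
  (solve 2 (λ m f → (:- m) :* f := :- (m :* f)) ≈-refl (mono 3) (negArg f)))

-- κ(q) E(q²) = E(-q) in both variables. This is the reason for multiplying the identity for U(q²)
-- by E(q²) E(Q²).
κ⊠κ : κ ⊠ κ ⊛ substPow 2 (E ⊠ E) ≈ negArg (E ⊠ E)
κ⊠κ = begin
  κ ⊠ κ ⊛ substPow 2 (E ⊠ E)
    ≈⟨ ⊛-congˡ (κ ⊠ κ) (≈-trans (substPow-⊛ 2 E (substPow 71 E)) (⊛-congˡ (substPow 2 E) (substPow-comm 2 71 E))) ⟩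
  κ ⊠ κ ⊛ (substPow 2 E ⊛ substPow 71 (substPow 2 E))
    ≈⟨ solve 4 (λ k k′ e e′ → k :* k′ :* (e :* e′) := (k :* e) :* (k′ :* e′)) ≈-refl κ (substPow 71 κ) (substPow 2 E) (substPow 71 (substPow 2 E)) ⟩
  κ ⊛ substPow 2 E ⊛ (substPow 71 κ ⊛ substPow 71 (substPow 2 E))
    ≈⟨ ⊛-cong κ⊛E (≈-trans (≈-sym (substPow-⊛ 71 κ (substPow 2 E))) (≈-trans (substPow-cong 71 κ⊛E) (≈-sym (negArg-substPow-odd 35 E)))) ⟩
  negArg E ⊛ negArg (substPow 71 E)
    ≈⟨ negArg-⊛ E (substPow 71 E) ⟨
  negArg (E ⊠ E) ∎

negArg-κ⊠κ : negArg κ ⊛ negArg (substPow 71 κ) ⊛ substPow 2 (E ⊠ E) ≈ E ⊠ E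
negArg-κ⊠κ = begin
  negArg κ ⊛ negArg (substPow 71 κ) ⊛ substPow 2 (E ⊠ E)
    ≈⟨ ⊛-cong (≈-sym (negArg-⊛ κ (substPow 71 κ))) (≈-sym (negArg-substPow-2 (E ⊠ E))) ⟩
  negArg (κ ⊠ κ) ⊛ negArg (substPow 2 (E ⊠ E))
    ≈⟨ negArg-⊛ (κ ⊠ κ) (substPow 2 (E ⊠ E)) ⟨
  negArg (κ ⊠ κ ⊛ substPow 2 (E ⊠ E))
    ≈⟨ negArg-cong κ⊠κ ⟩
  negArg (negArg (E ⊠ E))
    ≈⟨ negArg-involutive (E ⊠ E) ⟩
  E ⊠ E ∎

κκ : PS
κκ = substPow 2 (negArg κ) ⊛ substPow 142 (negArg κ)

substPow-142 : ∀ f → substPow 142 f ≈ substPow 2 (substPow 71 f)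
substPow-142 f = ≈-sym (substPow-substPow 2 71 142 refl f)

-- κ(-q) E(q²) = E(q) with q² for q, in both variables: dividing E(q²) E(Q²) by `κκ` leaves E(q⁴)
-- E(Q⁴).
κκ⊛ : κκ ⊛ substPow 2 (substPow 2 (E ⊠ E)) ≈ substPow 2 (E ⊠ E)
κκ⊛ = begin
  κκ ⊛ substPow 2 (substPow 2 (E ⊠ E))
    ≈⟨ ⊛-cong (≈-trans (⊛-congˡ (substPow 2 (negArg κ)) (substPow-142 (negArg κ))) (≈-sym (substPow-⊛ 2 (negArg κ) (substPow 71 (negArg κ)))))
              (≈-refl {substPow 2 (substPow 2 (E ⊠ E))}) ⟩
  substPow 2 (negArg κ ⊠ negArg κ) ⊛ substPow 2 (substPow 2 (E ⊠ E))
    ≈⟨ substPow-⊛ 2 (negArg κ ⊠ negArg κ) (substPow 2 (E ⊠ E)) ⟨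
  substPow 2 (negArg κ ⊠ negArg κ ⊛ substPow 2 (E ⊠ E))
    ≈⟨ substPow-cong 2 (≈-trans (⊛-congʳ (substPow 2 (E ⊠ E)) (⊛-congˡ (negArg κ) (≈-sym (negArg-substPow-odd 35 κ)))) negArg-κ⊠κ) ⟩
  substPow 2 (E ⊠ E) ∎

-- After multiplication by q³ E(q²) E(Q²), the left side is `identity₃` at q², and the four terms on
-- the right are `identity₁` at q², -q, q and q⁴, up to sign and a factor 2. What remains between
-- the theta series is `halve`.
identity₄ : (+ 2) · (mono 1 ⊛ substPow 2 (U 1 71))
  ≈ (- (+ 2)) · mono 3 ⊕ κ ⊛ substPow 71 κ ⊖ negArg κ ⊛ negArg (substPow 71 κ) ⊖ (+ 2) · (mono 9 ⊛ inv1 κκ)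
identity₄ = mono-cancel 3 (inv-cancel Z refl (begin
  Z ⊛ (mono 3 ⊛ ((+ 2) · (mono 1 ⊛ u)))
    ≈⟨ scaled ⟩
  substPow 2 (θ₁ ⊖ θ₃)
    ≈⟨ halve P 2P ⟩
  ⊝ substPow 2 (θ₃ ⊖ θ₂) ⊖ (P ⊕ negArg P) ⊖ substPow 2 (substPow 2 (θ₃ ⊖ θ₂))
    ≈⟨ ⊖-cong (⊖-cong (⊝-cong (≈-sym S2P)) (⊕-congˡ P (negArg-mono-3 (E ⊠ E)))) (≈-sym S4P) ⟩
  ⊝ (const (+ 2) ⊛ (mono 6 ⊛ Z)) ⊖ (P ⊕ ⊝ (mono 3 ⊛ negArg (E ⊠ E))) ⊖ const (+ 2) ⊛ (mono 12 ⊛ W)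
    ≈⟨ ⊖-cong (⊖-cong (⊝-cong (⊛-congˡ (const (+ 2)) (⊛-congʳ Z (mono-split 3 3 refl))))
                      (⊕-cong (⊛-congˡ (mono 3) (≈-sym negArg-κ⊠κ)) (⊝-cong (⊛-congˡ (mono 3) (≈-sym κ⊠κ)))))
              (⊛-congˡ (const (+ 2)) (⊛-cong (mono-split 3 9 refl) W≈)) ⟩
  ⊝ (const (+ 2) ⊛ (mono 3 ⊛ mono 3 ⊛ Z)) ⊖ (mono 3 ⊛ (k′ ⊛ Z) ⊕ ⊝ (mono 3 ⊛ (k ⊛ Z))) ⊖ const (+ 2) ⊛ (mono 3 ⊛ mono 9 ⊛ (Z ⊛ inv1 κκ))
    ≈⟨ solve 6 (λ m z k k′ m₉ i → :- (con (+ 2) :* (m :* m :* z)) :- (m :* (k′ :* z) :+ (:- (m :* (k :* z)))) :- con (+ 2) :* (m :* m₉ :* (z :* i))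
         := z :* (m :* (con (- + 2) :* m :+ k :- k′ :- con (+ 2) :* (m₉ :* i)))) ≈-refl (mono 3) Z k k′ (mono 9) (inv1 κκ) ⟩
  Z ⊛ (mono 3 ⊛ (const (- + 2) ⊛ mono 3 ⊕ k ⊖ k′ ⊖ const (+ 2) ⊛ (mono 9 ⊛ inv1 κκ)))
    ≈⟨ ⊛-congˡ Z (⊛-congˡ (mono 3) (⊖-cong (⊖-cong (⊕-congʳ k (const-⊛ (- + 2) (mono 3))) (≈-refl {k′})) (const-⊛ (+ 2) (mono 9 ⊛ inv1 κκ)))) ⟩
  Z ⊛ (mono 3 ⊛ ((- + 2) · mono 3 ⊕ k ⊖ k′ ⊖ (+ 2) · (mono 9 ⊛ inv1 κκ))) ∎))
  where
  Z W P u k k′ : PS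
  Z  = substPow 2 (E ⊠ E)
  W  = substPow 2 Z
  P  = mono 3 ⊛ (E ⊠ E)
  u  = substPow 2 (U 1 71)
  k  = κ ⊠ κ
  k′ = negArg κ ⊛ negArg (substPow 71 κ)
  2P : (+ 2) · P ≈ θ₃ ⊖ θ₂
  2P = identity₁
  S2-2mono : ∀ a f → substPow 2 ((+ 2) · (mono a ⊛ f)) ≈ const (+ 2) ⊛ (mono (2 ℕ.* a) ⊛ substPow 2 f)
  S2-2mono a f = ≈-trans (substPow-· 2 (+ 2) (mono a ⊛ f)) (≈-trans (≈-sym (const-⊛ (+ 2) (substPow 2 (mono a ⊛ f))))
    (⊛-congˡ (const (+ 2)) (≈-trans (substPow-⊛ 2 (mono a) f) (⊛-congʳ (substPow 2 f) (substPow-mono 2 a)))))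
  S2P : const (+ 2) ⊛ (mono 6 ⊛ Z) ≈ substPow 2 (θ₃ ⊖ θ₂)
  S2P = ≈-trans (≈-sym (S2-2mono 3 (E ⊠ E))) (substPow-cong 2 2P)
  S4P : const (+ 2) ⊛ (mono 12 ⊛ W) ≈ substPow 2 (substPow 2 (θ₃ ⊖ θ₂))
  S4P = ≈-trans (≈-sym (≈-trans (substPow-cong 2 (const-⊛ (+ 2) (mono 6 ⊛ Z))) (S2-2mono 6 Z))) (substPow-cong 2 S2P)
  scaled : Z ⊛ (mono 3 ⊛ ((+ 2) · (mono 1 ⊛ u))) ≈ substPow 2 (θ₁ ⊖ θ₃)
  scaled = begin
    Z ⊛ (mono 3 ⊛ ((+ 2) · (mono 1 ⊛ u)))
      ≈⟨ ⊛-congˡ Z (⊛-congˡ (mono 3) (≈-sym (const-⊛ (+ 2) (mono 1 ⊛ u)))) ⟩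
    Z ⊛ (mono 3 ⊛ (const (+ 2) ⊛ (mono 1 ⊛ u)))
      ≈⟨ solve 4 (λ z m m′ u → z :* (m :* (con (+ 2) :* (m′ :* u))) := con (+ 2) :* ((m :* m′) :* (z :* u))) ≈-refl Z (mono 3) (mono 1) u ⟩
    const (+ 2) ⊛ (mono 3 ⊛ mono 1 ⊛ (Z ⊛ u))
      ≈⟨ ⊛-congˡ (const (+ 2)) (⊛-cong (mono-+ 3 1) (≈-sym (substPow-⊛ 2 (E ⊠ E) (U 1 71)))) ⟩
    const (+ 2) ⊛ (mono 4 ⊛ substPow 2 (E ⊠ E ⊛ U 1 71))
      ≈⟨ S2-2mono 2 (E ⊠ E ⊛ U 1 71) ⟨
    substPow 2 ((+ 2) · (mono 2 ⊛ (E ⊠ E ⊛ U 1 71)))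
      ≈⟨ substPow-cong 2 (≈-trans (·-cong (+ 2) (solve 4 (λ m e e′ u → m :* (e :* e′ :* u) := m :* e :* e′ :* u) ≈-refl (mono 2) E (substPow 71 E) (U 1 71))) identity₃) ⟩
    substPow 2 (θ₁ ⊖ θ₃) ∎
  W≈ : W ≈ Z ⊛ inv1 κκ
  W≈ = ≈-sym (begin
    Z ⊛ inv1 κκ              ≈⟨ ⊛-congʳ (inv1 κκ) (≈-sym κκ⊛) ⟩
    κκ ⊛ W ⊛ inv1 κκ         ≈⟨ solve 3 (λ k w i → k :* w :* i := (k :* i) :* w) ≈-refl κκ W (inv1 κκ) ⟩
    κκ ⊛ inv1 κκ ⊛ W         ≈⟨ ⊛-congʳ W (inv1-inverse {κκ} refl) ⟩
    𝟙 ⊛ W                    ≈⟨ ⊛-identityˡ W ⟩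
    W                        ∎)

-- The first factor carries q U², the second q³, and each factor on the right q² U; as q · q³ = q² ·
-- q², both products are 4 q⁴ (E(q) E(Q) U)².
identity₅ : (θ₃ ⊖ θ₂ ⊖ θ₁ ⊕ θ₀) ⊛ (θ₃ ⊖ θ₂) ≈ (θ₁ ⊖ θ₃) ⊛ (θ₁ ⊖ θ₃)
identity₅ = begin
  (θ₃ ⊖ θ₂ ⊖ θ₁ ⊕ θ₀) ⊛ (θ₃ ⊖ θ₂)
    ≈⟨ ⊛-cong (≈-trans (≈-sym identity₂) (≈-sym (const-⊛ (+ 2) (mono 1 ⊛ E ⊛ e′ ⊛ u ⊛ u))))
              (≈-trans (≈-sym identity₁) (≈-sym (const-⊛ (+ 2) (mono 3 ⊛ (E ⊠ E))))) ⟩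
  const (+ 2) ⊛ (mono 1 ⊛ E ⊛ e′ ⊛ u ⊛ u) ⊛ (const (+ 2) ⊛ (mono 3 ⊛ (E ⊛ e′)))
    ≈⟨ solve 5 (λ m m′ e e′ u → con (+ 2) :* (m :* e :* e′ :* u :* u) :* (con (+ 2) :* (m′ :* (e :* e′)))
         := con (+ 4) :* ((m :* m′) :* (e :* e′ :* u :* (e :* e′ :* u)))) ≈-refl (mono 1) (mono 3) E e′ u ⟩
  const (+ 4) ⊛ (mono 1 ⊛ mono 3 ⊛ (E ⊛ e′ ⊛ u ⊛ (E ⊛ e′ ⊛ u)))
    ≈⟨ ⊛-congˡ (const (+ 4)) (⊛-congʳ (E ⊛ e′ ⊛ u ⊛ (E ⊛ e′ ⊛ u)) (≈-trans (mono-+ 1 3) (≈-sym (mono-+ 2 2)))) ⟩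
  const (+ 4) ⊛ (mono 2 ⊛ mono 2 ⊛ (E ⊛ e′ ⊛ u ⊛ (E ⊛ e′ ⊛ u)))
    ≈⟨ solve 4 (λ m e e′ u → con (+ 4) :* ((m :* m) :* (e :* e′ :* u :* (e :* e′ :* u)))
         := con (+ 2) :* (m :* e :* e′ :* u) :* (con (+ 2) :* (m :* e :* e′ :* u))) ≈-refl (mono 2) E e′ u ⟩
  const (+ 2) ⊛ (mono 2 ⊛ E ⊛ e′ ⊛ u) ⊛ (const (+ 2) ⊛ (mono 2 ⊛ E ⊛ e′ ⊛ u))
    ≈⟨ ⊛-cong (≈-trans (const-⊛ (+ 2) (mono 2 ⊛ E ⊛ e′ ⊛ u)) identity₃) (≈-trans (const-⊛ (+ 2) (mono 2 ⊛ E ⊛ e′ ⊛ u)) identity₃) ⟩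
  (θ₁ ⊖ θ₃) ⊛ (θ₁ ⊖ θ₃) ∎
  where
  e′ u : PS
  e′ = substPow 71 E
  u  = U 1 71

theorem4p3 : ((+ 2) · (mono 3 ⊛ E ⊛ substPow 71 E) ≐ ⟪ 3 , 1 , 6 ⟫ ⊖ ⟪ 4 , 3 , 5 ⟫)
    × ((+ 2) · (mono 1 ⊛ E ⊛ substPow 71 E ⊛ U 1 71 ⊛ U 1 71)
    ≐ ⟪ 3 , 1 , 6 ⟫ ⊖ ⟪ 4 , 3 , 5 ⟫ ⊖ ⟪ 2 , 1 , 9 ⟫ ⊕ ⟪ 1 , 1 , 18 ⟫)
    × ((+ 2) · (mono 2 ⊛ E ⊛ substPow 71 E ⊛ U 1 71) ≐ ⟪ 2 , 1 , 9 ⟫ ⊖ ⟪ 3 , 1 , 6 ⟫)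
    × ((+ 2) · (mono 1 ⊛ substPow 2 (U 1 71))
    ≐ (- (+ 2)) · mono 3 ⊕ κ ⊛ substPow 71 κ ⊖ negArg κ ⊛ negArg (substPow 71 κ)
    ⊖ (+ 2) · (mono 9 ⊛ inv1 (substPow 2 (negArg κ) ⊛ substPow 142 (negArg κ))))
    × ((⟪ 3 , 1 , 6 ⟫ ⊖ ⟪ 4 , 3 , 5 ⟫ ⊖ ⟪ 2 , 1 , 9 ⟫ ⊕ ⟪ 1 , 1 , 18 ⟫) ⊛ (⟪ 3 , 1 , 6 ⟫ ⊖ ⟪ 4 , 3 , 5 ⟫)
    ≐ (⟪ 2 , 1 , 9 ⟫ ⊖ ⟪ 3 , 1 , 6 ⟫) ⊛ (⟪ 2 , 1 , 9 ⟫ ⊖ ⟪ 3 , 1 , 6 ⟫))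
theorem4p3 =
    ≈-trans (·-cong (+ 2) (⊛-≈-assoc (mono 3) E (substPow 71 E))) identity₁ .at
  , identity₂ .at
  , identity₃ .at
  , identity₄ .at
  , identity₅ .at
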